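{- Let $G$ be a connected locally finite infinite graph with girth at least $6$. Then $\mathrm{DN}_{\mathrm{LLY}}(G)<\infty$ if and only if exactly one of the following holds: (i) $G$ is a double ray; (ii) $G$ is obtained from a finite tree by attaching one ray.
   Context: Graphs are simple and undirected; the girth of a forest is infinite. Let $d(\cdot,\cdot)$ be the combinatorial graph distance. For a positive edge weight $w:E\to(0,\infty)$ put $d_x^w:=\sum_{y\sim x}w_{xy}$. For $\alpha\in[0,1]$ let $\mu_x^{\alpha,w}$ be the probability measure with $\mu_x^{\alpha,w}(x)=\alpha$, $\mu_x^{\alpha,w}(z)=(1-\alpha)w_{xz}/d_x^w$ for $z\sim x$, and $0$ otherwise. Let $W_1$ be the $1$-Wasserstein distance with respect to $d$. For $x\sim y$ let $\kappa_\alpha^w(x,y):=1-W_1(\mu_x^{\alpha,w},\mu_y^{\alpha,w})$ and define the weighted Lin--Lu--Yau curvature $\kappa_{\mathrm{LLY}}^w(x,y):=\lim_{\alpha\to1^- }\kappa_\alpha^w(x,y)/(1-\alpha)$. For connected locally finite $G$ with $E\neq\varnothing$: $\mathrm{Dist}(w):=\sup_{e\in E}w_e/\inf_{e\in E}w_e$, with value $+\infty$ if the supremum is infinite or the infimum is $0$; a positive weight $w$ is admissible if $\kappa_{\mathrm{LLY}}^w(e)\ge0$ for every $e\in E$; and $\mathrm{DN}_{\mathrm{LLY}}(G):=\inf\{\mathrm{Dist}(w): w \text{ admissible}\}$, with value $+\infty$ if no admissible weight has finite distortion. A ray is a one-way infinite simple path $v_0v_1v_2\cdots$; a double ray is a two-way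 infinite simple path indexed by $\mathbb Z$. "Obtained from a finite tree $K$ by attaching one ray" means: $G$ is the disjoint union of a finite tree $K$ (possibly a single vertex) and a ray $R$, together with one edge joining a vertex of $K$ to the initial vertex of $R$ (so all vertices of $R$ have degree $2$ in $G$). -}

module Defs where

open import Algebra.Bundles using (CommutativeRing)
import Algebra.Definitions.RawMonoid as RawMonoidDefs
open import Axiom.ExcludedMiddle using (ExcludedMiddle)
open import Data.Empty using (⊥-elim)
open import Data.Fin.Base using (Fin; zero; suc; inject₁; fromℕ)
import Data.Integer.Base as ℤ
import Data.Integer.Properties as ℤₚ
open import Data.List.Base using (List; map; foldr)
open import Data.List.Membership.Propositional using (_∈_)
open import Data.List.Relation.Unary.Unique.Propositional using (Unique)
open import Data.Nat.Base as ℕ using (ℕ; zero; suc; z≤n; s≤s)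
import Data.Nat.Properties as ℕₚ
open import Data.Product.Base using (Σ; ∃; ∃₂; _×_; _,_; proj₁; proj₂)
open import Data.Sum.Base using (_⊎_; inj₁; inj₂; swap)
open import Function.Base using (_∘_)
open import Function.Bundles using (_↔_; _⇔_; Inverse)
open import Function.Definitions using (Injective)
open import Level using (0ℓ)
open import Relation.Binary.Core using (Rel)
import Relation.Binary.Construct.Add.Supremum.Strict as AddSupremumStrict
import Relation.Binary.Construct.NonStrictToStrict as NonStrictToStrict
open import Relation.Binary.Definitions using (Symmetric)
open import Relation.Binary.PropositionalEquality using (_≡_; refl; sym)
open import Relation.Binary.Structures using (IsTotalOrder)
open import Relation.Nullary using (¬_; yes; no)
open import Relation.Nullary.Construct.Add.Supremum using (_⁺; [_]; ⊤⁺)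

ExactlyOne : ∀ {a b} → Set a → Set b → Set _
ExactlyOne A B = (A × ¬ B) ⊎ (¬ A × B)

module Bounds {A : Set} (_≤_ : Rel A 0ℓ) where

  UpperBound LowerBound : (A → Set) → A → Set
  UpperBound P b = ∀ x → P x → x ≤ b
  LowerBound P b = ∀ x → P x → b ≤ x

  IsSup IsInf : (A → Set) → A → Set
  IsSup P s = UpperBound P s × (∀ b → UpperBound P b → s ≤ b)
  IsInf P s = LowerBound P s × (∀ b → LowerBound P b → b ≤ s)

-- The real numbers, axiomatised (up to isomorphism) as a complete
-- ordered field.  Equality is a setoid equality because Agda has no
-- quotients.

record CompleteOrderedField : Set₁ where
  field
    commutativeRing : CommutativeRing 0ℓ 0ℓ

  open CommutativeRing commutativeRing public
    using (Carrier; _≈_; _+_; _*_; -_; _-_; 0#; 1#; +-rawMonoid)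

  infix 4 _≤_
  infix 8 _⁻¹

  field
    _≤_ : Rel Carrier 0ℓ
    -- Total; nothing is assumed about the value at 0#.
    _⁻¹ : Carrier → Carrier

    isTotalOrder : IsTotalOrder _≈_ _≤_
    0≉1          : ¬ (0# ≈ 1#)
    *-inverseʳ   : ∀ x → ¬ (x ≈ 0#) → x * x ⁻¹ ≈ 1#
    +-monoˡ-≤    : ∀ z {x y} → x ≤ y → x + z ≤ y + z
    *-nonneg     : ∀ {x y} → 0# ≤ x → 0# ≤ y → 0# ≤ x * y

  open NonStrictToStrict _≈_ _≤_ public using (_<_)

  open Bounds _≤_ public

  field
    complete : ∀ (P : Carrier → Set) → ∃ P → ∃ (UpperBound P) → ∃ (IsSup P)

  open RawMonoidDefs +-rawMonoid public using () renaming (_×_ to _·_)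

  ∑ : ∀ {A : Set} → List A → (A → Carrier) → Carrier
  ∑ xs f = foldr _+_ 0# (map f xs)

record Graph : Set₁ where
  infix 4 _~_
  field
    V      : Set
    _~_    : Rel V 0ℓ
    ~-sym  : Symmetric _~_
    ~-irr  : ∀ x → ¬ (x ~ x)

  data Walk : ℕ → V → V → Set where
    nil  : ∀ {x} → Walk 0 x x
    cons : ∀ {n x y z} → x ~ y → Walk n y z → Walk (suc n) x z

  Connected : Set
  Connected = ∀ x y → ∃ λ n → Walk n x y

  LocallyFinite : Set
  LocallyFinite = ∀ x → Σ (List V) λ ys → Unique ys × (∀ y → y ∈ ys ⇔ x ~ y)

  Finite : Set
  Finite = ∃ λ xs → ∀ (x : V) → x ∈ xs

  Infinite : Set
  Infinite = ¬ Finite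

  record CycleOfLength (n : ℕ) : Set where
    field
      m         : ℕ
      n≡1+m     : n ≡ suc m
      3≤n       : 3 ℕ.≤ n
      vertex    : Fin (suc m) → V
      injective : Injective _≡_ _≡_ vertex
      step      : ∀ (i : Fin m) → vertex (inject₁ i) ~ vertex (suc i)
      close     : vertex (fromℕ m) ~ vertex zero

  -- The girth is the infimum of the cycle lengths (∞ if there are none).
  GirthAtLeast : ℕ → Set
  GirthAtLeast g = ∀ n → CycleOfLength n → g ℕ.≤ n

  record IsFiniteTree : Set where
    field
      finite    : Finite
      nonempty  : V
      connected : Connected
      acyclic   : ∀ n → ¬ CycleOfLength n

infix 4 _≅_
record _≅_ (G H : Graph) : Set where
  open Graph
  field
    bijection : V G ↔ V H
  open Inverse bijection public using (to)
  field
    adjacent : ∀ x y → _~_ G x y ⇔ _~_ H (to x) (to y)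

ray : Graph
ray = record
  { V     = ℕ
  ; _~_   = λ i j → j ≡ suc i ⊎ i ≡ suc j
  ; ~-sym = swap
  ; ~-irr = λ { i (inj₁ e) → ℕₚ.1+n≢n (sym e) ; i (inj₂ e) → ℕₚ.1+n≢n (sym e) }
  }

doubleRay : Graph
doubleRay = record
  { V     = ℤ.ℤ
  ; _~_   = λ i j → j ≡ ℤ.suc i ⊎ i ≡ ℤ.suc j
  ; ~-sym = swap
  ; ~-irr = λ { i (inj₁ e) → i≢1+i i e ; i (inj₂ e) → i≢1+i i e }
  }
  where
  i≢1+i : ∀ i → ¬ (i ≡ ℤ.suc i)
  i≢1+i i e = ℤₚ.<-irrefl e (ℤₚ.suc[i]≤j⇒i<j ℤₚ.≤-refl)

module _ (K : Graph) (k : Graph.V K) where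
  open Graph

  private
    Adj : Rel (V K ⊎ V ray) 0ℓ
    Adj (inj₁ a) (inj₁ b) = _~_ K a b
    Adj (inj₁ a) (inj₂ n) = a ≡ k × n ≡ 0
    Adj (inj₂ n) (inj₁ a) = a ≡ k × n ≡ 0
    Adj (inj₂ m) (inj₂ n) = _~_ ray m n

    Adj-sym : Symmetric Adj
    Adj-sym {inj₁ _} {inj₁ _} e = ~-sym K e
    Adj-sym {inj₁ _} {inj₂ _} e = e
    Adj-sym {inj₂ _} {inj₁ _} e = e
    Adj-sym {inj₂ m} {inj₂ n} e = ~-sym ray {m} {n} e

    Adj-irr : ∀ x → ¬ Adj x x
    Adj-irr (inj₁ a) = ~-irr K a
    Adj-irr (inj₂ n) = ~-irr ray n

  -- One edge joins k to the initial vertex 0 of the ray.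
  attachRay : Graph
  attachRay = record
    { V = V K ⊎ V ray ; _~_ = Adj
    ; ~-sym = λ {x} {y} → Adj-sym {x} {y} ; ~-irr = Adj-irr }

IsDoubleRay : Graph → Set
IsDoubleRay G = G ≅ doubleRay

IsFiniteTreeWithRay : Graph → Set₁
IsFiniteTreeWithRay G =
  Σ Graph λ K → Graph.IsFiniteTree K × Σ (Graph.V K) λ k → G ≅ attachRay K k

-- Excluded middle is used to make distances, infima and [0,∞]-valued
-- invariants into functions, and for the case split in the random walk
-- measure; the adjacency relation itself is not assumed decidable.

module Curvature (em : ExcludedMiddle 0ℓ) (R : CompleteOrderedField) where

  open CompleteOrderedField R
  open AddSupremumStrict _<_ public using (_<⁺_)

  least : ∀ (P : ℕ → Set) n → P n → ∃ λ m → P m × (∀ k → P k → m ℕ.≤ k)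
  least P zero    p = zero , p , λ _ _ → z≤n
  least P (suc n) p with em {P = P zero}
  ... | yes p₀ = zero , p₀ , λ _ _ → z≤n
  ... | no ¬p₀ with least (P ∘ suc) n p
  ...   | m , q , min = suc m , q , λ where
            zero    p₀ → ⊥-elim (¬p₀ p₀)
            (suc k) pk → s≤s (min k pk)

  -- Supremum and infimum as functions; the value is 0# when there is none.
  sup inf : (Carrier → Set) → Carrier
  sup P with em {P = ∃ (IsSup P)}
  ... | yes (s , _) = s
  ... | no _        = 0#
  inf P with em {P = ∃ (IsInf P)}
  ... | yes (s , _) = s
  ... | no _        = 0#

  module _ (G : Graph) (conn : Graph.Connected G) (lf : Graph.LocallyFinite G) where

    open Graph G

    -- Length of a shortest walk.
    dist : V → V → ℕ
    dist x y = proj₁ (least (λ n → Walk n x y) (proj₁ (conn x y)) (proj₂ (conn x y)))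

    neighbours : V → List V
    neighbours x = proj₁ (lf x)

    -- Couplings with finite support.  All measures below are finitely
    -- supported, so every coupling of them is of this kind.
    record Coupling (μ ν : V → Carrier) : Set where
      field
        plan       : V → V → Carrier
        support    : List V
        unique     : Unique support
        vanishes   : ∀ u v → ¬ (u ∈ support × v ∈ support) → plan u v ≈ 0#
        nonneg     : ∀ u v → 0# ≤ plan u v
        marginalˡ  : ∀ u → ∑ support (λ v → plan u v) ≈ μ u
        marginalʳ  : ∀ v → ∑ support (λ u → plan u v) ≈ ν v

      cost : Carrier
      cost = ∑ support λ u → ∑ support λ v → dist u v · plan u v

    W₁ : (μ ν : V → Carrier) → Carrier
    W₁ μ ν = inf λ r → ∃ λ (π : Coupling μ ν) → Coupling.cost π ≈ r

    -- Only the values on adjacent pairs are ever used, so this is a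
    -- positive function on the edge set.
    record Weight : Set where
      field
        w        : V → V → Carrier
        w-sym    : ∀ {x y} → x ~ y → w x y ≈ w y x
        positive : ∀ {x y} → x ~ y → 0# < w x y

    module _ (weight : Weight) where

      open Weight weight

      degree : V → Carrier
      degree x = ∑ (neighbours x) (w x)

      μ : Carrier → V → V → Carrier
      μ α x z with em {P = z ≡ x} | em {P = x ~ z}
      ... | yes _ | _     = α
      ... | no _  | yes _ = (1# - α) * (w x z * degree x ⁻¹)
      ... | no _  | no _  = 0#

      κ : Carrier → V → V → Carrier
      κ α x y = 1# - W₁ (μ α x) (μ α y)

      -- k is the limit of κ α x y / (1 - α) as α → 1⁻ within [0,1].
      κLLY_,_⟶_ : V → V → Carrier → Set
      κLLY x , y ⟶ k =
        ∀ ε → 0# < ε → ∃ λ δ → 0# < δ ×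
          (∀ α → 0# ≤ α → 1# - δ < α → α < 1# →
             let q = κ α x y * (1# - α) ⁻¹ in
             k - ε < q × q < k + ε)

      Admissible : Set
      Admissible = ∀ x y → x ~ y → ∃ λ k → (κLLY x , y ⟶ k) × 0# ≤ k

      EdgeValue : Carrier → Set
      EdgeValue r = ∃₂ λ x y → x ~ y × w x y ≈ r

      -- The values are positive, so inf EdgeValue is a genuine infimum
      -- as soon as there is an edge.
      Dist : Carrier ⁺
      Dist with em {P = ∃ (UpperBound EdgeValue) × 0# < inf EdgeValue}
      ... | yes _ = [ sup EdgeValue * inf EdgeValue ⁻¹ ]
      ... | no _  = ⊤⁺

    FiniteDistortion : Carrier → Set
    FiniteDistortion r = ∃ λ weight → Admissible weight × Dist weight ≡ [ r ]

    DN-LLY : Carrier ⁺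
    DN-LLY with em {P = ∃ FiniteDistortion}
    ... | yes _ = [ inf FiniteDistortion ]
    ... | no _  = ⊤⁺

{-# OPTIONS --safe #-}
-- On an edge xy of a graph of girth at least 6 the two measures are
-- supported on the vertices of a tree, and an optimal coupling for
-- α ≥ 1/2 can be written down together with a Kantorovich potential
-- proving its optimality.  Hence κ(x,y) = 2 (w_xy/d_x + w_xy/d_y - 1), and
-- κ(x,y) ≥ 0 means (d_x - w_xy) (d_y - w_xy) ≤ w_xy².
--
-- So an admissible weight is log-concave along every non-backtracking walk,
-- and if it is bounded away from 0 then it cannot decrease along an infinite
-- one; it even increases by a fixed amount at every further vertex of degree
-- at least 3.  If some edge begins infinite non-backtracking walks in both
-- directions, then the weight is constant along them, no vertex has a third
-- neighbour, and the graph is a double ray.  Otherwise an infinite walk is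
-- eventually a ray without branching (the weight being bounded), and what
-- lies behind that ray contains no infinite non-backtracking walk: it is a
-- finite tree.
--
-- Conversely, give the edges of a tree with a ray the weight 1 on the ray and
-- u n at depth n of the tree, where u (n+1) = ε (u n)² and 1/√ε bounds the
-- degrees.
module Submission where

open import Defs
open import Algebra.Bundles using (CommutativeRing)
import Algebra.Properties.Ring as RingProperties
import Algebra.Properties.Semiring.Mult.TCOptimised as Mult
import Algebra.Solver.Ring as RingSolver
open import Algebra.Solver.Ring.AlmostCommutativeRing
  using (fromCommutativeRing; _-Raw-AlmostCommutative⟶_)
open import Axiom.ExcludedMiddle using (ExcludedMiddle)
open import Data.Bool.Properties using (T-irrelevant)
open import Data.Empty using (⊥; ⊥-elim)
open import Data.Fin.Base as Fin using (Fin; zero; suc; inject₁; fromℕ)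
import Data.Fin.Properties as Finₚ
open import Data.Fin.Relation.Unary.Top using (view; ‵fromℕ; ‵inject₁)
import Data.Integer.Base as ℤ
import Data.Integer.Properties as ℤₚ
open import Data.List.Base using (List; []; _∷_; _++_; length; map; applyUpTo; tabulate)
open import Data.List.Membership.Propositional using (_∈_; _∉_)
open import Data.List.Membership.Propositional.Properties
  using ( ∈-++⁺ˡ; ∈-++⁺ʳ; ∈-∃++; ∈-map⁺
        ; ∈-applyUpTo⁺; ∈-applyUpTo⁻; ∈-tabulate⁺; ∈-tabulate⁻)
open import Data.List.Relation.Binary.Permutation.Propositional as ↭ using (_↭_)
open import Data.List.Relation.Binary.Permutation.Propositional.Properties
  using (∈-resp-↭; shift; ↭-length)
import Data.List.Relation.Binary.Permutation.Setoid.Properties as ↭ₛ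
open import Data.List.Relation.Unary.All as All using ([]; _∷_)
open import Data.List.Relation.Unary.AllPairs.Core using ([]; _∷_)
open import Data.List.Relation.Unary.Any using (here; there)
open import Data.List.Relation.Unary.Unique.Propositional using (Unique)
open import Data.List.Relation.Unary.Unique.Propositional.Properties using (++⁺)
open import Data.Maybe.Base using (Maybe; just; nothing)
open import Data.Nat.Base as ℕ using (ℕ; zero; suc; z≤n; s≤s)
import Data.Nat.Properties as ℕₚ
open import Data.Product.Base using (Σ; ∃; ∃₂; _×_; _,_; proj₁; proj₂)
open import Data.Sum.Base using (_⊎_; inj₁; inj₂; [_,_]′)
open import Data.Vec.Base as Vec using (Vec; []; _∷_)
open import Data.Vec.Relation.Unary.All using ([]; _∷_)
open import Data.Vec.Relation.Unary.AllPairs.Core using ([]; _∷_)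
import Data.Vec.Relation.Unary.Unique.Propositional as VecUnique
import Data.Vec.Relation.Unary.Unique.Propositional.Properties as VecUniqueₚ
open import Function.Base using (_∘_)
open import Function.Bundles using (_⇔_; mk⇔; mk↔ₛ′; Equivalence; Inverse)
open import Level using (0ℓ)
open import Relation.Binary.Bundles using (Poset)
import Relation.Binary.Construct.Add.Supremum.Strict as AddSupremumStrict
open import Relation.Binary.Definitions using (tri<; tri≈; tri>)
open import Relation.Binary.PropositionalEquality as ≡ using (_≡_; _≢_)
import Relation.Binary.Reasoning.PartialOrder as PosetReasoning
import Relation.Binary.Reasoning.Setoid as SetoidReasoning
open import Relation.Binary.Structures using (IsTotalOrder)
open import Relation.Nullary using (¬_; Dec; yes; no)
open import Relation.Nullary.Construct.Add.Supremum using ([_]; ⊤⁺)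
open import Relation.Nullary.Decidable.Core using (True; toWitness; fromWitness)

-- Girth at least 6 leaves longer cycles possible, so acyclicity has to be proved. The device is
-- `Core`, a finite set of vertices each having two neighbours inside it. Every cycle, and every
-- repetition on a non-backtracking walk, yields a core, and every step into a core begins an
-- infinite non-backtracking walk. So a cycle always produces an edge that is live in both
-- directions. In the one-sided case there is no such edge; in the two-sided case all degrees are at
-- most 2, the core would be the whole graph, and the graph would be finite.
--
-- The number 6 enters only through the curvature formula: a further neighbour of x and a further
-- neighbour of y must have distance 3, and any shorter connection would close a cycle of length at
-- most 5. The threshold 1/2 for α is what leaves x enough mass to supply the whole neighbourhood of
-- y and to send the rest to y.

-- The ring solver over an abstract ring, with coefficients in ℤ so that
-- it can cancel.
module IntegerSolver (R : CommutativeRing 0ℓ 0ℓ) where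
  open CommutativeRing R
  open RingProperties ring
    using (-‿distribˡ-*; -‿distribʳ-*; -0#≈0#; -‿involutive; -‿+-comm)
  open Mult semiring using (×-homo-+; ×1-homo-*; 1+×) renaming (_×_ to _·′_)

  ⟦_⟧ᶻ : ℤ.ℤ → Carrier
  ⟦ ℤ.+ n ⟧ᶻ      = n ·′ 1#
  ⟦ ℤ.-[1+ n ] ⟧ᶻ = - (suc n ·′ 1#)

  ⊖-homo : ∀ m n → ⟦ m ℤ.⊖ n ⟧ᶻ ≈ m ·′ 1# - n ·′ 1#
  ⊖-homo zero    zero    = sym (-‿inverseʳ 0#)
  ⊖-homo zero    (suc n) = sym (+-identityˡ _)
  ⊖-homo (suc m) zero    = sym (trans (+-congˡ -0#≈0#) (+-identityʳ _))
  ⊖-homo (suc m) (suc n) = begin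
    ⟦ suc m ℤ.⊖ suc n ⟧ᶻ                    ≡⟨ ≡.cong ⟦_⟧ᶻ (ℤₚ.[1+m]⊖[1+n]≡m⊖n m n) ⟩
    ⟦ m ℤ.⊖ n ⟧ᶻ                            ≈⟨ ⊖-homo m n ⟩
    m ·′ 1# - n ·′ 1#                         ≈⟨ +-identityˡ _ ⟨
    0# + (m ·′ 1# - n ·′ 1#)                  ≈⟨ +-congʳ (-‿inverseʳ 1#) ⟨
    1# - 1# + (m ·′ 1# - n ·′ 1#)             ≈⟨ +-assoc _ _ _ ⟩
    1# + (- 1# + (m ·′ 1# - n ·′ 1#))         ≈⟨ +-congˡ (trans (sym (+-assoc _ _ _))
                                                 (trans (+-congʳ (+-comm _ _)) (+-assoc _ _ _))) ⟩
    1# + (m ·′ 1# + (- 1# - n ·′ 1#))         ≈⟨ +-assoc _ _ _ ⟨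
    1# + m ·′ 1# + (- 1# - n ·′ 1#)           ≈⟨ +-cong (1+× m 1#) (trans (-‿cong (1+× n 1#)) (sym (-‿+-comm _ _))) ⟨
    suc m ·′ 1# - suc n ·′ 1#                 ∎
    where open SetoidReasoning setoid

  +-homo : ∀ i j → ⟦ i ℤ.+ j ⟧ᶻ ≈ ⟦ i ⟧ᶻ + ⟦ j ⟧ᶻ
  +-homo (ℤ.+ m)      (ℤ.+ n)      = ×-homo-+ 1# m n
  +-homo (ℤ.+ m)      (ℤ.-[1+ n ]) = ⊖-homo m (suc n)
  +-homo (ℤ.-[1+ m ]) (ℤ.+ n)      = trans (⊖-homo n (suc m)) (+-comm _ _)
  +-homo (ℤ.-[1+ m ]) (ℤ.-[1+ n ]) = trans
    (-‿cong (trans (reflexive (≡.cong (λ k → suc k ·′ 1#) (≡.sym (ℕₚ.+-suc m n)))) (×-homo-+ 1# (suc m) (suc n))))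
    (sym (-‿+-comm _ _))

  neg-homo : ∀ i → ⟦ ℤ.- i ⟧ᶻ ≈ - ⟦ i ⟧ᶻ
  neg-homo (ℤ.+ zero)   = sym -0#≈0#
  neg-homo (ℤ.+ suc n)  = refl
  neg-homo ℤ.-[1+ n ]   = sym (-‿involutive _)

  +*-homo : ∀ m j → ⟦ ℤ.+ m ℤ.* j ⟧ᶻ ≈ m ·′ 1# * ⟦ j ⟧ᶻ
  +*-homo m (ℤ.+ n) =
    trans (reflexive (≡.cong ⟦_⟧ᶻ (≡.sym (ℤₚ.pos-* m n)))) (×1-homo-* m n)
  +*-homo m ℤ.-[1+ n ] = begin
    ⟦ ℤ.+ m ℤ.* ℤ.-[1+ n ] ⟧ᶻ       ≡⟨ ≡.cong ⟦_⟧ᶻ (ℤₚ.neg-distribʳ-* (ℤ.+ m) (ℤ.+ suc n)) ⟨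
    ⟦ ℤ.- (ℤ.+ m ℤ.* ℤ.+ suc n) ⟧ᶻ  ≈⟨ neg-homo (ℤ.+ m ℤ.* ℤ.+ suc n) ⟩
    - ⟦ ℤ.+ m ℤ.* ℤ.+ suc n ⟧ᶻ      ≈⟨ -‿cong (+*-homo m (ℤ.+ suc n)) ⟩
    - (m ·′ 1# * (suc n ·′ 1#))     ≈⟨ -‿distribʳ-* _ _ ⟩
    m ·′ 1# * - (suc n ·′ 1#)       ∎
    where open SetoidReasoning setoid

  *-homo : ∀ i j → ⟦ i ℤ.* j ⟧ᶻ ≈ ⟦ i ⟧ᶻ * ⟦ j ⟧ᶻ
  *-homo (ℤ.+ m)    j = +*-homo m j
  *-homo ℤ.-[1+ m ] j = begin
    ⟦ ℤ.-[1+ m ] ℤ.* j ⟧ᶻ        ≡⟨ ≡.cong ⟦_⟧ᶻ (ℤₚ.neg-distribˡ-* (ℤ.+ suc m) j) ⟨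
    ⟦ ℤ.- (ℤ.+ suc m ℤ.* j) ⟧ᶻ   ≈⟨ neg-homo (ℤ.+ suc m ℤ.* j) ⟩
    - ⟦ ℤ.+ suc m ℤ.* j ⟧ᶻ       ≈⟨ -‿cong (+*-homo (suc m) j) ⟩
    - (suc m ·′ 1# * ⟦ j ⟧ᶻ)     ≈⟨ -‿distribˡ-* _ _ ⟩
    - (suc m ·′ 1#) * ⟦ j ⟧ᶻ     ∎
    where open SetoidReasoning setoid

  morphism : ℤ.+-*-rawRing -Raw-AlmostCommutative⟶ fromCommutativeRing R
  morphism = record
    { ⟦_⟧    = ⟦_⟧ᶻ
    ; +-homo = +-homo
    ; *-homo = *-homo
    ; -‿homo = neg-homo
    ; 0-homo = refl
    ; 1-homo = refl
    }

  decide : ∀ i j → Maybe (⟦ i ⟧ᶻ ≈ ⟦ j ⟧ᶻ)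
  decide i j with i ℤₚ.≟ j
  ... | yes i≡j = just (reflexive (≡.cong ⟦_⟧ᶻ i≡j))
  ... | no  _   = nothing

  open RingSolver ℤ.+-*-rawRing (fromCommutativeRing R) morphism decide public
    using (solve; _:=_; con; _:+_; _:*_; _:-_; :-_; Polynomial)

  :1 :2 :3 : ∀ {n} → Polynomial n
  :1 = con (ℤ.+ 1)
  :2 = :1 :+ :1
  :3 = :1 :+ :2

-- Ordered-field arithmetic and two consequences of completeness.

module OrderedField (R : CompleteOrderedField) where
  open CompleteOrderedField R public
  open CommutativeRing commutativeRing public
    using ( setoid; +-cong; +-congˡ; +-congʳ
          ; +-comm; +-assoc; +-identityˡ; +-identityʳ; -‿cong; -‿inverseʳ
          ; *-cong; *-congˡ; *-congʳ; *-comm; *-assoc; *-identityˡ; *-identityʳ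
          ; distribˡ; distribʳ; zeroˡ; zeroʳ; reflexive)
    renaming (refl to ≈-refl; sym to ≈-sym; trans to ≈-trans)
  open IntegerSolver commutativeRing public
    using (solve; _:=_; con; _:+_; _:*_; _:-_; :-_; :1; :2; :3)
  module ≤ = IsTotalOrder isTotalOrder

  poset : Poset 0ℓ 0ℓ 0ℓ
  poset = record { isPartialOrder = ≤.isPartialOrder }

  module ≤-Reasoning = PosetReasoning poset
  module ≈-Reasoning = SetoidReasoning setoid

  ≤-respˡ : ∀ {x y z} → x ≈ y → x ≤ z → y ≤ z
  ≤-respˡ x≈y = ≤.trans (≤.reflexive (≈-sym x≈y))

  ≤-respʳ : ∀ {x y z} → x ≈ y → z ≤ x → z ≤ y
  ≤-respʳ x≈y z≤x = ≤.trans z≤x (≤.reflexive x≈y)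

  <⇒≤ : ∀ {x y} → x < y → x ≤ y
  <⇒≤ = proj₁

  <⇒≱ : ∀ {x y} → x < y → ¬ y ≤ x
  <⇒≱ (x≤y , x≉y) y≤x = x≉y (≤.antisym x≤y y≤x)

  ≰⇒> : ∀ {x y} → ¬ x ≤ y → y < x
  ≰⇒> {x} {y} x≰y with ≤.total x y
  ... | inj₁ x≤y = ⊥-elim (x≰y x≤y)
  ... | inj₂ y≤x = y≤x , λ y≈x → x≰y (≤.reflexive (≈-sym y≈x))

  <-≤-trans : ∀ {x y z} → x < y → y ≤ z → x < z
  <-≤-trans x<y y≤z = ≤.trans (<⇒≤ x<y) y≤z , λ x≈z → <⇒≱ x<y (≤-respʳ (≈-sym x≈z) y≤z)

  ≤-<-trans : ∀ {x y z} → x ≤ y → y < z → x < z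
  ≤-<-trans x≤y y<z = ≤.trans x≤y (<⇒≤ y<z) , λ x≈z → <⇒≱ y<z (≤-respˡ x≈z x≤y)

  <-respʳ : ∀ {x y z} → x ≈ y → z < x → z < y
  <-respʳ x≈y z<x = <-≤-trans z<x (≤.reflexive x≈y)

  <-respˡ : ∀ {x y z} → x ≈ y → x < z → y < z
  <-respˡ x≈y = ≤-<-trans (≤.reflexive (≈-sym x≈y))

  +-mono-≤ : ∀ {a b c d} → a ≤ b → c ≤ d → a + c ≤ b + d
  +-mono-≤ {a} {b} {c} {d} a≤b c≤d = begin
    a + c ≤⟨ +-monoˡ-≤ c a≤b ⟩
    b + c ≈⟨ +-comm b c ⟩
    c + b ≤⟨ +-monoˡ-≤ b c≤d ⟩
    d + b ≈⟨ +-comm d b ⟩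
    b + d ∎
    where open ≤-Reasoning

  0≤y-x : ∀ {x y} → x ≤ y → 0# ≤ y - x
  0≤y-x {x} x≤y = ≤-respˡ (-‿inverseʳ x) (+-monoˡ-≤ (- x) x≤y)

  -- The witness d is the difference of the two sides, so that an
  -- inequality is reduced to a ring identity.
  ≤-by : ∀ {x y} d → 0# ≤ d → y ≈ x + d → x ≤ y
  ≤-by {x} {y} d 0≤d y≈x+d = begin
    x      ≈⟨ +-identityʳ x ⟨
    x + 0# ≤⟨ +-mono-≤ ≤.refl 0≤d ⟩
    x + d  ≈⟨ y≈x+d ⟨
    y      ∎
    where open ≤-Reasoning

  <-by : ∀ {x y} d → 0# < d → y ≈ x + d → x < y
  <-by {x} {y} d 0<d y≈x+d = ≤-by d (<⇒≤ 0<d) y≈x+d , λ x≈y → <⇒≱ 0<d (≤.reflexive (begin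
    d             ≈⟨ solve 2 (λ x d → d := x :+ d :- x) ≈-refl x d ⟩
    x + d - x     ≈⟨ +-congʳ (≈-trans (≈-sym y≈x+d) (≈-sym x≈y)) ⟩
    x - x         ≈⟨ -‿inverseʳ x ⟩
    0#            ∎))
    where open ≈-Reasoning

  0<y-x : ∀ {x y} → x < y → 0# < y - x
  0<y-x {x} {y} x<y = 0≤y-x (<⇒≤ x<y) , λ 0≈ → <⇒≱ x<y (≤.reflexive (begin
    y             ≈⟨ solve 2 (λ x y → y := y :- x :+ x) ≈-refl x y ⟩
    y - x + x     ≈⟨ +-congʳ 0≈ ⟨
    0# + x        ≈⟨ +-identityˡ x ⟩
    x             ∎))
    where open ≈-Reasoning

  0≤+ : ∀ {x y} → 0# ≤ x → 0# ≤ y → 0# ≤ x + y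
  0≤+ 0≤x 0≤y = ≤-respˡ (+-identityˡ 0#) (+-mono-≤ 0≤x 0≤y)

  0<+ : ∀ {x y} → 0# < x → 0# ≤ y → 0# < x + y
  0<+ 0<x 0≤y = <-≤-trans 0<x (≤-by _ 0≤y ≈-refl)

  *-monoˡ-≤ : ∀ {c x y} → 0# ≤ c → x ≤ y → c * x ≤ c * y
  *-monoˡ-≤ {c} {x} {y} 0≤c x≤y = ≤-by (c * (y - x)) (*-nonneg 0≤c (0≤y-x x≤y))
    (solve 3 (λ c x y → c :* y := c :* x :+ c :* (y :- x)) ≈-refl c x y)

  *-mono-≤ : ∀ {a b c d} → 0# ≤ a → 0# ≤ d → a ≤ b → c ≤ d → a * c ≤ b * d
  *-mono-≤ {a} {b} {c} {d} 0≤a 0≤d a≤b c≤d = begin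
    a * c ≤⟨ *-monoˡ-≤ 0≤a c≤d ⟩
    a * d ≈⟨ *-comm a d ⟩
    d * a ≤⟨ *-monoˡ-≤ 0≤d a≤b ⟩
    d * b ≈⟨ *-comm d b ⟩
    b * d ∎
    where open ≤-Reasoning

  0≤1 : 0# ≤ 1#
  0≤1 with ≤.total 0# 1#
  ... | inj₁ 0≤1 = 0≤1
  ... | inj₂ 1≤0 = ≤-respʳ (solve 0 ((con (ℤ.+ 0) :- :1) :* (con (ℤ.+ 0) :- :1) := :1) ≈-refl)
                     (*-nonneg (0≤y-x 1≤0) (0≤y-x 1≤0))

  0<1 : 0# < 1#
  0<1 = 0≤1 , 0≉1

  <⇒≉0 : ∀ {x} → 0# < x → ¬ x ≈ 0#
  <⇒≉0 (_ , 0≉x) x≈0 = 0≉x (≈-sym x≈0)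

  *-inverse : ∀ {x} → 0# < x → x * x ⁻¹ ≈ 1#
  *-inverse 0<x = *-inverseʳ _ (<⇒≉0 0<x)

  *-cancel⁻¹ : ∀ {x} y → 0# < x → y * x * x ⁻¹ ≈ y
  *-cancel⁻¹ y 0<x = ≈-trans (*-assoc _ _ _) (≈-trans (*-congˡ (*-inverse 0<x)) (*-identityʳ y))

  0<⁻¹ : ∀ {x} → 0# < x → 0# < x ⁻¹
  0<⁻¹ {x} 0<x = ≰⇒> λ x⁻¹≤0 → <⇒≱ 0<1 (begin
    1#        ≈⟨ *-inverse 0<x ⟨
    x * x ⁻¹  ≤⟨ *-monoˡ-≤ (<⇒≤ 0<x) x⁻¹≤0 ⟩
    x * 0#    ≈⟨ zeroʳ x ⟩
    0#        ∎)
    where open ≤-Reasoning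

  *-cancelʳ-≤ : ∀ {a b c} → 0# < c → a * c ≤ b * c → a ≤ b
  *-cancelʳ-≤ {a} {b} {c} 0<c ac≤bc = begin
    a              ≈⟨ *-cancel⁻¹ a 0<c ⟨
    a * c * c ⁻¹   ≈⟨ *-comm _ _ ⟩
    c ⁻¹ * (a * c) ≤⟨ *-monoˡ-≤ (<⇒≤ (0<⁻¹ 0<c)) ac≤bc ⟩
    c ⁻¹ * (b * c) ≈⟨ *-comm _ _ ⟩
    b * c * c ⁻¹   ≈⟨ *-cancel⁻¹ b 0<c ⟩
    b              ∎
    where open ≤-Reasoning

  0<* : ∀ {x y} → 0# < x → 0# < y → 0# < x * y
  0<* {x} {y} 0<x 0<y = ≰⇒> λ xy≤0 →
    <⇒≱ 0<x (*-cancelʳ-≤ 0<y (≤-respʳ (≈-sym (zeroˡ y)) xy≤0))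

  ½ : Carrier
  ½ = (1# + 1#) ⁻¹

  0<2 : 0# < 1# + 1#
  0<2 = 0<+ 0<1 0≤1

  0<½ : 0# < ½
  0<½ = 0<⁻¹ 0<2

  ½+½ : ½ + ½ ≈ 1#
  ½+½ = ≈-trans (solve 1 (λ h → h :+ h := :2 :* h) ≈-refl ½) (*-inverse 0<2)

  half< : ∀ {x} → 0# < x → x * ½ < x
  half< {x} 0<x = <-by (x * ½) (0<* 0<x 0<½) (begin
    x               ≈⟨ *-identityʳ x ⟨
    x * 1#          ≈⟨ *-congˡ ½+½ ⟨
    x * (½ + ½)     ≈⟨ distribˡ x ½ ½ ⟩
    x * ½ + x * ½   ∎)
    where open ≈-Reasoning

  module _ (em : ExcludedMiddle 0ℓ) where

    -- Some term lies above `s - c`, where `s` is the supremum of the range. This replaces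
    -- convergence arguments: a bounded sequence cannot gain `c` at every step, nor even once after
    -- the index `N` relative to `t N`.
    near-sup : ∀ (t : ℕ → Carrier) {M c} → (∀ n → t n ≤ M) → 0# < c →
               ∃ λ N → ∀ i → t i < t N + c
    near-sup t {M} {c} t≤M 0<c with complete (λ r → ∃ λ n → t n ≈ r) (_ , 0 , ≈-refl)
                                      (M , λ { r (n , tn≈r) → ≤-respˡ tn≈r (t≤M n) })
    ... | s , ub , lub with em {P = ∃ λ N → ¬ t N ≤ s - c}
    ...   | yes (N , tN≰) = N , λ i → ≤-<-trans (ub _ (i , ≈-refl))
              (<-by (t N - (s - c)) (0<y-x (≰⇒> tN≰))
                (solve 3 (λ t s c → t :+ c := s :+ (t :- (s :- c))) ≈-refl (t N) s c))
    ...   | no ¬∃ = ⊥-elim (<⇒≱ s-c<s (lub (s - c) λ { r (n , tn≈r) → ≤-respˡ tn≈r (below n) }))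
            where
            s-c<s : s - c < s
            s-c<s = <-by c 0<c (solve 2 (λ s c → s := s :- c :+ c) ≈-refl s c)
            below : ∀ n → t n ≤ s - c
            below n with em {P = t n ≤ s - c}
            ... | yes p = p
            ... | no ¬p = ⊥-elim (¬∃ (n , ¬p))

    -- If the first step went down, the ratios of consecutive terms would
    -- stay below t 1 / t 0 < 1, and the sequence would decrease by a fixed
    -- amount at every step.
    logConcave-step : ∀ (t : ℕ → Carrier) {m} → 0# < m → (∀ n → m ≤ t n) →
      (∀ n → t n * t (suc (suc n)) ≤ t (suc n) * t (suc n)) → t 0 ≤ t 1
    logConcave-step t {m} 0<m m≤t lc with em {P = t 0 ≤ t 1}
    ... | yes p = p
    ... | no t₀≰t₁ = ⊥-elim contra
      where
      a b δ : Carrier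
      a = t 0
      b = t 1
      δ = a - b

      0<δ : 0# < δ
      0<δ = 0<y-x (≰⇒> t₀≰t₁)

      0<t : ∀ n → 0# < t n
      0<t n = <-≤-trans 0<m (m≤t n)

      ratio : ∀ n → t (suc n) * a ≤ t n * b
      ratio zero    = ≤.reflexive (*-comm b a)
      ratio (suc n) = *-cancelʳ-≤ (0<t n) (begin
        t₂ * a * t₀    ≈⟨ solve 3 (λ x y z → x :* y :* z := y :* (z :* x)) ≈-refl t₂ a t₀ ⟩
        a * (t₀ * t₂)  ≤⟨ *-monoˡ-≤ (<⇒≤ (0<t 0)) (lc n) ⟩
        a * (t₁ * t₁)  ≈⟨ solve 2 (λ x y → x :* (y :* y) := y :* (y :* x)) ≈-refl a t₁ ⟩
        t₁ * (t₁ * a)  ≤⟨ *-monoˡ-≤ (<⇒≤ (0<t (suc n))) (ratio n) ⟩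
        t₁ * (t₀ * b)  ≈⟨ solve 3 (λ x y z → x :* (y :* z) := x :* z :* y) ≈-refl t₁ t₀ b ⟩
        t₁ * b * t₀    ∎)
        where
        open ≤-Reasoning
        t₀ = t n
        t₁ = t (suc n)
        t₂ = t (suc (suc n))

      -- By `ratio`, `a * t (suc n)` is at most `b * t n`, which is `a * t n - δ * t n`, and `t n`
      -- is at least `m`. The factor `a` avoids a division, and the sign turns the decrease into an
      -- increase, as `near-sup` requires.
      drop : ∀ n → - (a * t n) + m * δ ≤ - (a * t (suc n))
      drop n = ≤-by ((t n * b - t (suc n) * a) + (t n - m) * δ)
        (0≤+ (0≤y-x (ratio n)) (*-nonneg (0≤y-x (m≤t n)) (<⇒≤ 0<δ)))
        (solve 5 (λ a b t₀ t₁ m → :- (a :* t₁)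
           := :- (a :* t₀) :+ m :* (a :- b)
              :+ (t₀ :* b :- t₁ :* a :+ (t₀ :- m) :* (a :- b)))
           ≈-refl a b (t n) (t (suc n)) m)

      bounded : ∀ n → - (a * t n) ≤ - (a * m)
      bounded n = ≤-by (a * (t n - m)) (*-nonneg (<⇒≤ (0<t 0)) (0≤y-x (m≤t n)))
        (solve 3 (λ a t m → :- (a :* m) := :- (a :* t) :+ a :* (t :- m))
          ≈-refl a (t n) m)

      contra : ⊥
      contra = let N , below = near-sup (λ n → - (a * t n)) bounded (0<* 0<m 0<δ)
               in <⇒≱ (below (suc N)) (drop N)

-- Duplicate-free lists and finite sums over them.

module _ {A : Set} where

  Unique-resp-↭ : ∀ {xs ys : List A} → xs ↭ ys → Unique xs → Unique ys
  Unique-resp-↭ p = ↭ₛ.Unique-resp-↭ (≡.setoid A) (↭.↭⇒↭ₛ p)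

  extract : ∀ {x : A} {xs} → x ∈ xs → ∃ λ ys → xs ↭ x ∷ ys
  extract x∈xs with ∈-∃++ x∈xs
  ... | ys , zs , ≡.refl = _ , shift _ ys zs

  Unique-head : ∀ {x y : A} {xs} → Unique (x ∷ xs) → y ∈ xs → ¬ y ≡ x
  Unique-head (x∉xs ∷ _) y∈xs y≡x = All.lookup x∉xs y∈xs (≡.sym y≡x)

  Unique-tail : ∀ {x : A} {xs} → Unique (x ∷ xs) → Unique xs
  Unique-tail (_ ∷ uxs) = uxs

  ∈-∷-≢ : ∀ {x y : A} {xs} → y ∈ x ∷ xs → ¬ y ≡ x → y ∈ xs
  ∈-∷-≢ (here y≡x)   y≢x = ⊥-elim (y≢x y≡x)
  ∈-∷-≢ (there y∈xs) _   = y∈xs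

module Sums (em : ExcludedMiddle 0ℓ) (R : CompleteOrderedField) where
  open OrderedField R

  module _ {A : Set} where

    ∑-cong : ∀ (xs : List A) {f g} → (∀ {x} → x ∈ xs → f x ≈ g x) → ∑ xs f ≈ ∑ xs g
    ∑-cong []       f≈g = ≈-refl
    ∑-cong (x ∷ xs) f≈g = +-cong (f≈g (here ≡.refl)) (∑-cong xs (f≈g ∘ there))

    ∑-0 : ∀ (xs : List A) {f} → (∀ {x} → x ∈ xs → f x ≈ 0#) → ∑ xs f ≈ 0#
    ∑-0 []       f≈0 = ≈-refl
    ∑-0 (x ∷ xs) f≈0 = ≈-trans (+-cong (f≈0 (here ≡.refl)) (∑-0 xs (f≈0 ∘ there))) (+-identityˡ 0#)

    ∑-mono : ∀ (xs : List A) {f g} → (∀ {x} → x ∈ xs → f x ≤ g x) → ∑ xs f ≤ ∑ xs g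
    ∑-mono []       f≤g = ≤.refl
    ∑-mono (x ∷ xs) f≤g = +-mono-≤ (f≤g (here ≡.refl)) (∑-mono xs (f≤g ∘ there))

    ∑-nonneg : ∀ (xs : List A) {f} → (∀ {x} → x ∈ xs → 0# ≤ f x) → 0# ≤ ∑ xs f
    ∑-nonneg []       _   = ≤.refl
    ∑-nonneg (x ∷ xs) 0≤f = 0≤+ (0≤f (here ≡.refl)) (∑-nonneg xs (0≤f ∘ there))

    ∑-+ : ∀ (xs : List A) (f g : A → Carrier) → ∑ xs (λ x → f x + g x) ≈ ∑ xs f + ∑ xs g
    ∑-+ []       f g = ≈-sym (+-identityˡ 0#)
    ∑-+ (x ∷ xs) f g = ≈-trans (+-congˡ (∑-+ xs f g))
      (solve 4 (λ a b c d → a :+ b :+ (c :+ d) := a :+ c :+ (b :+ d)) ≈-refl (f x) (g x) (∑ xs f) (∑ xs g))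

    ∑-*ˡ : ∀ (xs : List A) c (f : A → Carrier) → ∑ xs (λ x → c * f x) ≈ c * ∑ xs f
    ∑-*ˡ []       c f = ≈-sym (zeroʳ c)
    ∑-*ˡ (x ∷ xs) c f = ≈-trans (+-congˡ (∑-*ˡ xs c f)) (≈-sym (distribˡ c _ _))

    ∑-*ʳ : ∀ (xs : List A) c (f : A → Carrier) → ∑ xs (λ x → f x * c) ≈ ∑ xs f * c
    ∑-*ʳ xs c f = ≈-trans (∑-cong xs λ _ → *-comm _ c) (≈-trans (∑-*ˡ xs c f) (*-comm c _))

    ∑-↭ : ∀ {xs ys : List A} (f : A → Carrier) → xs ↭ ys → ∑ xs f ≈ ∑ ys f
    ∑-↭ f ↭.refl         = ≈-refl
    ∑-↭ f (↭.prep x p)   = +-congˡ (∑-↭ f p)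
    ∑-↭ f (↭.swap x y p) = ≈-trans (+-congˡ (+-congˡ (∑-↭ f p)))
      (solve 3 (λ a b c → a :+ (b :+ c) := b :+ (a :+ c)) ≈-refl (f x) (f y) _)
    ∑-↭ f (↭.trans p q)  = ≈-trans (∑-↭ f p) (∑-↭ f q)

    ∑-⊆ : ∀ {xs ys : List A} {f} → Unique xs → (∀ {x} → x ∈ xs → x ∈ ys) →
          (∀ {y} → y ∈ ys → 0# ≤ f y) → ∑ xs f ≤ ∑ ys f
    ∑-⊆ {[]}     {ys}     _   _     0≤f = ∑-nonneg ys 0≤f
    ∑-⊆ {x ∷ xs} {ys} {f} uxs xs⊆ys 0≤f = let zs , p = extract (xs⊆ys (here ≡.refl)) in begin
      f x + ∑ xs f ≤⟨ +-mono-≤ ≤.refl (∑-⊆ (Unique-tail uxs)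
                        (λ y∈xs → ∈-∷-≢ (∈-resp-↭ p (xs⊆ys (there y∈xs))) (Unique-head uxs y∈xs))
                        (λ z∈zs → 0≤f (∈-resp-↭ (↭.↭-sym p) (there z∈zs)))) ⟩
      f x + ∑ zs f ≈⟨ ∑-↭ f p ⟨
      ∑ ys f       ∎
      where open ≤-Reasoning

    -- An element common to both lists is moved to the front and removed from both; an element of
    -- only one list contributes zero. It allows the support list of a coupling to be exchanged for
    -- the list of a ball.
    ∑-support : ∀ {xs ys : List A} {f} → Unique xs → Unique ys →
                (∀ {x} → x ∈ xs → x ∉ ys → f x ≈ 0#) →
                (∀ {y} → y ∈ ys → y ∉ xs → f y ≈ 0#) → ∑ xs f ≈ ∑ ys f
    ∑-support {[]}     {ys}     _   _   _   off = ≈-sym (∑-0 ys λ y∈ys → off y∈ys λ ())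
    ∑-support {x ∷ xs} {ys} {f} uxs uys off off′ with em {P = x ∈ ys}
    ... | yes x∈ys = let zs , p = extract x∈ys; uzs = Unique-resp-↭ p uys in begin
      f x + ∑ xs f ≈⟨ +-congˡ (∑-support (Unique-tail uxs) (Unique-tail uzs)
                        (λ y∈xs y∉zs → off (there y∈xs)
                           λ y∈ys → y∉zs (∈-∷-≢ (∈-resp-↭ p y∈ys) (Unique-head uxs y∈xs)))
                        (λ z∈zs z∉xs → off′ (∈-resp-↭ (↭.↭-sym p) (there z∈zs))
                           λ z∈ → z∉xs (∈-∷-≢ z∈ (Unique-head uzs z∈zs)))) ⟩
      f x + ∑ zs f ≈⟨ ∑-↭ f p ⟨
      ∑ ys f       ∎
      where open ≈-Reasoning
    ... | no x∉ys = begin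
      f x + ∑ xs f ≈⟨ +-cong (off (here ≡.refl) x∉ys) (∑-support (Unique-tail uxs) uys
                        (off ∘ there)
                        (λ y∈ys y∉xs → off′ y∈ys
                           λ y∈ → y∉xs (∈-∷-≢ y∈ λ { ≡.refl → x∉ys y∈ys }))) ⟩
      0# + ∑ ys f  ≈⟨ +-identityˡ _ ⟩
      ∑ ys f       ∎
      where open ≈-Reasoning

    ∑-point : ∀ {xs : List A} {x f} → Unique xs → x ∈ xs →
              (∀ {y} → ¬ y ≡ x → f y ≈ 0#) → ∑ xs f ≈ f x
    ∑-point {xs} {x} {f} uxs x∈xs off = ≈-trans
      (∑-support uxs (All.[] ∷ []) (λ _ y∉ → off λ y≡x → y∉ (here y≡x))
        λ { (here ≡.refl) x∉ → ⊥-elim (x∉ x∈xs) })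
      (+-identityʳ (f x))

    ∑-≤-length : ∀ (xs : List A) {f c} → (∀ {x} → x ∈ xs → f x ≤ c) → ∑ xs f ≤ length xs · c
    ∑-≤-length []       _   = ≤.refl
    ∑-≤-length (x ∷ xs) f≤c = +-mono-≤ (f≤c (here ≡.refl)) (∑-≤-length xs (f≤c ∘ there))

  ∑-swap : ∀ {A B : Set} (xs : List A) (ys : List B) (f : A → B → Carrier) →
           ∑ xs (λ x → ∑ ys (f x)) ≈ ∑ ys (λ y → ∑ xs (λ x → f x y))
  ∑-swap []       ys f = ≈-sym (∑-0 ys λ _ → ≈-refl)
  ∑-swap (x ∷ xs) ys f = ≈-trans (+-congˡ (∑-swap xs ys f))
    (≈-sym (∑-+ ys (f x) (λ y → ∑ xs (λ x → f x y))))

  ·-congʳ : ∀ n {x y} → x ≈ y → n · x ≈ n · y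
  ·-congʳ zero    x≈y = ≈-refl
  ·-congʳ (suc n) x≈y = +-cong x≈y (·-congʳ n x≈y)

  ·-zeroʳ : ∀ n → n · 0# ≈ 0#
  ·-zeroʳ zero    = ≈-refl
  ·-zeroʳ (suc n) = ≈-trans (+-identityˡ _) (·-zeroʳ n)

  ·-homo-+ : ∀ m n x → (m ℕ.+ n) · x ≈ m · x + n · x
  ·-homo-+ zero    n x = ≈-sym (+-identityˡ _)
  ·-homo-+ (suc m) n x = ≈-trans (+-congˡ (·-homo-+ m n x)) (≈-sym (+-assoc x _ _))

  0≤· : ∀ n {x} → 0# ≤ x → 0# ≤ n · x
  0≤· zero    0≤x = ≤.refl
  0≤· (suc n) 0≤x = 0≤+ 0≤x (0≤· n 0≤x)

  ·-monoˡ : ∀ {m n x} → m ℕ.≤ n → 0# ≤ x → m · x ≤ n · x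
  ·-monoˡ {n = n} z≤n 0≤x = 0≤· n 0≤x
  ·-monoˡ (s≤s m≤n)   0≤x = +-mono-≤ ≤.refl (·-monoˡ m≤n 0≤x)

  -- Turns repeated addition into a ring product, so that linearity of sums and the ring solver
  -- apply to distances and potentials with values in ℕ.
  ·1* : ∀ n x → n · x ≈ n · 1# * x
  ·1* zero    x = ≈-sym (zeroˡ x)
  ·1* (suc n) x = ≈-trans (+-cong (≈-sym (*-identityˡ x)) (·1* n x)) (≈-sym (distribʳ x _ _))

  ∑-· : ∀ {A : Set} (xs : List A) n (f : A → Carrier) → ∑ xs (λ x → n · f x) ≈ n · ∑ xs f
  ∑-· xs n f = ≈-trans (∑-cong xs λ {x} _ → ·1* n (f x))
    (≈-trans (∑-*ˡ xs (n · 1#) f) (≈-sym (·1* n (∑ xs f))))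

-- Exclusion of cycles of length 3, 4 and 5.

module ShortCycles (G : Graph) where
  open Graph G

  ~⇒≢ : ∀ {x y} → x ~ y → x ≢ y
  ~⇒≢ {x} x~y ≡.refl = ~-irr x x~y

  module _ (girth : GirthAtLeast 6) where

    private
      too-short : ∀ {m} → 3 ℕ.≤ suc m → suc m ℕ.< 6 → (vs : Vec V (suc m)) → VecUnique.Unique vs →
                  (∀ i → Vec.lookup vs (inject₁ i) ~ Vec.lookup vs (suc i)) →
                  Vec.lookup vs (fromℕ m) ~ Vec.lookup vs zero → ⊥
      too-short 3≤ <6 vs uvs step close = ℕₚ.<⇒≱ <6 (girth _ record
        { n≡1+m = ≡.refl ; 3≤n = 3≤ ; vertex = Vec.lookup vs
        ; injective = VecUniqueₚ.lookup-injective uvs _ _ ; step = step ; close = close })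

    no-triangle : ∀ {a b c} → a ~ b → b ~ c → c ~ a → ⊥
    no-triangle {a} {b} {c} ab bc ca = too-short (ℕₚ.≤ᵇ⇒≤ 3 3 _) (ℕₚ.≤ᵇ⇒≤ 4 6 _)
      (a ∷ b ∷ c ∷ [])
      ((~⇒≢ ab ∷ ~⇒≢ (~-sym ca) ∷ []) ∷
       (~⇒≢ bc ∷ []) ∷ [] ∷ [])
      (λ { zero → ab ; (suc zero) → bc }) ca

    -- Consecutive vertices differ because they are adjacent, so only the diagonals require
    -- hypotheses; the same holds for five vertices.
    no-4-cycle : ∀ {a b c d} → a ~ b → b ~ c → c ~ d → d ~ a → a ≢ c → b ≢ d → ⊥
    no-4-cycle {a} {b} {c} {d} ab bc cd da a≢c b≢d = too-short (ℕₚ.≤ᵇ⇒≤ 3 4 _) (ℕₚ.≤ᵇ⇒≤ 5 6 _)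
      (a ∷ b ∷ c ∷ d ∷ [])
      ((~⇒≢ ab ∷ a≢c ∷ ~⇒≢ (~-sym da) ∷ []) ∷
       (~⇒≢ bc ∷ b≢d ∷ []) ∷
       (~⇒≢ cd ∷ []) ∷ [] ∷ [])
      (λ { zero → ab ; (suc zero) → bc ; (suc (suc zero)) → cd }) da

    no-5-cycle : ∀ {a b c d e} → a ~ b → b ~ c → c ~ d → d ~ e → e ~ a →
                 a ≢ c → a ≢ d → b ≢ d → b ≢ e → c ≢ e → ⊥
    no-5-cycle {a} {b} {c} {d} {e} ab bc cd de ea a≢c a≢d b≢d b≢e c≢e =
      too-short (ℕₚ.≤ᵇ⇒≤ 3 5 _) (ℕₚ.≤ᵇ⇒≤ 6 6 _)
      (a ∷ b ∷ c ∷ d ∷ e ∷ [])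
      ((~⇒≢ ab ∷ a≢c ∷ a≢d ∷ ~⇒≢ (~-sym ea) ∷ []) ∷
       (~⇒≢ bc ∷ b≢d ∷ b≢e ∷ []) ∷
       (~⇒≢ cd ∷ c≢e ∷ []) ∷
       (~⇒≢ de ∷ []) ∷ [] ∷ [])
      (λ { zero → ab ; (suc zero) → bc ; (suc (suc zero)) → cd ; (suc (suc (suc zero))) → de }) ea

-- The curvature of an edge, by Kantorovich duality.

module EdgeCurvature (em : ExcludedMiddle 0ℓ) (R : CompleteOrderedField)
                     (G : Graph) (conn : Graph.Connected G) (lf : Graph.LocallyFinite G)
                     (girth : Graph.GirthAtLeast G 6) where
  open OrderedField R
  open Sums em R
  open Graph G
  open ShortCycles G
  module C = Curvature em R

  dist : V → V → ℕ
  dist = C.dist G conn lf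

  N : V → List V
  N = C.neighbours G conn lf

  N-unique : ∀ x → Unique (N x)
  N-unique x = proj₁ (proj₂ (lf x))

  ∈N⇒~ : ∀ {x y} → y ∈ N x → x ~ y
  ∈N⇒~ {x} {y} = Equivalence.to (proj₂ (proj₂ (lf x)) y)

  ~⇒∈N : ∀ {x y} → x ~ y → y ∈ N x
  ~⇒∈N {x} {y} = Equivalence.from (proj₂ (proj₂ (lf x)) y)

  ∷N-unique : ∀ x → Unique (x ∷ N x)
  ∷N-unique x = All.tabulate (λ z∈N → ~⇒≢ (∈N⇒~ z∈N)) ∷ N-unique x

  dist-walk : ∀ u v → Walk (dist u v) u v
  dist-walk u v = proj₁ (proj₂ (C.least (λ n → Walk n u v) (proj₁ (conn u v)) (proj₂ (conn u v))))

  dist-≤ : ∀ {n u v} → Walk n u v → dist u v ℕ.≤ n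
  dist-≤ {n} {u} {v} walk =
    proj₂ (proj₂ (C.least (λ n → Walk n u v) (proj₁ (conn u v)) (proj₂ (conn u v)))) n walk

  -- The function `inf` returns whatever infimum excluded middle supplies; antisymmetry identifies
  -- it with any infimum found by hand.
  inf-≈ : ∀ {P s} → IsInf P s → C.inf P ≈ s
  inf-≈ {P} {s} (lb , glb) with em {P = ∃ (IsInf P)}
  ... | yes (s′ , lb′ , glb′) = ≤.antisym (glb s′ lb′) (glb′ s lb)
  ... | no ¬inf = ⊥-elim (¬inf (s , lb , glb))

  Ball : V → V → Set
  Ball x v = v ≡ x ⊎ x ~ v

  ball⇒∈ : ∀ {x v} → Ball x v → v ∈ x ∷ N x
  ball⇒∈ (inj₁ v≡x) = here v≡x
  ball⇒∈ (inj₂ x~v) = there (~⇒∈N x~v)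

  -- An optimal Kantorovich potential for the two measures of an edge xy;
  -- on the ball around x and the ball around y it is determined, elsewhere
  -- its values are irrelevant.
  potential : V → V → V → ℕ
  potential x y v with em {P = v ≡ x} | em {P = v ≡ y} | em {P = y ~ v}
  ... | yes _ | _     | _     = 1
  ... | no _  | yes _ | _     = 2
  ... | no _  | no _  | yes _ = 3
  ... | no _  | no _  | no _  = 0

  module _ {x y : V} (x~y : x ~ y) where

    private
      φ : V → ℕ
      φ = potential x y

    φ-x : φ x ≡ 1
    φ-x with em {P = x ≡ x} | em {P = x ≡ y} | em {P = y ~ x}
    ... | yes _  | _ | _ = ≡.refl
    ... | no x≢x | _ | _ = ⊥-elim (x≢x ≡.refl)

    φ-y : φ y ≡ 2
    φ-y with em {P = y ≡ x} | em {P = y ≡ y} | em {P = y ~ y}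
    ... | yes y≡x | _      | _ = ⊥-elim (~⇒≢ x~y (≡.sym y≡x))
    ... | no _    | yes _  | _ = ≡.refl
    ... | no _    | no y≢y | _ = ⊥-elim (y≢y ≡.refl)

    φ-N[y] : ∀ {v} → y ~ v → v ≢ x → φ v ≡ 3
    φ-N[y] {v} y~v v≢x with em {P = v ≡ x} | em {P = v ≡ y} | em {P = y ~ v}
    ... | yes v≡x | _       | _      = ⊥-elim (v≢x v≡x)
    ... | no _    | yes v≡y | _      = ⊥-elim (~⇒≢ y~v (≡.sym v≡y))
    ... | no _    | no _    | yes _  = ≡.refl
    ... | no _    | no _    | no ¬yv = ⊥-elim (¬yv y~v)

    φ-N[x] : ∀ {v} → x ~ v → v ≢ y → φ v ≡ 0
    φ-N[x] {v} x~v v≢y with em {P = v ≡ x} | em {P = v ≡ y} | em {P = y ~ v}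
    ... | yes v≡x | _       | _       = ⊥-elim (~⇒≢ x~v (≡.sym v≡x))
    ... | no _    | yes v≡y | _       = ⊥-elim (v≢y v≡y)
    ... | no _    | no _    | yes y~v = ⊥-elim (no-triangle girth x~y y~v (~-sym x~v))
    ... | no _    | no _    | no _    = ≡.refl

    data BallX (u : V) : Set where
      atX  : u ≡ x → φ u ≡ 1 → BallX u
      atY  : u ≡ y → φ u ≡ 2 → BallX u
      near : x ~ u → u ≢ y → φ u ≡ 0 → BallX u

    data BallY (v : V) : Set where
      atX  : v ≡ x → φ v ≡ 1 → BallY v
      atY  : v ≡ y → φ v ≡ 2 → BallY v
      near : y ~ v → v ≢ x → φ v ≡ 3 → BallY v

    ballX : ∀ {u} → Ball x u → BallX u
    ballX (inj₁ ≡.refl) = atX ≡.refl φ-x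
    ballX {u} (inj₂ x~u) with em {P = u ≡ y}
    ... | yes ≡.refl = atY ≡.refl φ-y
    ... | no u≢y     = near x~u u≢y (φ-N[x] x~u u≢y)

    ballY : ∀ {v} → Ball y v → BallY v
    ballY (inj₁ ≡.refl) = atY ≡.refl φ-y
    ballY {v} (inj₂ y~v) with em {P = v ≡ x}
    ... | yes ≡.refl = atX ≡.refl φ-x
    ... | no v≢x     = near y~v v≢x (φ-N[y] y~v v≢x)

    -- The potential rises by at most 3, so only walks shorter than the rise have to be excluded.
    -- Those are ruled out by irreflexivity, by the case hypotheses, or by a cycle of length at most
    -- 5 that they close together with the edge `x ~ y`. The longest one runs in two steps from a
    -- neighbour of `x` to a neighbour of `y` and closes a pentagon; where two of its vertices
    -- coincide, a triangle remains.
    φ-walk : ∀ {n u v} → BallX u → BallY v → Walk n u v → φ v ℕ.≤ φ u ℕ.+ n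
    φ-walk {n} {u} {v} bu bv walk = go bu bv walk
      where
      conclude : ∀ {a b} → φ u ≡ a → φ v ≡ b → b ℕ.≤ a ℕ.+ n → φ v ℕ.≤ φ u ℕ.+ n
      conclude eu ev b≤ = ≡.subst₂ (λ a b → b ℕ.≤ a ℕ.+ n) (≡.sym eu) (≡.sym ev) b≤
      go : BallX u → BallY v → Walk n u v → φ v ℕ.≤ φ u ℕ.+ n
      go (atX _ eu) (atX _ ev) _ = conclude eu ev (s≤s z≤n)
      go (atX ≡.refl eu) (atY ≡.refl ev) nil = ⊥-elim (~-irr _ x~y)
      go (atX ≡.refl eu) (atY ≡.refl ev) (cons _ _) = conclude eu ev (s≤s (s≤s z≤n))
      go (atX ≡.refl eu) (near y~v v≢x ev) nil = ⊥-elim (v≢x ≡.refl)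
      go (atX ≡.refl eu) (near y~v v≢x ev) (cons x~v nil) = ⊥-elim (no-triangle girth x~y y~v (~-sym x~v))
      go (atX ≡.refl eu) (near y~v v≢x ev) (cons _ (cons _ _)) = conclude eu ev (s≤s (s≤s (s≤s z≤n)))
      go (atY _ eu) (atX _ ev) _ = conclude eu ev (s≤s z≤n)
      go (atY _ eu) (atY _ ev) _ = conclude eu ev (s≤s (s≤s z≤n))
      go (atY ≡.refl eu) (near y~v v≢x ev) nil = ⊥-elim (~-irr _ y~v)
      go (atY ≡.refl eu) (near y~v v≢x ev) (cons _ _) = conclude eu ev (s≤s (s≤s (s≤s z≤n)))
      go (near x~u u≢y eu) (atX ≡.refl ev) nil = ⊥-elim (~-irr _ x~u)
      go (near x~u u≢y eu) (atX ≡.refl ev) (cons _ _) = conclude eu ev (s≤s z≤n)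
      go (near x~u u≢y eu) (atY ≡.refl ev) nil = ⊥-elim (u≢y ≡.refl)
      go (near x~u u≢y eu) (atY ≡.refl ev) (cons u~y nil) = ⊥-elim (no-triangle girth x~u u~y (~-sym x~y))
      go (near x~u u≢y eu) (atY ≡.refl ev) (cons _ (cons _ _)) = conclude eu ev (s≤s (s≤s z≤n))
      go (near x~u u≢y eu) (near y~v v≢x ev) nil = ⊥-elim (no-triangle girth x~y y~v (~-sym x~u))
      go (near x~u u≢y eu) (near y~v v≢x ev) (cons u~v nil) =
        ⊥-elim (no-4-cycle girth x~u u~v (~-sym y~v) (~-sym x~y) (v≢x ∘ ≡.sym) u≢y)
      go (near x~u u≢y eu) (near y~v v≢x ev) (cons {y = t} u~t (cons t~v nil)) =
        ⊥-elim (no-5-cycle girth x~u u~t t~v (~-sym y~v) (~-sym x~y)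
          (λ { ≡.refl → no-triangle girth x~y y~v (~-sym t~v) })
          (v≢x ∘ ≡.sym)
          (λ { ≡.refl → no-triangle girth x~y y~v (~-sym x~u) })
          u≢y
          (λ { ≡.refl → no-triangle girth x~u u~t (~-sym x~y) }))
      go (near _ _ eu) (near _ _ ev) (cons _ (cons _ (cons _ _))) =
        conclude eu ev (s≤s (s≤s (s≤s z≤n)))

    φ-lipschitz : ∀ {u v} → Ball x u → Ball y v → φ v ℕ.≤ φ u ℕ.+ dist u v
    φ-lipschitz {u} {v} bu bv = φ-walk (ballX bu) (ballY bv) (dist-walk u v)

    -- Complementary slackness: the optimal coupling charges only pairs on which the Lipschitz bound
    -- is attained. These are the pairs starting at `x`, treated here, and those ending at `y`,
    -- treated in `φ-tight-y`.
    φ-tight-x : ∀ {v} → Ball y v → φ x ℕ.+ dist x v ℕ.≤ φ v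
    φ-tight-x {v} bv with ballY bv
    ... | atX ≡.refl ev     = ≡.subst₂ (λ a b → a ℕ.+ dist x x ℕ.≤ b) (≡.sym φ-x) (≡.sym ev) (s≤s (dist-≤ nil))
    ... | atY ≡.refl ev     = ≡.subst₂ (λ a b → a ℕ.+ dist x y ℕ.≤ b) (≡.sym φ-x) (≡.sym ev) (s≤s (dist-≤ (cons x~y nil)))
    ... | near y~v _ ev = ≡.subst₂ (λ a b → a ℕ.+ dist x v ℕ.≤ b) (≡.sym φ-x) (≡.sym ev) (s≤s (dist-≤ (cons x~y (cons y~v nil))))

    φ-tight-y : ∀ {u} → x ~ u → φ u ℕ.+ dist u y ℕ.≤ φ y
    φ-tight-y {u} x~u with ballX (inj₂ x~u)
    ... | atX ≡.refl eu = ⊥-elim (~-irr _ x~u)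
    ... | atY ≡.refl eu = ≡.subst₂ (λ a b → a ℕ.+ dist y y ℕ.≤ b) (≡.sym eu) (≡.sym φ-y) (s≤s (s≤s (dist-≤ nil)))
    ... | near _ _ eu   = ≡.subst₂ (λ a b → a ℕ.+ dist u y ℕ.≤ b) (≡.sym eu) (≡.sym φ-y) (dist-≤ (cons (~-sym x~u) (cons x~y nil)))

  module Duality {μ ν : V → Carrier} (π : C.Coupling G conn lf μ ν) (φ : V → ℕ) where
    open C.Coupling π

    vanishesˡ : ∀ {u} v → μ u ≈ 0# → plan u v ≈ 0#
    vanishesˡ {u} v μu≈0 with em {P = u ∈ support × v ∈ support}
    ... | no ¬uv       = vanishes u v ¬uv
    ... | yes (_ , v∈) = ≤.antisym (begin
      plan u v                  ≈⟨ +-identityʳ _ ⟨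
      ∑ (v ∷ []) (plan u)       ≤⟨ ∑-⊆ (All.[] ∷ []) (λ { (here ≡.refl) → v∈ }) (λ _ → nonneg u _) ⟩
      ∑ support (plan u)        ≈⟨ marginalˡ u ⟩
      μ u                       ≈⟨ μu≈0 ⟩
      0#                        ∎) (nonneg u v)
      where open ≤-Reasoning

    vanishesʳ : ∀ u {v} → ν v ≈ 0# → plan u v ≈ 0#
    vanishesʳ u {v} νv≈0 with em {P = u ∈ support × v ∈ support}
    ... | no ¬uv       = vanishes u v ¬uv
    ... | yes (u∈ , _) = ≤.antisym (begin
      plan u v                        ≈⟨ +-identityʳ _ ⟨
      ∑ (u ∷ []) (λ u → plan u v)     ≤⟨ ∑-⊆ (All.[] ∷ []) (λ { (here ≡.refl) → u∈ }) (λ _ → nonneg _ v) ⟩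
      ∑ support (λ u → plan u v)      ≈⟨ marginalʳ v ⟩
      ν v                             ≈⟨ νv≈0 ⟩
      0#                              ∎) (nonneg u v)
      where open ≤-Reasoning

    outsideˡ : ∀ {u} → u ∉ support → μ u ≈ 0#
    outsideˡ {u} u∉ = ≈-trans (≈-sym (marginalˡ u)) (∑-0 support λ {v} _ → vanishes u v (u∉ ∘ proj₁))

    outsideʳ : ∀ {v} → v ∉ support → ν v ≈ 0#
    outsideʳ {v} v∉ = ≈-trans (≈-sym (marginalʳ v)) (∑-0 support λ {u} _ → vanishes u v (v∉ ∘ proj₂))

    ∑² : (V → V → Carrier) → Carrier
    ∑² f = ∑ support λ u → ∑ support (f u)

    ∑²-mono : ∀ {f g} → (∀ u v → f u v ≤ g u v) → ∑² f ≤ ∑² g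
    ∑²-mono f≤g = ∑-mono support λ _ → ∑-mono support λ _ → f≤g _ _

    target : ∑ support (λ v → φ v · ν v) ≈ ∑² (λ u v → φ v · plan u v)
    target = begin
      ∑ support (λ v → φ v · ν v)
        ≈⟨ ∑-cong support (λ {v} _ → ·-congʳ (φ v) (marginalʳ v)) ⟨
      ∑ support (λ v → φ v · ∑ support (λ u → plan u v))
        ≈⟨ ∑-cong support (λ {v} _ → ∑-· support (φ v) (λ u → plan u v)) ⟨
      ∑ support (λ v → ∑ support (λ u → φ v · plan u v))
        ≈⟨ ∑-swap support support (λ u v → φ v · plan u v) ⟨
      ∑² (λ u v → φ v · plan u v) ∎
      where open ≈-Reasoning

    -- Keeping the cost on the side of the source avoids differences of potential values, which can
    -- then stay in ℕ.
    source+cost : ∑ support (λ u → φ u · μ u) + cost ≈ ∑² (λ u v → (φ u ℕ.+ dist u v) · plan u v)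
    source+cost = begin
      ∑ support (λ u → φ u · μ u) + cost
        ≈⟨ +-congʳ (∑-cong support λ {u} _ → ·-congʳ (φ u) (marginalˡ u)) ⟨
      ∑ support (λ u → φ u · ∑ support (plan u)) + cost
        ≈⟨ ∑-+ support _ _ ⟨
      ∑ support (λ u → φ u · ∑ support (plan u) + ∑ support (λ v → dist u v · plan u v))
        ≈⟨ ∑-cong support (λ {u} _ → ≈-trans (∑-+ support _ _) (+-congʳ (∑-· support (φ u) (plan u)))) ⟨
      ∑² (λ u v → φ u · plan u v + dist u v · plan u v)
        ≈⟨ ∑-cong support (λ {u} _ → ∑-cong support λ {v} _ → ·-homo-+ (φ u) (dist u v) (plan u v)) ⟨
      ∑² (λ u v → (φ u ℕ.+ dist u v) · plan u v) ∎
      where open ≈-Reasoning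

    -- The comparison is asked for only where the plan is nonzero, because the potential is
    -- Lipschitz merely from one ball to the other.
    ·-on-plan : ∀ {m n} u v → (¬ plan u v ≈ 0# → m ℕ.≤ n) → m · plan u v ≤ n · plan u v
    ·-on-plan {m} {n} u v m≤n with em {P = plan u v ≈ 0#}
    ... | yes p≈0 = ≤.reflexive (≈-trans (≈-trans (·-congʳ m p≈0) (·-zeroʳ m))
                                         (≈-sym (≈-trans (·-congʳ n p≈0) (·-zeroʳ n))))
    ... | no p≉0  = ·-monoˡ (m≤n p≉0) (nonneg u v)

    lipschitz⇒≤ : (∀ u v → ¬ plan u v ≈ 0# → φ v ℕ.≤ φ u ℕ.+ dist u v) →
                  ∑ support (λ v → φ v · ν v) ≤ ∑ support (λ u → φ u · μ u) + cost
    lipschitz⇒≤ lip = begin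
      ∑ support (λ v → φ v · ν v)                 ≈⟨ target ⟩
      ∑² (λ u v → φ v · plan u v)                 ≤⟨ ∑²-mono (λ u v → ·-on-plan u v (lip u v)) ⟩
      ∑² (λ u v → (φ u ℕ.+ dist u v) · plan u v)  ≈⟨ source+cost ⟨
      ∑ support (λ u → φ u · μ u) + cost          ∎
      where open ≤-Reasoning

    tight⇒≥ : (∀ u v → ¬ plan u v ≈ 0# → φ u ℕ.+ dist u v ℕ.≤ φ v) →
              ∑ support (λ u → φ u · μ u) + cost ≤ ∑ support (λ v → φ v · ν v)
    tight⇒≥ tight = begin
      ∑ support (λ u → φ u · μ u) + cost          ≈⟨ source+cost ⟩
      ∑² (λ u v → (φ u ℕ.+ dist u v) · plan u v)  ≤⟨ ∑²-mono (λ u v → ·-on-plan u v (tight u v)) ⟩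
      ∑² (λ u v → φ v · plan u v)                 ≈⟨ target ⟨
      ∑ support (λ v → φ v · ν v)                 ∎
      where open ≤-Reasoning

  module _ (W : C.Weight G conn lf) where
    open C.Weight W

    d : V → Carrier
    d = C.degree G conn lf W

    0<d : ∀ {x y} → x ~ y → 0# < d x
    0<d {x} {y} x~y = <-≤-trans (positive x~y) (begin
      w x y              ≈⟨ +-identityʳ _ ⟨
      ∑ (y ∷ []) (w x)   ≤⟨ ∑-⊆ (All.[] ∷ []) (λ { (here ≡.refl) → ~⇒∈N x~y }) (λ z∈N → <⇒≤ (positive (∈N⇒~ z∈N))) ⟩
      d x                ∎)
      where open ≤-Reasoning

    p : V → V → Carrier
    p x z = w x z * d x ⁻¹

    ∑p≈1 : ∀ {x y} → x ~ y → ∑ (N x) (p x) ≈ 1#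
    ∑p≈1 {x} x~y = ≈-trans (∑-*ʳ (N x) (d x ⁻¹) (w x)) (*-inverse (0<d x~y))

    0≤p : ∀ {x z} → x ~ z → 0# ≤ p x z
    0≤p x~z = *-nonneg (<⇒≤ (positive x~z)) (<⇒≤ (0<⁻¹ (0<d x~z)))

    μ : Carrier → V → V → Carrier
    μ = C.μ G conn lf W

    μ-self : ∀ α x → μ α x x ≈ α
    μ-self α x with em {P = x ≡ x} | em {P = x ~ x}
    ... | yes _  | _ = ≈-refl
    ... | no x≢x | _ = ⊥-elim (x≢x ≡.refl)

    μ-~ : ∀ α {x z} → x ~ z → μ α x z ≈ (1# - α) * p x z
    μ-~ α {x} {z} x~z with em {P = z ≡ x} | em {P = x ~ z}
    ... | yes z≡x | _      = ⊥-elim (~⇒≢ x~z (≡.sym z≡x))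
    ... | no _    | yes _  = ≈-refl
    ... | no _    | no ¬xz = ⊥-elim (¬xz x~z)

    μ-outside : ∀ α {x z} → ¬ Ball x z → μ α x z ≈ 0#
    μ-outside α {x} {z} ¬xz with em {P = z ≡ x} | em {P = x ~ z}
    ... | yes z≡x | _       = ⊥-elim (¬xz (inj₁ z≡x))
    ... | no _    | yes x~z = ⊥-elim (¬xz (inj₂ x~z))
    ... | no _    | no _    = ≈-refl

    μ-ball : ∀ {α x z} → ¬ μ α x z ≈ 0# → Ball x z
    μ-ball {α} {x} {z} μ≉0 with em {P = Ball x z}
    ... | yes b = b
    ... | no ¬b = ⊥-elim (μ≉0 (μ-outside α ¬b))

    -- The list `S` is arbitrary because every coupling brings its own support; it is exchanged for
    -- the ball around `x`, off which the measure vanishes.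
    ∑-μ : ∀ (φ : V → ℕ) α x {S} → Unique S → (∀ {v} → v ∉ S → μ α x v ≈ 0#) →
          ∑ S (λ v → φ v · μ α x v) ≈ φ x · α + (1# - α) * ∑ (N x) (λ z → φ z · p x z)
    ∑-μ φ α x {S} uS out = begin
      ∑ S (λ v → φ v · μ α x v)
        ≈⟨ ∑-support uS (∷N-unique x)
             (λ {v} _ v∉ → ≈-trans (·-congʳ (φ v) (μ-outside α (v∉ ∘ ball⇒∈))) (·-zeroʳ (φ v)))
             (λ {v} _ v∉ → ≈-trans (·-congʳ (φ v) (out v∉)) (·-zeroʳ (φ v))) ⟩
      φ x · μ α x x + ∑ (N x) (λ v → φ v · μ α x v)
        ≈⟨ +-cong (·-congʳ (φ x) (μ-self α x)) (∑-cong (N x) λ {z} z∈N → begin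
             φ z · μ α x z                   ≈⟨ ·-congʳ (φ z) (μ-~ α (∈N⇒~ z∈N)) ⟩
             φ z · ((1# - α) * p x z)        ≈⟨ ·1* (φ z) _ ⟩
             φ z · 1# * ((1# - α) * p x z)   ≈⟨ solve 3 (λ a b c → a :* (b :* c) := b :* (a :* c)) ≈-refl _ _ _ ⟩
             (1# - α) * (φ z · 1# * p x z)   ≈⟨ *-congˡ (·1* (φ z) _) ⟨
             (1# - α) * (φ z · p x z)        ∎) ⟩
      φ x · α + ∑ (N x) (λ z → (1# - α) * (φ z · p x z))
        ≈⟨ +-congˡ (∑-*ˡ (N x) (1# - α) _) ⟩
      φ x · α + (1# - α) * ∑ (N x) (λ z → φ z · p x z) ∎
      where open ≈-Reasoning

    module _ {x y : V} (x~y : x ~ y) where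

      private
        φ : V → ℕ
        φ = potential x y

      ∑φp-x : ∑ (N x) (λ z → φ z · p x z) ≈ (1# + 1#) * p x y
      ∑φp-x = let zs , pm = extract (~⇒∈N x~y); u = Unique-resp-↭ pm (N-unique x) in begin
        ∑ (N x) (λ z → φ z · p x z)
          ≈⟨ ∑-↭ (λ z → φ z · p x z) pm ⟩
        φ y · p x y + ∑ zs (λ z → φ z · p x z)
          ≈⟨ +-cong (reflexive (≡.cong (_· p x y) (φ-y x~y)))
               (∑-0 zs λ {z} z∈zs → reflexive (≡.cong (_· p x z)
                 (φ-N[x] x~y (∈N⇒~ (∈-resp-↭ (↭.↭-sym pm) (there z∈zs))) (Unique-head u z∈zs)))) ⟩
        (p x y + (p x y + 0#)) + 0#
          ≈⟨ +-identityʳ _ ⟩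
        p x y + (p x y + 0#)
          ≈⟨ +-congˡ (+-identityʳ _) ⟩
        p x y + p x y
          ≈⟨ solve 1 (λ a → a :+ a := :2 :* a) ≈-refl (p x y) ⟩
        (1# + 1#) * p x y ∎
        where open ≈-Reasoning

      -- The potential is 1 at `x` and 3 at all other neighbours of `y`, so its mean is
      -- `p y x + 3 (1 - p y x)`.
      ∑φp-y : ∑ (N y) (λ z → φ z · p y z) ≈ 1# + (1# + 1#) - (1# + 1#) * p y x
      ∑φp-y = let zs , pm = extract (~⇒∈N (~-sym x~y)); u = Unique-resp-↭ pm (N-unique y) in begin
        ∑ (N y) (λ z → φ z · p y z)
          ≈⟨ ∑-↭ (λ z → φ z · p y z) pm ⟩
        φ x · p y x + ∑ zs (λ z → φ z · p y z)
          ≈⟨ +-cong (≈-trans (reflexive (≡.cong (_· p y x) (φ-x x~y))) (+-identityʳ _))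
               (≈-trans (∑-cong zs λ {z} z∈zs → reflexive (≡.cong (_· p y z)
                 (φ-N[y] x~y (∈N⇒~ (∈-resp-↭ (↭.↭-sym pm) (there z∈zs))) (Unique-head u z∈zs))))
                 (∑-· zs 3 (p y))) ⟩
        p y x + 3 · ∑ zs (p y)
          ≈⟨ +-congˡ (+-congˡ (+-congˡ (+-identityʳ _))) ⟩
        p y x + (∑ zs (p y) + (∑ zs (p y) + ∑ zs (p y)))
          ≈⟨ solve 2 (λ a s → a :+ (s :+ (s :+ s)) := :3 :* (a :+ s) :- :2 :* a) ≈-refl (p y x) (∑ zs (p y)) ⟩
        (1# + (1# + 1#)) * (p y x + ∑ zs (p y)) - (1# + 1#) * p y x
          ≈⟨ +-congʳ (≈-trans (*-congˡ (≈-trans (≈-sym (∑-↭ (p y) pm)) (∑p≈1 (~-sym x~y)))) (*-identityʳ _)) ⟩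
        1# + (1# + 1#) - (1# + 1#) * p y x ∎
        where open ≈-Reasoning

      curvature : Carrier
      curvature = (1# + 1#) * (p x y + p y x - 1#)

      -- The difference of the integrals of the potential against the two measures: with β = 1 - α
      -- they are `2α + β (3 - 2 p y x)` at `y` and `α + 2β p x y` at `x`. For every α it bounds the
      -- cost of a coupling from below; a tight coupling attains it.
      transportCost : Carrier → Carrier
      transportCost α = 1# - (1# - α) * curvature

      ∑φμ : ∀ α {S} → Unique S → (∀ {v} → v ∉ S → μ α x v ≈ 0#) → (∀ {v} → v ∉ S → μ α y v ≈ 0#) →
            ∑ S (λ v → φ v · μ α y v) ≈ ∑ S (λ v → φ v · μ α x v) + transportCost α
      ∑φμ α {S} uS outx outy = begin
        ∑ S (λ v → φ v · μ α y v)
          ≈⟨ ∑-μ φ α y uS outy ⟩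
        φ y · α + (1# - α) * ∑ (N y) (λ z → φ z · p y z)
          ≈⟨ +-cong (≈-trans (reflexive (≡.cong (_· α) (φ-y x~y))) (+-congˡ (+-identityʳ α))) (*-congˡ ∑φp-y) ⟩
        (α + α) + (1# - α) * (1# + (1# + 1#) - (1# + 1#) * p y x)
          ≈⟨ solve 3 (λ α a b → α :+ α :+ (:1 :- α) :* (:3 :- :2 :* b)
               := α :+ (:1 :- α) :* (:2 :* a) :+ (:1 :- (:1 :- α) :* (:2 :* (a :+ b :- :1))))
               ≈-refl α (p x y) (p y x) ⟩
        α + (1# - α) * ((1# + 1#) * p x y) + transportCost α
          ≈⟨ +-congʳ (+-cong (≈-trans (reflexive (≡.cong (_· α) (φ-x x~y))) (+-identityʳ α)) (*-congˡ ∑φp-x)) ⟨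
        φ x · α + (1# - α) * ∑ (N x) (λ z → φ z · p x z) + transportCost α
          ≈⟨ +-congʳ (∑-μ φ α x uS outx) ⟨
        ∑ S (λ v → φ v · μ α x v) + transportCost α ∎
        where open ≈-Reasoning

      module _ (α : Carrier) (π : C.Coupling G conn lf (μ α x) (μ α y)) where
        open C.Coupling π
        open Duality π φ

        private
          +-cancelˡ-≤ : ∀ a {b c} → a + b ≤ a + c → b ≤ c
          +-cancelˡ-≤ a {b} {c} ab≤ac = ≤-by _ (0≤y-x ab≤ac)
            (solve 3 (λ a b c → c := b :+ (a :+ c :- (a :+ b))) ≈-refl a b c)

        cost-≥ : transportCost α ≤ cost
        cost-≥ = +-cancelˡ-≤ _ (≤-respˡ (∑φμ α unique outsideˡ outsideʳ)
          (lipschitz⇒≤ λ u v plan≉0 → φ-lipschitz x~y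
            (μ-ball (plan≉0 ∘ vanishesˡ v)) (μ-ball (plan≉0 ∘ vanishesʳ u))))

        cost-≤ : (∀ u v → ¬ plan u v ≈ 0# → φ u ℕ.+ dist u v ℕ.≤ φ v) → cost ≤ transportCost α
        cost-≤ tight = +-cancelˡ-≤ _ (≤-respʳ (∑φμ α unique outsideˡ outsideʳ) (tight⇒≥ tight))

  δ : V → V → Carrier
  δ a v with em {P = v ≡ a}
  ... | yes _ = 1#
  ... | no _  = 0#

  δ-self : ∀ a → δ a a ≈ 1#
  δ-self a with em {P = a ≡ a}
  ... | yes _  = ≈-refl
  ... | no a≢a = ⊥-elim (a≢a ≡.refl)

  δ-≢ : ∀ {a v} → v ≢ a → δ a v ≈ 0#
  δ-≢ {a} {v} v≢a with em {P = v ≡ a}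
  ... | yes v≡a = ⊥-elim (v≢a v≡a)
  ... | no _    = ≈-refl

  0≤δ : ∀ a v → 0# ≤ δ a v
  0≤δ a v with em {P = v ≡ a}
  ... | yes _ = 0≤1
  ... | no _  = ≤.refl

  ∑δ : ∀ {S a} → Unique S → a ∈ S → ∑ S (δ a) ≈ 1#
  ∑δ {a = a} uS a∈S = ≈-trans (∑-point uS a∈S δ-≢) (δ-self a)

  module _ (W : C.Weight G conn lf) where
    open C.Weight W

    ρ : V → V → Carrier
    ρ x z with em {P = x ~ z}
    ... | yes _ = p W x z
    ... | no _  = 0#

    ρ-~ : ∀ {x z} → x ~ z → ρ x z ≈ p W x z
    ρ-~ {x} {z} x~z with em {P = x ~ z}
    ... | yes _  = ≈-refl
    ... | no ¬xz = ⊥-elim (¬xz x~z)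

    ρ-≁ : ∀ {x z} → ¬ x ~ z → ρ x z ≈ 0#
    ρ-≁ {x} {z} ¬xz with em {P = x ~ z}
    ... | yes x~z = ⊥-elim (¬xz x~z)
    ... | no _    = ≈-refl

    0≤ρ : ∀ x z → 0# ≤ ρ x z
    0≤ρ x z with em {P = x ~ z}
    ... | yes x~z = 0≤p W x~z
    ... | no _    = ≤.refl

    ∑ρ : ∀ {S x y} → x ~ y → Unique S → (∀ {z} → z ∈ N x → z ∈ S) → ∑ S (ρ x) ≈ 1#
    ∑ρ {S} {x} x~y uS N⊆S = begin
      ∑ S (ρ x)       ≈⟨ ∑-support uS (N-unique x) (λ _ z∉N → ρ-≁ (z∉N ∘ ~⇒∈N)) (λ z∈N z∉S → ⊥-elim (z∉S (N⊆S z∈N))) ⟩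
      ∑ (N x) (ρ x)   ≈⟨ ∑-cong (N x) (λ z∈N → ρ-~ (∈N⇒~ z∈N)) ⟩
      ∑ (N x) (p W x) ≈⟨ ∑p≈1 W x~y ⟩
      1#              ∎
      where open ≈-Reasoning

    -- As a combination of a point mass and the step distribution, both defined on all vertices, the
    -- measure no longer involves a case distinction, and the marginals of the coupling become ring
    -- identities.
    μ-split : ∀ α x z → μ W α x z ≈ α * δ x z + (1# - α) * ρ x z
    μ-split α x z with em {P = z ≡ x} | em {P = x ~ z}
    ... | yes ≡.refl | yes x~x = ⊥-elim (~-irr x x~x)
    ... | yes _      | no _    = ≈-sym (≈-trans (+-cong (*-identityʳ α) (zeroʳ _)) (+-identityʳ α))
    ... | no _ | yes _ = ≈-sym (≈-trans (+-congʳ (zeroʳ α)) (+-identityˡ _))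
    ... | no _ | no _  = ≈-sym (≈-trans (+-cong (zeroʳ α) (zeroʳ _)) (+-identityˡ 0#))

    module _ {x y : V} (x~y : x ~ y) where

      private
        y~x : y ~ x
        y~x = ~-sym x~y

        -- Each of `x` and `y` is a neighbour of the other, so this list contains them both; it has
        -- no duplicates because there is no triangle.
        S : List V
        S = N x ++ N y

        S-unique : Unique S
        S-unique = ++⁺ (N-unique x) (N-unique y) λ { (z∈Nx , z∈Ny) →
          no-triangle girth x~y (∈N⇒~ z∈Ny) (~-sym (∈N⇒~ z∈Nx)) }

        x∈S : x ∈ S
        x∈S = ∈-++⁺ʳ (N x) (~⇒∈N y~x)

        y∈S : y ∈ S
        y∈S = ∈-++⁺ˡ (~⇒∈N x~y)

      -- The mass on the neighbours of x all ends at y, and the mass required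
      -- on the neighbours of y all comes from x.
      coupling : ∀ α → 0# ≤ 1# - α → 0# ≤ α - (1# - α) → C.Coupling G conn lf (μ W α x) (μ W α y)
      coupling α 0≤β 0≤γ = record
        { plan = plan ; support = S ; unique = S-unique ; vanishes = vanishes
        ; nonneg = nonneg ; marginalˡ = marginalˡ ; marginalʳ = marginalʳ }
        where
        β γ : Carrier
        β = 1# - α
        -- The mass sent directly from `x` to `y`: of the mass α at `x`, an amount β is distributed
        -- over the neighbours of `y`. It is nonnegative exactly when α is at least 1/2.
        γ = α - (1# - α)

        plan : V → V → Carrier
        plan u v = δ x u * (β * ρ y v + γ * δ y v) + β * ρ x u * δ y v

        plan-0 : ∀ {u v} → (δ x u ≈ 0# × ρ x u ≈ 0#) ⊎ (ρ y v ≈ 0# × δ y v ≈ 0#) → plan u v ≈ 0#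
        plan-0 {u} {v} (inj₁ (δ≈0 , ρ≈0)) = ≈-trans
          (+-cong (*-congʳ δ≈0) (*-congʳ (*-congˡ ρ≈0)))
          (≈-trans (+-cong (zeroˡ _) (≈-trans (*-congʳ (zeroʳ β)) (zeroˡ _))) (+-identityˡ 0#))
        plan-0 {u} {v} (inj₂ (ρ≈0 , δ≈0)) = ≈-trans
          (+-cong (*-congˡ (≈-trans (+-cong (≈-trans (*-congˡ ρ≈0) (zeroʳ β))
                                            (≈-trans (*-congˡ δ≈0) (zeroʳ γ))) (+-identityˡ 0#)))
                  (*-congˡ δ≈0))
          (≈-trans (+-cong (zeroʳ _) (zeroʳ _)) (+-identityˡ 0#))

        vanishes : ∀ u v → ¬ (u ∈ S × v ∈ S) → plan u v ≈ 0#
        vanishes u v ¬uv with em {P = u ∈ S}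
        ... | no u∉S  = plan-0 (inj₁ (δ-≢ (λ { ≡.refl → u∉S x∈S }) , ρ-≁ (u∉S ∘ ∈-++⁺ˡ ∘ ~⇒∈N)))
        ... | yes u∈S = plan-0 (inj₂ (ρ-≁ (v∉S ∘ ∈-++⁺ʳ (N x) ∘ ~⇒∈N) , δ-≢ (λ { ≡.refl → v∉S y∈S })))
          where
          v∉S : v ∉ S
          v∉S v∈S = ¬uv (u∈S , v∈S)

        nonneg : ∀ u v → 0# ≤ plan u v
        nonneg u v = 0≤+ (*-nonneg (0≤δ x u) (0≤+ (*-nonneg 0≤β (0≤ρ y v)) (*-nonneg 0≤γ (0≤δ y v))))
                         (*-nonneg (*-nonneg 0≤β (0≤ρ x u)) (0≤δ y v))

        marginalˡ : ∀ u → ∑ S (plan u) ≈ μ W α x u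
        marginalˡ u = begin
          ∑ S (plan u)
            ≈⟨ ∑-+ S _ _ ⟩
          ∑ S (λ v → δ x u * (β * ρ y v + γ * δ y v)) + ∑ S (λ v → β * ρ x u * δ y v)
            ≈⟨ +-cong (≈-trans (∑-*ˡ S _ _) (*-congˡ (≈-trans (∑-+ S _ _) (+-cong (∑-*ˡ S β _) (∑-*ˡ S γ _))))) (∑-*ˡ S _ _) ⟩
          δ x u * (β * ∑ S (ρ y) + γ * ∑ S (δ y)) + β * ρ x u * ∑ S (δ y)
            ≈⟨ +-cong (*-congˡ (+-cong (*-congˡ (∑ρ y~x S-unique (∈-++⁺ʳ (N x)))) (*-congˡ (∑δ S-unique y∈S)))) (*-congˡ (∑δ S-unique y∈S)) ⟩
          δ x u * (β * 1# + γ * 1#) + β * ρ x u * 1#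
            ≈⟨ solve 3 (λ α d r → d :* ((:1 :- α) :* :1 :+ (α :- (:1 :- α)) :* :1) :+ (:1 :- α) :* r :* :1
                 := α :* d :+ (:1 :- α) :* r) ≈-refl α (δ x u) (ρ x u) ⟩
          α * δ x u + β * ρ x u
            ≈⟨ μ-split α x u ⟨
          μ W α x u ∎
          where open ≈-Reasoning

        marginalʳ : ∀ v → ∑ S (λ u → plan u v) ≈ μ W α y v
        marginalʳ v = begin
          ∑ S (λ u → plan u v)
            ≈⟨ ∑-+ S _ _ ⟩
          ∑ S (λ u → δ x u * (β * ρ y v + γ * δ y v)) + ∑ S (λ u → β * ρ x u * δ y v)
            ≈⟨ +-cong (∑-*ʳ S _ _) (≈-trans (∑-*ʳ S _ _) (*-congʳ (∑-*ˡ S β _))) ⟩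
          ∑ S (δ x) * (β * ρ y v + γ * δ y v) + β * ∑ S (ρ x) * δ y v
            ≈⟨ +-cong (*-congʳ (∑δ S-unique x∈S)) (*-congʳ (*-congˡ (∑ρ x~y S-unique ∈-++⁺ˡ))) ⟩
          1# * (β * ρ y v + γ * δ y v) + β * 1# * δ y v
            ≈⟨ solve 3 (λ α d r → :1 :* ((:1 :- α) :* r :+ (α :- (:1 :- α)) :* d) :+ (:1 :- α) :* :1 :* d
                 := α :* d :+ (:1 :- α) :* r) ≈-refl α (δ y v) (ρ y v) ⟩
          α * δ y v + β * ρ y v
            ≈⟨ μ-split α y v ⟨
          μ W α y v ∎
          where open ≈-Reasoning

      coupling-tight : ∀ α 0≤β 0≤γ u v → ¬ C.Coupling.plan (coupling α 0≤β 0≤γ) u v ≈ 0# →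
                       potential x y u ℕ.+ dist u v ℕ.≤ potential x y v
      coupling-tight α 0≤β 0≤γ u v plan≉0 = go em em em em
        where
        -- Only the vanishing statements are taken from here; they do not mention the potential, so
        -- a constant stands in for it.
        open Duality (coupling α 0≤β 0≤γ) (λ _ → 0)
        go : Dec (u ≡ x) → Dec (Ball y v) → Dec (v ≡ y) → Dec (x ~ u) →
             potential x y u ℕ.+ dist u v ℕ.≤ potential x y v
        go (yes ≡.refl) (yes yv) _ _ = φ-tight-x x~y yv
        go (yes ≡.refl) (no ¬yv) _ _ = ⊥-elim (plan≉0 (vanishesʳ u (μ-outside W α ¬yv)))
        go (no u≢x) _ (yes ≡.refl) (yes x~u) = φ-tight-y x~y x~u
        go (no u≢x) _ _ (no ¬xu) = ⊥-elim (plan≉0 (vanishesˡ v (μ-outside W α [ u≢x , ¬xu ]′)))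
        go (no u≢x) _ (no v≢y) _ = ⊥-elim (plan≉0 (≈-trans
          (+-cong (≈-trans (*-congʳ (δ-≢ u≢x)) (zeroˡ _)) (≈-trans (*-congˡ (δ-≢ v≢y)) (zeroʳ _)))
          (+-identityˡ 0#)))

      W₁-≈ : ∀ α → 0# ≤ 1# - α → 0# ≤ α - (1# - α) →
             C.W₁ G conn lf (μ W α x) (μ W α y) ≈ transportCost W x~y α
      W₁-≈ α 0≤β 0≤γ = inf-≈
        ( (λ { r (π , cost≈r) → ≤-respʳ cost≈r (cost-≥ W x~y α π) })
        , λ b lb → ≤.trans (lb _ (coupling α 0≤β 0≤γ , ≈-refl))
                     (cost-≤ W x~y α (coupling α 0≤β 0≤γ) (coupling-tight α 0≤β 0≤γ)))

      κ/[1-α]-≈ : ∀ α → 0# < 1# - α → 0# ≤ α - (1# - α) →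
                  C.κ G conn lf W α x y * (1# - α) ⁻¹ ≈ curvature W x~y
      κ/[1-α]-≈ α 0<β 0≤γ = begin
        (1# - C.W₁ G conn lf (μ W α x) (μ W α y)) * (1# - α) ⁻¹
          ≈⟨ *-congʳ (+-congˡ (-‿cong (W₁-≈ α (<⇒≤ 0<β) 0≤γ))) ⟩
        (1# - (1# - (1# - α) * c)) * (1# - α) ⁻¹
          ≈⟨ *-congʳ (solve 2 (λ b c → :1 :- (:1 :- b :* c) := c :* b) ≈-refl (1# - α) c) ⟩
        c * (1# - α) * (1# - α) ⁻¹
          ≈⟨ *-cancel⁻¹ c 0<β ⟩
        c ∎
        where
        open ≈-Reasoning
        c = curvature W x~y

      private
        0≤2α-1 : ∀ {α} → 1# - ½ ≤ α → 0# ≤ α - (1# - α)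
        0≤2α-1 {α} ½≤α = ≤-respʳ (begin
          (α - (1# - ½)) + (α - (1# - ½))
            ≈⟨ solve 2 (λ a h → (a :- (:1 :- h)) :+ (a :- (:1 :- h)) := a :- (:1 :- a) :+ ((h :+ h) :- :1)) ≈-refl α ½ ⟩
          α - (1# - α) + (½ + ½ - 1#)
            ≈⟨ +-congˡ (≈-trans (+-congʳ ½+½) (-‿inverseʳ 1#)) ⟩
          α - (1# - α) + 0#
            ≈⟨ +-identityʳ _ ⟩
          α - (1# - α) ∎)
          (0≤+ (0≤y-x ½≤α) (0≤y-x ½≤α))
          where open ≈-Reasoning

      κLLY-limit : C.κLLY_,_⟶_ G conn lf W x y (curvature W x~y)
      -- The quotient is constant from 1/2 on, so one radius serves every ε.
      κLLY-limit ε 0<ε = ½ , 0<½ , λ α _ ½<α α<1 →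
        let q≈c = κ/[1-α]-≈ α (0<y-x α<1) (0≤2α-1 (<⇒≤ ½<α)) in
        <-respʳ (≈-sym q≈c) (<-by ε 0<ε (solve 2 (λ c e → c := c :- e :+ e) ≈-refl _ ε)) ,
        <-respˡ (≈-sym q≈c) (<-by ε 0<ε ≈-refl)

      -- Admissibility supplies some limit `k`, not yet known to be the curvature `c`. If `c` were
      -- negative, the tolerance `- c` would give `k + c < c` at a single α, chosen close to 1 and
      -- at least 1/2, against `0# ≤ k`.
      κLLY-≥0⇒curvature-≥0 : ∀ {k} → C.κLLY_,_⟶_ G conn lf W x y k → 0# ≤ k → 0# ≤ curvature W x~y
      κLLY-≥0⇒curvature-≥0 {k} lim 0≤k with em {P = 0# ≤ curvature W x~y}
      ... | yes p  = p
      ... | no 0≰c = ⊥-elim contra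
        where
        c : Carrier
        c = curvature W x~y

        0<-c : 0# < - c
        0<-c = <-respʳ (+-identityˡ (- c)) (0<y-x (≰⇒> 0≰c))

        small : ∀ {η} → 0# < η → ∃ λ θ → 0# < θ × θ ≤ ½ × θ < η
        small {η} 0<η with ≤.total ½ (η * ½)
        ... | inj₁ ½≤η½ = ½ , 0<½ , ≤.refl , ≤-<-trans ½≤η½ (half< 0<η)
        ... | inj₂ η½≤½ = η * ½ , 0<* 0<η 0<½ , η½≤½ , half< 0<η

        contra : ⊥
        contra =
          let δ , 0<δ , H = lim (- c) 0<-c
              η , 0<η , η≤½ , η<δ = small 0<δ
              α = 1# - η
              ½≤α = ≤-by {1# - ½} {α} (½ - η) (0≤y-x η≤½) (solve 2 (λ h e → :1 :- e := :1 :- h :+ (h :- e)) ≈-refl ½ η)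
              0≤1-½ = ≤-respʳ (≈-trans (solve 1 (λ h → h := h :+ h :- h) ≈-refl ½) (+-congʳ ½+½)) (<⇒≤ 0<½)
              α<1 = <-by {α} {1#} η 0<η (solve 1 (λ e → :1 := :1 :- e :+ e) ≈-refl η)
              1-δ<α = <-by {1# - δ} {α} (δ - η) (0<y-x η<δ) (solve 2 (λ d e → :1 :- e := :1 :- d :+ (d :- e)) ≈-refl δ η)
              k--c<q , _ = H α (≤.trans 0≤1-½ ½≤α) 1-δ<α α<1
              k+c<c = <-respʳ (κ/[1-α]-≈ α (0<y-x α<1) (0≤2α-1 ½≤α)) k--c<q
          in <⇒≱ k+c<c (≤-by k 0≤k (solve 2 (λ k c → k :- :- c := c :+ k) ≈-refl k c))

    admissible⇔ : (∀ x y → (x~y : x ~ y) → 0# ≤ curvature W x~y) ⇔ C.Admissible G conn lf W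
    admissible⇔ = mk⇔
      (λ 0≤c x y x~y → curvature W x~y , κLLY-limit x~y , 0≤c x y x~y)
      (λ adm x y x~y → let k , lim , 0≤k = adm x y x~y in κLLY-≥0⇒curvature-≥0 x~y lim 0≤k)

    module _ {x y : V} (x~y : x ~ y) where

      private
        c ω dx dy z : Carrier
        c = curvature W x~y
        ω = w x y
        dx = d W x
        dy = d W y
        -- Multiplying the curvature by this clears both denominators and the factor 2, which leaves
        -- `ω dy + ω dx - dx dy`.
        z = ½ * (dx * dy)

        0<z : 0# < z
        0<z = 0<* 0<½ (0<* (0<d W x~y) (0<d W (~-sym x~y)))

        curvature-scaled : ω * ω ≈ (dx - ω) * (dy - ω) + c * z
        curvature-scaled = begin
          ω * ω
            ≈⟨ solve 3 (λ w a b → w :* w := (a :- w) :* (b :- w) :+ (w :* (:1 :* b) :+ w :* (:1 :* a) :- a :* b)) ≈-refl ω dx dy ⟩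
          (dx - ω) * (dy - ω) + (ω * (1# * dy) + ω * (1# * dx) - dx * dy)
            ≈⟨ +-congˡ (+-congʳ (+-cong (*-congˡ (*-congʳ (*-inverse (0<d W x~y))))
                                        (*-cong (w-sym (~-sym x~y)) (*-congʳ (*-inverse (0<d W (~-sym x~y))))))) ⟨
          (dx - ω) * (dy - ω) + (ω * (dx * dx ⁻¹ * dy) + w y x * (dy * dy ⁻¹ * dx) - dx * dy)
            ≈⟨ +-congˡ (solve 6 (λ w v a a⁻ b b⁻ → w :* (a :* a⁻ :* b) :+ v :* (b :* b⁻ :* a) :- a :* b
                 := :1 :* (w :* a⁻ :+ v :* b⁻ :- :1) :* (a :* b)) ≈-refl ω (w y x) dx (dx ⁻¹) dy (dy ⁻¹)) ⟩
          (dx - ω) * (dy - ω) + 1# * (p W x y + p W y x - 1#) * (dx * dy)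
            ≈⟨ +-congˡ (*-congʳ (*-congʳ (*-inverse 0<2))) ⟨
          (dx - ω) * (dy - ω) + (1# + 1#) * ½ * (p W x y + p W y x - 1#) * (dx * dy)
            ≈⟨ +-congˡ (solve 4 (λ t h q r → t :* h :* q :* r := t :* q :* (h :* r)) ≈-refl (1# + 1#) ½ _ _) ⟩
          (dx - ω) * (dy - ω) + c * z ∎
          where open ≈-Reasoning

      -- The numbers `a` and `b` stand for any part of the remaining weight at the two ends, so an
      -- application has to name only the neighbours that matter to it.
      curvature-≥0⇒ : ∀ {a b} → 0# ≤ c → 0# ≤ a → 0# ≤ b →
                      ω + a ≤ dx → ω + b ≤ dy → a * b ≤ ω * ω
      curvature-≥0⇒ {a} {b} 0≤c 0≤a 0≤b ωa≤ ωb≤ = begin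
        a * b                 ≤⟨ *-mono-≤ 0≤a (≤.trans 0≤b b≤) a≤ b≤ ⟩
        (dx - ω) * (dy - ω)   ≤⟨ ≤-by (c * z) (*-nonneg 0≤c (<⇒≤ 0<z)) curvature-scaled ⟩
        ω * ω                 ∎
        where
        open ≤-Reasoning
        a≤ : a ≤ dx - ω
        a≤ = ≤-by _ (0≤y-x ωa≤) (solve 3 (λ d w a → d :- w := a :+ (d :- (w :+ a))) ≈-refl dx ω a)
        b≤ : b ≤ dy - ω
        b≤ = ≤-by _ (0≤y-x ωb≤) (solve 3 (λ d w a → d :- w := a :+ (d :- (w :+ a))) ≈-refl dy ω b)

      ⇒curvature-≥0 : (dx - ω) * (dy - ω) ≤ ω * ω → 0# ≤ c
      ⇒curvature-≥0 le = *-cancelʳ-≤ 0<z (≤-respˡ (≈-sym (zeroˡ z)) (≤-respʳ (begin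
        ω * ω - (dx - ω) * (dy - ω)
          ≈⟨ +-congʳ curvature-scaled ⟩
        (dx - ω) * (dy - ω) + c * z - (dx - ω) * (dy - ω)
          ≈⟨ solve 2 (λ m q → m :+ q :- m := q) ≈-refl _ _ ⟩
        c * z ∎) (0≤y-x le)))
        where open ≈-Reasoning

-- Infinite non-backtracking walks, cores and finite branches.

module _ {V : Set} where

  FiniteSet : (V → Set) → Set
  FiniteSet P = ∃ λ xs → ∀ u → P u → u ∈ xs

  finite-⋃ : ∀ (zs : List V) {P : V → V → Set} → (∀ z → z ∈ zs → FiniteSet (P z)) →
             FiniteSet (λ u → ∃ λ z → z ∈ zs × P z u)
  finite-⋃ []       fin = [] , λ { u (_ , () , _) }
  finite-⋃ (z ∷ zs) fin with fin z (here ≡.refl) | finite-⋃ zs (λ z′ z′∈ → fin z′ (there z′∈))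
  ... | xs , Pz⊆xs | ys , P⊆ys = xs ++ ys , λ where
    u (_ , here ≡.refl , Pu) → ∈-++⁺ˡ (Pz⊆xs u Pu)
    u (z′ , there z′∈  , Pu) → ∈-++⁺ʳ xs (P⊆ys u (z′ , z′∈ , Pu))

module _ {G : Graph} where
  open Graph G

  closed⇒everything : Connected → ∀ {C : V → Set} {x} → C x → (∀ u v → u ~ v → C u → C v) → ∀ v → C v
  closed⇒everything conn {C} {x} Cx closed v = go (proj₂ (conn x v)) Cx
    where
    go : ∀ {n u} → Walk n u v → C u → C v
    go nil          Cu = Cu
    go (cons u~t p) Cu = go p (closed _ _ u~t Cu)

  _▷_ : ∀ {n x y z} → Walk n x y → y ~ z → Walk (suc n) x z
  nil        ▷ y~z = cons y~z nil
  cons x~t p ▷ y~z = cons x~t (p ▷ y~z)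

  reverse : ∀ {n x y} → Walk n x y → Walk n y x
  reverse nil          = nil
  reverse (cons x~t p) = reverse p ▷ ~-sym x~t

  append : ∀ {m n x y z} → Walk m x y → Walk n y z → Walk (m ℕ.+ n) x z
  append nil          q = q
  append (cons x~t p) q = cons x~t (append p q)

  connected-via : ∀ r → (∀ x → ∃ λ n → Walk n x r) → Connected
  connected-via r toRoot x y = _ , append (proj₂ (toRoot x)) (reverse (proj₂ (toRoot y)))

≅-from : ∀ {G H} (f : Graph.V H → Graph.V G) →
         (∀ {h h′} → f h ≡ f h′ → h ≡ h′) → (∀ v → ∃ λ h → f h ≡ v) →
         (∀ {h h′} → Graph._~_ H h h′ → Graph._~_ G (f h) (f h′)) →
         (∀ {h h′} → Graph._~_ G (f h) (f h′) → Graph._~_ H h h′) → G ≅ H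
≅-from {G} {H} f inj surj hom reflects = record
  { bijection = mk↔ₛ′ to f (λ h → inj (f∘to (f h))) f∘to
  ; adjacent  = λ x y → mk⇔
      (λ x~y → reflects (≡.subst₂ (Graph._~_ G) (≡.sym (f∘to x)) (≡.sym (f∘to y)) x~y))
      (λ x~y → ≡.subst₂ (Graph._~_ G) (f∘to x) (f∘to y) (hom x~y)) }
  where
  to : Graph.V G → Graph.V H
  to v = proj₁ (surj v)
  f∘to : ∀ v → f (to v) ≡ v
  f∘to v = proj₂ (surj v)

module NonBacktracking (em : ExcludedMiddle 0ℓ) (G : Graph) where
  open Graph G

  -- No infinite non-backtracking walk begins with the step from x to y.
  data Dead (x y : V) : Set where
    dead : (∀ z → y ~ z → z ≢ x → Dead y z) → Dead x y

  Live : V → V → Set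
  Live x y = ¬ Dead x y

  live-next : ∀ {x y} → Live x y → ∃ λ z → y ~ z × z ≢ x × Live y z
  live-next {x} {y} live with em {P = ∃ λ z → y ~ z × z ≢ x × Live y z}
  ... | yes next = next
  ... | no ¬next = ⊥-elim (live (dead λ z y~z z≢x → dead′ z y~z z≢x))
    where
    dead′ : ∀ z → y ~ z → z ≢ x → Dead y z
    dead′ z y~z z≢x with em {P = Dead y z}
    ... | yes d = d
    ... | no ¬d = ⊥-elim (¬next (z , y~z , z≢x , ¬d))

  live-prepend : ∀ {x y z} → y ~ z → z ≢ x → Live y z → Live x y
  live-prepend y~z z≢x live (dead d) = live (d _ y~z z≢x)

  -- A common form for a cycle and for a closed stretch of a non-backtracking walk: inside such a
  -- set a walk can always go on without turning back.
  record Core : Set where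
    field
      vertices : List V
      base     : V
      base∈    : base ∈ vertices
      two      : ∀ {y} → y ∈ vertices →
                 ∃₂ λ a b → a ≢ b × (y ~ a × a ∈ vertices) × (y ~ b × b ∈ vertices)

    -- One of the two inner neighbours differs from the previous vertex, so a proof of `Dead` would
    -- contain another one for a step into the core, without end; but `Dead` is inductive.
    into-live : ∀ {x y} → y ∈ vertices → Live x y
    into-live {x} y∈ (dead d) with two y∈
    ... | a , b , a≢b , (y~a , a∈) , (y~b , b∈) with em {P = a ≡ x}
    ...   | no a≢x     = into-live a∈ (d a y~a a≢x)
    ...   | yes ≡.refl = into-live b∈ (d b y~b (a≢b ∘ ≡.sym))

    -- When degrees are at most 2, the two inner neighbours of a vertex are all its neighbours, so
    -- the core is closed under adjacency.
    finite : Connected → (∀ {y a b c} → y ~ a → y ~ b → y ~ c → a ≢ b → c ≡ a ⊎ c ≡ b) → Finite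
    finite conn degree≤2 = vertices , closed⇒everything {G} conn base∈ closed
      where
      closed : ∀ u v → u ~ v → u ∈ vertices → v ∈ vertices
      closed u v u~v u∈ with two u∈
      ... | a , b , a≢b , (u~a , a∈) , (u~b , b∈) with degree≤2 u~a u~b u~v a≢b
      ...   | inj₁ ≡.refl = a∈
      ...   | inj₂ ≡.refl = b∈

  BiLive : V → V → Set
  BiLive x y = x ~ y × Live x y × Live y x

  core⇒bilive : Core → ∃₂ BiLive
  core⇒bilive core = let open Core core; a , _ , _ , (y~a , a∈) , _ = two base∈ in
    base , a , y~a , into-live a∈ , into-live base∈

  cycle⇒core : ∀ {n} → CycleOfLength n → Core
  cycle⇒core record { m = suc zero ; n≡1+m = ≡.refl ; 3≤n = s≤s (s≤s ()) }
  cycle⇒core record { m = suc (suc m) ; vertex = c ; injective = inj ; step = step ; close = close } = record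
    { vertices = vs ; base∈ = c∈ zero
    ; two = λ y∈ → let i , y≡ci = ∈-tabulate⁻ {f = c} y∈
                   in ≡.subst (λ y → ∃₂ λ a b → a ≢ b × (y ~ a × a ∈ vs) × (y ~ b × b ∈ vs)) (≡.sym y≡ci) (two i) }
    where
    vs : List V
    vs = tabulate c

    c∈ : ∀ i → c i ∈ vs
    c∈ = ∈-tabulate⁺ {f = c}

    -- The disjunction records the position of the successor, so that `distinct` can tell it from
    -- the predecessor; for the last index this uses length at least 3.
    next : ∀ i → ∃ λ j → c i ~ c j × (i ≡ fromℕ _ × j ≡ zero ⊎ Fin.toℕ j ≡ suc (Fin.toℕ i))
    next i with view i
    ... | ‵fromℕ     = zero , close , inj₁ (≡.refl , ≡.refl)
    ... | ‵inject₁ j = suc j , step j , inj₂ (≡.cong suc (≡.sym (Finₚ.toℕ-inject₁ j)))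

    distinct : ∀ i {j} → suc i ≡ fromℕ _ × j ≡ zero ⊎ Fin.toℕ j ≡ suc (suc (Fin.toℕ i)) → inject₁ i ≢ j
    distinct zero (inj₁ (() , _))
    distinct (suc _) (inj₁ (_ , ≡.refl)) ()
    distinct i (inj₂ j≡2+i) ≡.refl =
      ℕₚ.m≢1+n+m (Fin.toℕ i) {1} (≡.trans (≡.sym (Finₚ.toℕ-inject₁ i)) j≡2+i)

    two : ∀ i → ∃₂ λ a b → a ≢ b × (c i ~ a × a ∈ vs) × (c i ~ b × b ∈ vs)
    two zero = c (suc zero) , c (fromℕ _) , (λ e → 1≢last (inj e)) ,
      (step zero , c∈ _) , (~-sym close , c∈ _)
      where
      1≢last : suc zero ≢ fromℕ (suc (suc m))
      1≢last ()
    two (suc i) with next (suc i)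
    ... | j , ci~cj , prop = c (inject₁ i) , c j , distinct i prop ∘ inj ,
          (~-sym (step i) , c∈ _) , (ci~cj , c∈ _)

  module _ (v : ℕ → V) (adj : ∀ n → v n ~ v (suc n)) (nb : ∀ n → v (suc (suc n)) ≢ v n) where

    -- Where the stretch closes up, its first and last edge may be the same, as in a closed walk
    -- with a tail. Then one step is cut off at each end and the argument repeats on a shorter
    -- stretch; otherwise the vertices of the stretch form a core.
    repetition⇒core : ∀ d i → v (suc d ℕ.+ i) ≡ v i → Core
    repetition⇒core zero          i e = ⊥-elim (~-irr _ (≡.subst (v i ~_) e (adj i)))
    repetition⇒core (suc zero)    i e = ⊥-elim (nb i e)
    repetition⇒core (suc (suc d)) i e with em {P = v (suc d ℕ.+ suc i) ≡ v (suc i)}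
    ... | yes e′ = repetition⇒core d (suc i) e′
    ... | no e′  = record
      { vertices = vs ; base∈ = member {0} (s≤s z≤n)
      ; two = λ y∈ → let k , k< , y≡ = ∈-applyUpTo⁻ vᵢ y∈
                   in ≡.subst (λ y → ∃₂ λ a b → a ≢ b × (y ~ a × a ∈ vs) × (y ~ b × b ∈ vs)) (≡.sym y≡) (two k k<) }
      where
      vᵢ : ℕ → V
      vᵢ k = v (k ℕ.+ i)
      vs = applyUpTo vᵢ (3 ℕ.+ d)
      member : ∀ {k} → k ℕ.< 3 ℕ.+ d → vᵢ k ∈ vs
      member = ∈-applyUpTo⁺ vᵢ
      next∈ : ∀ k → k ℕ.< 3 ℕ.+ d → vᵢ (suc k) ∈ vs
      next∈ k k< with ℕₚ.m≤n⇒m<n∨m≡n k<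
      ... | inj₁ 1+k< = member 1+k<
      ... | inj₂ ≡.refl = ≡.subst (_∈ vs) (≡.sym e) (member {0} (s≤s z≤n))
      two : ∀ k → k ℕ.< 3 ℕ.+ d → ∃₂ λ a b → a ≢ b × (vᵢ k ~ a × a ∈ vs) × (vᵢ k ~ b × b ∈ vs)
      two zero    k<        = vᵢ 1 , vᵢ (2 ℕ.+ d) ,
        (λ e″ → e′ (≡.trans (≡.cong v (ℕₚ.+-suc (suc d) i)) (≡.sym e″))) ,
        (adj i , next∈ 0 (s≤s z≤n)) ,
        (~-sym (≡.subst (vᵢ (2 ℕ.+ d) ~_) e (adj _)) , member ℕₚ.≤-refl)
      two (suc k) k<        = vᵢ (2 ℕ.+ k) , vᵢ k , nb (k ℕ.+ i) ,
        (adj _ , next∈ (suc k) k<) , (~-sym (adj _) , member (ℕₚ.<-trans (ℕₚ.n<1+n k) k<))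

  record LiveEdge : Set where
    field
      {src tgt} : V
      edge      : src ~ tgt
      live      : Live src tgt

    next : LiveEdge
    next = record { edge = proj₁ (proj₂ (live-next live)) ; live = proj₂ (proj₂ (proj₂ (live-next live))) }

  open LiveEdge

  next-≢ : ∀ e → tgt (next e) ≢ src e
  next-≢ e = proj₁ (proj₂ (proj₂ (live-next (live e))))

  infixl 9 _at_

  -- A witness of `live-next` is itself a live edge, so plain iteration produces an infinite walk
  -- all of whose steps are live.
  _at_ : LiveEdge → ℕ → LiveEdge
  e at zero  = e
  e at suc n = next (e at n)

  walk : LiveEdge → ℕ → V
  walk e n = src (e at n)

  walk-~ : ∀ e n → walk e n ~ walk e (suc n)
  walk-~ e n = edge (e at n)

  walk-≢ : ∀ e n → walk e (suc (suc n)) ≢ walk e n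
  walk-≢ e n = next-≢ (e at n)

  walk-live : ∀ e n → Live (walk e n) (walk e (suc n))
  walk-live e n = live (e at n)

  -- The vertices `u` on non-backtracking walks that begin with the step from `x` to `y`.
  data Branch (x y : V) : V → Set where
    here  : Branch x y y
    there : ∀ {z u} → y ~ z → z ≢ x → Branch y z u → Branch x y u

  -- A step from the end of the walk either prolongs it or goes back to the vertex before, which is
  -- in the branch as well, unless the walk consists of the first step alone.
  branch-closed : ∀ {x y u t} → Branch x y u → u ~ t → Branch x y t ⊎ (u ≡ y × t ≡ x)
  branch-closed {x} {t = t} here u~t with em {P = t ≡ x}
  ... | yes t≡x = inj₂ (≡.refl , t≡x)
  ... | no t≢x  = inj₁ (there u~t t≢x here)
  branch-closed (there y~z z≢x b) u~t with branch-closed b u~t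
  ... | inj₁ b′              = inj₁ (there y~z z≢x b′)
  ... | inj₂ (≡.refl , ≡.refl) = inj₁ here

  module _ (lf : LocallyFinite) where

    private
      N : V → List V
      N x = proj₁ (lf x)
      ~⇒∈N : ∀ {x y} → x ~ y → y ∈ N x
      ~⇒∈N {x} {y} = Equivalence.from (proj₂ (proj₂ (lf x)) y)
      ∈N⇒~ : ∀ {x y} → y ∈ N x → x ~ y
      ∈N⇒~ {x} {y} = Equivalence.to (proj₂ (proj₂ (lf x)) y)

    -- König's lemma in contrapositive form: recursion on `Dead`, with a finite union over the
    -- neighbours at every node.
    branch-finite : ∀ {x y} → Dead x y → FiniteSet (Branch x y)
    branch-finite {x} {y} (dead d) =
      let xs , ⊆xs = finite-⋃ (N y) {λ z u → z ≢ x × Branch y z u} finite-z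
      in y ∷ xs , λ where
        u here                → here ≡.refl
        u (there y~z z≢x b) → there (⊆xs u (_ , ~⇒∈N y~z , z≢x , b))
      where
      finite-z : ∀ z → z ∈ N y → FiniteSet (λ u → z ≢ x × Branch y z u)
      finite-z z z∈N with em {P = z ≡ x}
      ... | yes z≡x = [] , λ u (z≢x , _) → ⊥-elim (z≢x z≡x)
      ... | no z≢x  = let xs , ⊆xs = branch-finite (d z (∈N⇒~ z∈N) z≢x) in xs , λ u (_ , b) → ⊆xs u b

    -- If all steps out of some vertex `x` were dead, then `x` and its finitely many finite branches
    -- would be closed under adjacency and exhaust the graph.
    liveEdge-exists : Connected → Infinite → LiveEdge
    liveEdge-exists conn inf with em {P = V}
    ... | no ¬V = ⊥-elim (inf ([] , λ x → ⊥-elim (¬V x)))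
    ... | yes x with em {P = ∃ λ y → x ~ y × Live x y}
    ...   | yes (y , x~y , live) = record { edge = x~y ; live = live }
    ...   | no none = ⊥-elim (inf (x ∷ xs , everything))
      where
      fin : ∀ y → y ∈ N x → FiniteSet (Branch x y)
      fin y y∈N with em {P = Dead x y}
      ... | yes d = branch-finite d
      ... | no ¬d = ⊥-elim (none (y , ∈N⇒~ y∈N , ¬d))
      xs : List V
      xs = proj₁ (finite-⋃ (N x) fin)
      C : V → Set
      C u = u ≡ x ⊎ ∃ λ y → x ~ y × Branch x y u
      closed : ∀ u t → u ~ t → C u → C t
      closed u t u~t (inj₁ ≡.refl) = inj₂ (t , u~t , here)
      closed u t u~t (inj₂ (y , x~y , b)) with branch-closed b u~t
      ... | inj₁ b′          = inj₂ (y , x~y , b′)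
      ... | inj₂ (_ , t≡x)   = inj₁ t≡x
      everything : ∀ u → u ∈ x ∷ xs
      everything u with closed⇒everything {G} conn {C} (inj₁ ≡.refl) closed u
      ... | inj₁ u≡x           = here u≡x
      ... | inj₂ (y , x~y , b) = there (proj₂ (finite-⋃ (N x) fin) u (y , ~⇒∈N x~y , b))

  -- What lies behind an unbranched ray is a finite tree.

  module RayEnd (conn : Connected) (lf : LocallyFinite) (none : ¬ ∃₂ BiLive)
                (v : ℕ → V) (v-~ : ∀ n → v n ~ v (suc n)) (v-≢ : ∀ n → v (suc (suc n)) ≢ v n)
                (v-live : Live (v 0) (v 1))
                (v-neighbour : ∀ n {u} → v (suc n) ~ u → u ≡ v n ⊎ u ≡ v (suc (suc n)))
                where

    private
      v-≢+ : ∀ d i → v (suc d ℕ.+ i) ≢ v i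
      v-≢+ d i eq = none (core⇒bilive (repetition⇒core v v-~ v-≢ d i eq))

      v-injective : ∀ {i j} → v i ≡ v j → i ≡ j
      v-injective {i} {j} eq with ℕₚ.<-cmp i j
      ... | tri≈ _ i≡j _ = i≡j
      ... | tri< i<j _ _ = ⊥-elim (v-≢+ (j ℕ.∸ suc i) i
              (≡.trans (≡.cong v (≡.trans (≡.sym (ℕₚ.+-suc _ i)) (ℕₚ.m∸n+n≡m i<j))) (≡.sym eq)))
      ... | tri> _ _ j<i = ⊥-elim (v-≢+ (i ℕ.∸ suc j) j
              (≡.trans (≡.cong v (≡.trans (≡.sym (ℕₚ.+-suc _ j)) (ℕₚ.m∸n+n≡m j<i))) eq))

      Q : V → Set
      Q u = ∀ i → u ≢ v (suc i)

      ¬Q⇒ : ∀ {u} → ¬ Q u → ∃ λ i → v (suc i) ≡ u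
      ¬Q⇒ {u} ¬Qu with em {P = ∃ λ i → v (suc i) ≡ u}
      ... | yes p = p
      ... | no ¬p = ⊥-elim (¬Qu λ i u≡ → ¬p (i , ≡.sym u≡))

    -- The complement of the ray v 1, v 2, …; membership is truncated to
    -- a Boolean so that it is proof-irrelevant.
    K : Graph
    K = record { V = Σ V λ u → True (em {P = Q u}) ; _~_ = λ a b → proj₁ a ~ proj₁ b
               ; ~-sym = ~-sym ; ~-irr = λ a → ~-irr (proj₁ a) }

    private
      K-≡ : ∀ {a b : Graph.V K} → proj₁ a ≡ proj₁ b → a ≡ b
      K-≡ {u , p} {.u , q} ≡.refl = ≡.cong (u ,_) (T-irrelevant p q)

      inK : ∀ u → Q u → Graph.V K
      inK u Qu = u , fromWitness Qu

      Q-K : ∀ (a : Graph.V K) → Q (proj₁ a)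
      Q-K a = toWitness (proj₂ a)

      root : Graph.V K
      root = inK (v 0) λ i e → ℕₚ.0≢1+n (v-injective e)

      sublist : ∀ (us : List V) → ∃ λ as → ∀ (a : Graph.V K) → proj₁ a ∈ us → a ∈ as
      sublist []       = [] , λ _ ()
      sublist (u ∷ us) with sublist us | em {P = Q u}
      ... | as , complete | yes Qu = inK u Qu ∷ as , λ where
              a (here e)   → here (K-≡ e)
              a (there a∈) → there (complete a a∈)
      ... | as , complete | no ¬Qu = as , λ where
              a (here ≡.refl) → ⊥-elim (¬Qu (Q-K a))
              a (there a∈)    → complete a a∈

      -- The first step is live forwards, and no edge is live in both directions. Since the
      -- complement of the ray lies in the branch of the reversed step, this is the source of its
      -- finiteness.
      v₁→v₀-dead : Dead (v 1) (v 0)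
      v₁→v₀-dead with em {P = Dead (v 1) (v 0)}
      ... | yes d   = d
      ... | no live = ⊥-elim (none (v 0 , v 1 , v-~ 0 , v-live , live))

      branch∪ray : ∀ u → Branch (v 1) (v 0) u ⊎ ∃ λ i → u ≡ v (suc i)
      branch∪ray = closed⇒everything {G} conn {λ u → Branch (v 1) (v 0) u ⊎ ∃ λ i → u ≡ v (suc i)} (inj₁ here) closed
        where
        closed : ∀ u t → u ~ t → Branch (v 1) (v 0) u ⊎ (∃ λ i → u ≡ v (suc i)) →
                 Branch (v 1) (v 0) t ⊎ ∃ λ i → t ≡ v (suc i)
        closed u t u~t (inj₁ b) with branch-closed b u~t
        ... | inj₁ b′        = inj₁ b′
        ... | inj₂ (_ , t≡)  = inj₂ (0 , t≡)
        closed u t u~t (inj₂ (i , ≡.refl)) with v-neighbour i u~t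
        ... | inj₂ t≡ = inj₂ (suc i , t≡)
        closed u t u~t (inj₂ (zero  , ≡.refl)) | inj₁ ≡.refl = inj₁ here
        closed u t u~t (inj₂ (suc i , ≡.refl)) | inj₁ t≡     = inj₂ (i , t≡)

      K-finite : Graph.Finite K
      K-finite = let us , ⊆us = branch-finite lf v₁→v₀-dead
                     as , complete = sublist us
                 in as , λ a → complete a (⊆us (proj₁ a) (inBranch a (branch∪ray (proj₁ a))))
        where
        inBranch : ∀ a → Branch (v 1) (v 0) (proj₁ a) ⊎ (∃ λ i → proj₁ a ≡ v (suc i)) → Branch (v 1) (v 0) (proj₁ a)
        inBranch a (inj₁ b)       = b
        inBranch a (inj₂ (i , e)) = ⊥-elim (Q-K a i e)

      exit : ∀ (a : Graph.V K) i → proj₁ a ~ v (suc i) → a ≡ root × i ≡ 0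
      exit a i a~v with v-neighbour i (~-sym a~v)
      ... | inj₂ a≡ = ⊥-elim (Q-K a (suc i) a≡)
      exit a zero    a~v | inj₁ a≡ = K-≡ a≡ , ≡.refl
      exit a (suc i) a~v | inj₁ a≡ = ⊥-elim (Q-K a i a≡)

      -- The walk of the whole graph is followed until it first meets the root; by `exit` it cannot
      -- leave the complement of the ray earlier.
      toRoot : ∀ {n} (a : Graph.V K) → Walk n (proj₁ a) (v 0) → ∃ λ k → Graph.Walk K k a root
      toRoot a p with em {P = proj₁ a ≡ v 0}
      ... | yes a≡ = 0 , ≡.subst (λ b → Graph.Walk K 0 b root) (≡.sym (K-≡ {a} {root} a≡)) Graph.nil
      toRoot a nil | no a≢ = ⊥-elim (a≢ ≡.refl)
      toRoot a (cons {y = t} a~t p) | no a≢ with em {P = Q t}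
      ... | yes Qt = let k , q = toRoot (inK t Qt) p in suc k , Graph.cons a~t q
      ... | no ¬Qt = ⊥-elim (a≢ (≡.cong proj₁ (proj₁ (exit a _
                       (≡.subst (proj₁ a ~_) (≡.sym (proj₂ (¬Q⇒ ¬Qt))) a~t)))))

      K-acyclic : ∀ n → ¬ Graph.CycleOfLength K n
      K-acyclic n c = none (core⇒bilive (cycle⇒core (record
        { n≡1+m = n≡1+m ; 3≤n = 3≤n ; vertex = proj₁ ∘ vertex ; injective = injective ∘ K-≡
        ; step = step ; close = close })))
        where open Graph.CycleOfLength c

    K-tree : Graph.IsFiniteTree K
    K-tree = record
      { finite = K-finite ; nonempty = root ; acyclic = K-acyclic
      ; connected = connected-via root λ a → toRoot a (proj₂ (conn (proj₁ a) (v 0))) }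

    isFiniteTreeWithRay : IsFiniteTreeWithRay G
    isFiniteTreeWithRay = K , K-tree , root , ≅-from embed embed-injective embed-surjective
      (λ {h} {h′} → embed-~ h h′) (λ {h} {h′} → embed-reflects h h′)
      where
      H : Graph
      H = attachRay K root

      embed : Graph.V H → V
      embed (inj₁ a) = proj₁ a
      embed (inj₂ i) = v (suc i)

      embed-injective : ∀ {h h′} → embed h ≡ embed h′ → h ≡ h′
      embed-injective {inj₁ a} {inj₁ b} e = ≡.cong inj₁ (K-≡ e)
      embed-injective {inj₁ a} {inj₂ j} e = ⊥-elim (Q-K a j e)
      embed-injective {inj₂ i} {inj₁ b} e = ⊥-elim (Q-K b i (≡.sym e))
      embed-injective {inj₂ i} {inj₂ j} e = ≡.cong inj₂ (ℕₚ.suc-injective (v-injective e))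

      embed-surjective : ∀ u → ∃ λ h → embed h ≡ u
      embed-surjective u with em {P = Q u}
      ... | yes Qu = inj₁ (inK u Qu) , ≡.refl
      ... | no ¬Qu = inj₂ (proj₁ (¬Q⇒ ¬Qu)) , proj₂ (¬Q⇒ ¬Qu)

      embed-~ : ∀ h h′ → Graph._~_ H h h′ → embed h ~ embed h′
      embed-~ (inj₁ a) (inj₁ b) a~b                 = a~b
      embed-~ (inj₁ a) (inj₂ j) (≡.refl , ≡.refl)   = v-~ 0
      embed-~ (inj₂ i) (inj₁ b) (≡.refl , ≡.refl)   = ~-sym (v-~ 0)
      embed-~ (inj₂ i) (inj₂ j) (inj₁ ≡.refl)       = v-~ (suc i)
      embed-~ (inj₂ i) (inj₂ j) (inj₂ ≡.refl)       = ~-sym (v-~ (suc j))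

      embed-reflects : ∀ h h′ → embed h ~ embed h′ → Graph._~_ H h h′
      embed-reflects (inj₁ a) (inj₁ b) a~b = a~b
      embed-reflects (inj₁ a) (inj₂ j) a~v = exit a j a~v
      embed-reflects (inj₂ i) (inj₁ b) v~b = exit b i (~-sym v~b)
      embed-reflects (inj₂ i) (inj₂ j) v~v with v-neighbour i v~v
      ... | inj₁ e = inj₂ (≡.sym (v-injective e))
      ... | inj₂ e = inj₁ (ℕₚ.suc-injective (v-injective e))

-- Distance levels in a finite tree.

bounded-on : ∀ {A : Set} (f : A → ℕ) xs → ∃ λ M → ∀ {a} → a ∈ xs → f a ℕ.≤ M
bounded-on f []       = 0 , λ ()
bounded-on f (x ∷ xs) with bounded-on f xs
... | M , ≤M = f x ℕ.⊔ M , λ where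
  (here ≡.refl) → ℕₚ.m≤m⊔n (f x) M
  (there a∈)    → ℕₚ.≤-trans (≤M a∈) (ℕₚ.m≤n⊔m (f x) M)

maximum-on : ∀ {A : Set} (f : A → ℕ) x xs → ∃ λ a → ∀ {b} → b ∈ x ∷ xs → f b ℕ.≤ f a
maximum-on f x [] = x , λ { (here ≡.refl) → ℕₚ.≤-refl }
maximum-on f x (y ∷ xs) with maximum-on f y xs
... | a , max with ℕₚ.≤-total (f x) (f a)
...   | inj₁ x≤a = a , λ { (here ≡.refl) → x≤a ; (there b∈) → max b∈ }
...   | inj₂ a≤x = x , λ { (here ≡.refl) → ℕₚ.≤-refl ; (there b∈) → ℕₚ.≤-trans (max b∈) a≤x }

module Paths (G : Graph) where
  open Graph G

  -- The path has vertices `v 0` to `v m`; a total function on ℕ makes prolonging and reversing a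
  -- matter of shifting indices.
  record Path (m : ℕ) (v : ℕ → V) : Set where
    field
      step : ∀ {i} → i ℕ.< m → v i ~ v (suc i)
      inj  : ∀ {i j} → i ℕ.≤ m → j ℕ.≤ m → v i ≡ v j → i ≡ j
  open Path

  close-path : ∀ {m v} → Path m v → 2 ℕ.≤ m → v m ~ v 0 → CycleOfLength (suc m)
  close-path {m} {v} path 2≤m close = record
    { n≡1+m     = ≡.refl
    ; 3≤n       = s≤s 2≤m
    ; vertex    = v ∘ Fin.toℕ
    ; injective = λ {i} {j} e → Finₚ.toℕ-injective (inj path (Finₚ.toℕ≤pred[n] i) (Finₚ.toℕ≤pred[n] j) e)
    ; step      = λ i → ≡.subst (λ n → v n ~ v (suc (Fin.toℕ i))) (≡.sym (Finₚ.toℕ-inject₁ i)) (step path (Finₚ.toℕ<n i))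
    ; close     = ≡.subst (λ n → v n ~ v 0) (≡.sym (Finₚ.toℕ-fromℕ m)) close
    }

  infixr 5 _◂_
  _◂_ : V → (ℕ → V) → ℕ → V
  (p ◂ v) zero    = p
  (p ◂ v) (suc i) = v i

  ◂-path : ∀ {m v p} → Path m v → p ~ v 0 → (∀ {i} → i ℕ.≤ m → p ≢ v i) → Path (suc m) (p ◂ v)
  ◂-path {m} {v} {p} path p~ p≢ = record { step = step′ ; inj = inj′ }
    where
    step′ : ∀ {i} → i ℕ.< suc m → (p ◂ v) i ~ v i
    step′ {zero}  _         = p~
    step′ {suc i} (s≤s i<m) = step path i<m
    inj′ : ∀ {i j} → i ℕ.≤ suc m → j ℕ.≤ suc m → (p ◂ v) i ≡ (p ◂ v) j → i ≡ j
    inj′ {zero}  {zero}  _         _         _ = ≡.refl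
    inj′ {zero}  {suc j} _         (s≤s j≤m) e = ⊥-elim (p≢ j≤m e)
    inj′ {suc i} {zero}  (s≤s i≤m) _         e = ⊥-elim (p≢ i≤m (≡.sym e))
    inj′ {suc i} {suc j} (s≤s i≤m) (s≤s j≤m) e = ≡.cong suc (inj path i≤m j≤m e)

  reverse-path : ∀ {m v} → Path m v → Path m (λ i → v (m ℕ.∸ i))
  reverse-path {m} {v} path = record
    { step = λ {i} i<m → ~-sym (≡.subst (λ j → v (m ℕ.∸ suc i) ~ v j) (≡.sym (ℕₚ.+-∸-assoc 1 i<m))
               (step path (ℕₚ.∸-monoʳ-< {o = 0} (s≤s z≤n) i<m)))
    ; inj  = λ {i} {j} i≤m j≤m e → ℕₚ.∸-cancelˡ-≡ i≤m j≤m (inj path (ℕₚ.m∸n≤m m i) (ℕₚ.m∸n≤m m j) e) }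

  constant-path : ∀ x → Path 0 (λ _ → x)
  constant-path x = record { step = λ () ; inj = λ { z≤n z≤n _ → ≡.refl } }

module TreeLevels (em : ExcludedMiddle 0ℓ) (R : CompleteOrderedField) (K : Graph) (tree : Graph.IsFiniteTree K) (k : Graph.V K) where
  open Graph K
  open IsFiniteTree tree
  open Paths K
  open ShortCycles K using (~⇒≢)

  private
    shortest : ∀ a → ∃ λ m → Walk m a k × (∀ n → Walk n a k → m ℕ.≤ n)
    shortest a = Curvature.least em R (λ n → Walk n a k) (proj₁ (connected a k)) (proj₂ (connected a k))

  level : V → ℕ
  level a = proj₁ (shortest a)

  level-≤ : ∀ {n a} → Walk n a k → level a ℕ.≤ n
  level-≤ {n} {a} p = proj₂ (proj₂ (shortest a)) n p

  level-walk : ∀ a → Walk (level a) a k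
  level-walk a = proj₁ (proj₂ (shortest a))

  level-k : level k ≡ 0
  level-k = ℕₚ.n≤0⇒n≡0 (level-≤ nil)

  level-0 : ∀ {a} → level a ≡ 0 → a ≡ k
  level-0 {a} la≡0 with level a | level-walk a
  level-0 ≡.refl | .0 | nil = ≡.refl

  level-~ : ∀ {a b} → a ~ b → level a ℕ.≤ suc (level b)
  level-~ {b = b} a~b = level-≤ (cons a~b (level-walk b))

  parent : ∀ {a n} → level a ≡ suc n → ∃ λ b → a ~ b × level b ≡ n
  parent {a} {n} la = let b , a~b , p = first (≡.subst (λ m → Walk m a k) la (level-walk a)) in
    b , a~b , ℕₚ.≤-antisym (level-≤ p) (ℕₚ.≤-pred (≡.subst (ℕ._≤ suc (level b)) la (level-~ a~b)))
    where
    first : Walk (suc n) a k → ∃ λ b → a ~ b × Walk n b k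
    first (cons a~b p) = _ , a~b , p

  -- Going up from both ends, such a path extends until its ends meet.
  no-cup : ∀ n {m v} → Path (suc m) v → (∀ {i} → i ℕ.≤ suc m → n ℕ.≤ level (v i)) →
           level (v 0) ≡ n → level (v (suc m)) ≡ n → ⊥
  no-cup zero path _ l₀ lₘ =
    ℕₚ.0≢1+n (Path.inj path z≤n ℕₚ.≤-refl (≡.trans (level-0 l₀) (≡.sym (level-0 lₘ))))
  no-cup (suc n) {m} {v} path above l₀ lₘ
    with parent l₀ | parent lₘ
  ... | p , v₀~p , lp | q , vₘ~q , lq = extend
    where
    below : ∀ {r} → level r ≡ n → ∀ {i} → i ℕ.≤ suc m → r ≢ v i
    below lr i≤ ≡.refl = ℕₚ.<-irrefl (≡.sym lr) (above i≤)
    p◂ : Path (2 ℕ.+ m) (p ◂ v)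
    p◂ = ◂-path path (~-sym v₀~p) (below lp)
    -- Paths are prolonged only at the front, so the path starting at `p` is reversed before `q` is
    -- attached to its other end.
    u : ℕ → V
    u = λ i → (p ◂ v) (2 ℕ.+ m ℕ.∸ i)
    p◂-above : ∀ i → i ℕ.≤ 2 ℕ.+ m → n ℕ.≤ level ((p ◂ v) i)
    p◂-above zero    _        = ℕₚ.≤-reflexive (≡.sym lp)
    p◂-above (suc i) (s≤s i≤) = ℕₚ.≤-trans (ℕₚ.n≤1+n n) (above i≤)
    q≢u : q ≢ p → ∀ {i} → i ℕ.≤ 2 ℕ.+ m → q ≢ u i
    q≢u q≢p {i} i≤ e = q≢p◂ (2 ℕ.+ m ℕ.∸ i) (ℕₚ.m∸n≤m (2 ℕ.+ m) i) e
      where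
      q≢p◂ : ∀ j → j ℕ.≤ 2 ℕ.+ m → q ≢ (p ◂ v) j
      q≢p◂ zero    _        = q≢p
      q≢p◂ (suc j) (s≤s j≤) = below lq j≤
    extend : ⊥
    extend with em {P = q ≡ p}
    ... | yes ≡.refl = acyclic _ (close-path p◂ (s≤s (s≤s z≤n)) vₘ~q)
    ... | no q≢p = no-cup n (◂-path (reverse-path p◂) (~-sym vₘ~q) (q≢u q≢p))
                     (λ { {zero} _ → ℕₚ.≤-reflexive (≡.sym lq)
                        ; {suc i} (s≤s i≤) → p◂-above (2 ℕ.+ m ℕ.∸ i) (ℕₚ.m∸n≤m (2 ℕ.+ m) i) })
                     lq (≡.trans (≡.cong (λ j → level ((p ◂ v) j)) (ℕₚ.n∸n≡0 m)) lp)

  -- An edge within a level would be a cup of length 1; likewise two parents of a vertex form a cup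
  -- of length 2 in `parent-unique`.
  level-≢ : ∀ {a b} → a ~ b → level a ≢ level b
  level-≢ {a} {b} a~b la≡lb = no-cup (level a)
    (◂-path (constant-path b) a~b (λ _ → ~⇒≢ a~b))
    (λ { {zero} _ → ℕₚ.≤-refl ; {suc i} _ → ℕₚ.≤-reflexive la≡lb }) ≡.refl (≡.sym la≡lb)

  level-step : ∀ {a b} → a ~ b → level a ≡ suc (level b) ⊎ level b ≡ suc (level a)
  level-step {a} {b} a~b with ℕₚ.<-cmp (level a) (level b)
  ... | tri< a<b _ _ = inj₂ (ℕₚ.≤-antisym (level-~ (~-sym a~b)) a<b)
  ... | tri≈ _ a≡b _ = ⊥-elim (level-≢ a~b a≡b)
  ... | tri> _ _ b<a = inj₁ (ℕₚ.≤-antisym (level-~ a~b) b<a)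

  parent-unique : ∀ {a b c n} → level a ≡ suc n → a ~ b → a ~ c → level b ≡ n → level c ≡ n → b ≡ c
  parent-unique {a} {b} {c} {n} la a~b a~c lb lc with em {P = b ≡ c}
  ... | yes b≡c = b≡c
  ... | no b≢c  = ⊥-elim (no-cup n {v = b ◂ a ◂ λ _ → c}
      (◂-path (◂-path (constant-path c) a~c (λ _ → ~⇒≢ a~c)) (~-sym a~b)
        (λ { {zero} _ → ~⇒≢ (~-sym a~b) ; {suc i} _ → b≢c }))
      (λ { {zero} _ → ℕₚ.≤-reflexive (≡.sym lb)
         ; {suc zero} _ → ℕₚ.≤-trans (ℕₚ.n≤1+n n) (ℕₚ.≤-reflexive (≡.sym la))
         ; {suc (suc i)} _ → ℕₚ.≤-reflexive (≡.sym lc) }) lb lc)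

-- Level 0 carries the infinite part of the graph, and every vertex of
-- positive level has a single neighbour closer to it.
record Layering (G : Graph) : Set where
  open Graph G
  field
    level         : V → ℕ
    height        : ℕ
    level≤height  : ∀ x → level x ℕ.≤ height
    level-~       : ∀ {x y} → x ~ y → (level x ≡ 0 × level y ≡ 0) ⊎ (level x ≡ suc (level y) ⊎ level y ≡ suc (level x))
    parent-unique : ∀ {x y z n} → level x ≡ suc n → x ~ y → x ~ z → level y ≡ n → level z ≡ n → y ≡ z
    level-0       : ∀ {x y} → x ~ y → level x ≡ 0 → level y ≡ 0 →
                    (∀ {z z′} → x ~ z → x ~ z′ → z ≢ y → z′ ≢ y → z ≡ z′) ⊎
                    (∀ {z} → x ~ z → z ≢ y → level z ≡ 1)
    inner         : List V
    inner-complete : ∀ {x z} → x ~ z → 1 ℕ.≤ level z → x ∈ inner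

-- Layerings of the two kinds of graphs, and their incompatibility.

≅-injective : ∀ {G H} (iso : G ≅ H) {x y} → _≅_.to iso x ≡ _≅_.to iso y → x ≡ y
≅-injective iso {x} {y} e = ≡.trans (≡.sym (strictlyInverseʳ x)) (≡.trans (≡.cong from e) (strictlyInverseʳ y))
  where open Inverse (_≅_.bijection iso)

transport : ∀ {G H} → G ≅ H → Layering H → Layering G
transport {G} {H} iso L = record
  { level = level ∘ to ; height = height ; level≤height = level≤height ∘ to
  ; level-~ = level-~ ∘ hom
  ; parent-unique = λ lx x~y x~z ly lz → injective (parent-unique lx (hom x~y) (hom x~z) ly lz)
  ; level-0 = level-0′
  ; inner = map from inner
  ; inner-complete = λ {x} x~z 1≤ → ≡.subst (_∈ map from inner) (Inverse.strictlyInverseʳ bijection x)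
                       (∈-map⁺ from (inner-complete (hom x~z) 1≤))
  }
  where
  open _≅_ iso
  open Inverse bijection using (from)
  open Layering L
  hom : ∀ {x y} → Graph._~_ G x y → Graph._~_ H (to x) (to y)
  hom {x} {y} = Equivalence.to (adjacent x y)
  injective : ∀ {x y} → to x ≡ to y → x ≡ y
  injective = ≅-injective iso
  level-0′ : ∀ {x y} → Graph._~_ G x y → level (to x) ≡ 0 → level (to y) ≡ 0 →
             (∀ {z z′} → Graph._~_ G x z → Graph._~_ G x z′ → z ≢ y → z′ ≢ y → z ≡ z′) ⊎
             (∀ {z} → Graph._~_ G x z → z ≢ y → level (to z) ≡ 1)
  level-0′ x~y lx ly with level-0 (hom x~y) lx ly
  ... | inj₁ f = inj₁ λ x~z x~z′ z≢y z′≢y →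
                   injective (f (hom x~z) (hom x~z′) (z≢y ∘ injective) (z′≢y ∘ injective))
  ... | inj₂ f = inj₂ λ x~z z≢y → f (hom x~z) (z≢y ∘ injective)

-- With every vertex on level 0, the weight built from the layering is constantly 1.
doubleRay-layering : Layering doubleRay
doubleRay-layering = record
  { level = λ _ → 0 ; height = 0 ; level≤height = λ _ → z≤n
  ; level-~ = λ _ → inj₁ (≡.refl , ≡.refl)
  ; parent-unique = λ ()
  ; level-0 = λ {x} x~y _ _ → inj₁ λ x~z x~z′ z≢y z′≢y → other x x~y x~z x~z′ z≢y z′≢y
  ; inner = [] ; inner-complete = λ _ () }
  where
  open Graph doubleRay
  suc-injective : ∀ {i j} → ℤ.suc i ≡ ℤ.suc j → i ≡ j
  suc-injective {i} {j} e = ≡.trans (≡.sym (ℤₚ.pred-suc i)) (≡.trans (≡.cong ℤ.pred e) (ℤₚ.pred-suc j))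
  other : ∀ x {y z z′} → x ~ y → x ~ z → x ~ z′ → z ≢ y → z′ ≢ y → z ≡ z′
  other x (inj₁ ≡.refl) (inj₁ ≡.refl) _             z≢y _    = ⊥-elim (z≢y ≡.refl)
  other x (inj₁ ≡.refl) _             (inj₁ ≡.refl) _   z′≢y = ⊥-elim (z′≢y ≡.refl)
  other x (inj₁ ≡.refl) (inj₂ e)      (inj₂ e′)     _   _    = suc-injective (≡.trans (≡.sym e) e′)
  other x (inj₂ e)      (inj₂ e′)     _             z≢y _    = ⊥-elim (z≢y (suc-injective (≡.trans (≡.sym e′) e)))
  other x (inj₂ e)      _             (inj₂ e′)     _   z′≢y = ⊥-elim (z′≢y (suc-injective (≡.trans (≡.sym e′) e)))
  other x (inj₂ _)      (inj₁ ≡.refl) (inj₁ ≡.refl) _   _    = ≡.refl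

module AttachRay (em : ExcludedMiddle 0ℓ) (R : CompleteOrderedField) (K : Graph) (tree : Graph.IsFiniteTree K) (k : Graph.V K) where
  private
    module T = TreeLevels em R K tree k
    H = attachRay K k
    open Graph H

    vertices : List (Graph.V K)
    vertices = proj₁ (Graph.IsFiniteTree.finite tree)

    ∈vertices : ∀ a → a ∈ vertices
    ∈vertices = proj₂ (Graph.IsFiniteTree.finite tree)

    level : V → ℕ
    level (inj₁ a) = T.level a
    level (inj₂ _) = 0

    height : ∃ λ M → ∀ {a} → a ∈ vertices → T.level a ℕ.≤ M
    height = bounded-on T.level vertices

    level≤height : ∀ x → level x ℕ.≤ proj₁ height
    level≤height (inj₁ a) = proj₂ height (∈vertices a)
    level≤height (inj₂ _) = z≤n

    level-~ : ∀ x y → x ~ y → (level x ≡ 0 × level y ≡ 0) ⊎ (level x ≡ suc (level y) ⊎ level y ≡ suc (level x))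
    level-~ (inj₁ a) (inj₁ b) a~b          = inj₂ (T.level-step a~b)
    level-~ (inj₁ a) (inj₂ n) (≡.refl , _) = inj₁ (T.level-k , ≡.refl)
    level-~ (inj₂ m) (inj₁ b) (≡.refl , _) = inj₁ (≡.refl , T.level-k)
    level-~ (inj₂ m) (inj₂ n) _            = inj₁ (≡.refl , ≡.refl)

    level-1+ : ∀ {a n} → T.level a ≡ suc n → a ≢ k
    level-1+ la ≡.refl = ℕₚ.0≢1+n (≡.trans (≡.sym T.level-k) la)

    parent-unique : ∀ x y z {n} → level x ≡ suc n → x ~ y → x ~ z → level y ≡ n → level z ≡ n → y ≡ z
    parent-unique (inj₁ a) (inj₁ b) (inj₁ c) la a~b a~c lb lc = ≡.cong inj₁ (T.parent-unique la a~b a~c lb lc)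
    parent-unique (inj₁ a) (inj₂ n) _        la (a≡k , _) _ _ _ = ⊥-elim (level-1+ la a≡k)
    parent-unique (inj₁ a) (inj₁ b) (inj₂ n) la _ (a≡k , _) _ _ = ⊥-elim (level-1+ la a≡k)

    ray-other : ∀ n {y z z′} → inj₂ n ~ y → inj₂ n ~ z → inj₂ n ~ z′ → z ≢ y → z′ ≢ y → z ≡ z′
    ray-other n {y} {z} {z′} n~y n~z n~z′ z≢y z′≢y with up y n~y | up z n~z | up z′ n~z′
      where
      previous : ℕ → V
      previous zero    = inj₁ k
      previous (suc n) = inj₂ n
      up : ∀ x → inj₂ n ~ x → x ≡ inj₂ (suc n) ⊎ x ≡ previous n
      up (inj₁ a) (≡.refl , ≡.refl) = inj₂ ≡.refl
      up (inj₂ m) (inj₁ ≡.refl)     = inj₁ ≡.refl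
      up (inj₂ m) (inj₂ ≡.refl)     = inj₂ ≡.refl
    ... | inj₁ y≡ | inj₁ z≡ | _        = ⊥-elim (z≢y (≡.trans z≡ (≡.sym y≡)))
    ... | inj₂ y≡ | inj₂ z≡ | _        = ⊥-elim (z≢y (≡.trans z≡ (≡.sym y≡)))
    ... | inj₁ y≡ | _       | inj₁ z′≡ = ⊥-elim (z′≢y (≡.trans z′≡ (≡.sym y≡)))
    ... | inj₂ y≡ | _       | inj₂ z′≡ = ⊥-elim (z′≢y (≡.trans z′≡ (≡.sym y≡)))
    ... | inj₁ _  | inj₂ z≡ | inj₂ z′≡ = ≡.trans z≡ (≡.sym z′≡)
    ... | inj₂ _  | inj₁ z≡ | inj₁ z′≡ = ≡.trans z≡ (≡.sym z′≡)

    level-0 : ∀ x y → x ~ y → level x ≡ 0 → level y ≡ 0 →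
              (∀ {z z′} → x ~ z → x ~ z′ → z ≢ y → z′ ≢ y → z ≡ z′) ⊎
              (∀ {z} → x ~ z → z ≢ y → level z ≡ 1)
    level-0 (inj₁ a) (inj₁ b) a~b la lb = ⊥-elim (T.level-≢ a~b (≡.trans la (≡.sym lb)))
    level-0 (inj₂ m) y        m~y _ _   = inj₁ (ray-other m {y} m~y)
    level-0 (inj₁ a) (inj₂ n) (_ , ≡.refl) la _ = inj₂ λ {z} → children z
      where
      children : ∀ z → inj₁ a ~ z → z ≢ inj₂ 0 → level z ≡ 1
      children (inj₂ m) (_ , ≡.refl) z≢0 = ⊥-elim (z≢0 ≡.refl)
      children (inj₁ b) a~b _ with T.level-step a~b
      ... | inj₁ la≡ = ⊥-elim (ℕₚ.0≢1+n (≡.trans (≡.sym la) la≡))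
      ... | inj₂ lb≡ = ≡.trans lb≡ (≡.cong suc la)

    inner-complete : ∀ x z → x ~ z → 1 ℕ.≤ level z → x ∈ map inj₁ vertices
    inner-complete (inj₁ a) _        _            _  = ∈-map⁺ inj₁ (∈vertices a)
    inner-complete (inj₂ m) (inj₁ b) (≡.refl , _) 1≤ = ⊥-elim (ℕₚ.<-irrefl (≡.sym T.level-k) 1≤)

  layering : Layering H
  layering = record
    { level = level ; height = proj₁ height ; level≤height = level≤height
    ; level-~ = λ {x} {y} → level-~ x y
    ; parent-unique = λ {x} {y} {z} → parent-unique x y z
    ; level-0 = λ {x} {y} → level-0 x y
    ; inner = map inj₁ vertices
    ; inner-complete = λ {x} {z} → inner-complete x z }

  -- A tree vertex farthest from `k` has only its parent as neighbour; if the tree is the single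
  -- vertex `k`, its only neighbour is the start of the ray. A double ray has no such vertex, which
  -- separates the two cases of the theorem.
  leaf : ∃ λ x → ∀ {y z} → x ~ y → x ~ z → y ≡ z
  leaf with maximum-on T.level k vertices
  ... | a , max = inj₁ a , λ {y} {z} → only (T.level a) ≡.refl y z
    where
    not-higher : ∀ {b} → T.level b ≢ suc (T.level a)
    not-higher {b} lb = ℕₚ.<-irrefl ≡.refl (≡.subst (ℕ._≤ T.level a) lb (max (there (∈vertices b))))
    lower : ∀ {b} → Graph._~_ K a b → T.level a ≡ suc (T.level b)
    lower a~b with T.level-step a~b
    ... | inj₁ la = la
    ... | inj₂ lb = ⊥-elim (not-higher lb)
    only : ∀ n → T.level a ≡ n → ∀ y z → inj₁ a ~ y → inj₁ a ~ z → y ≡ z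
    only n       la (inj₂ _) (inj₂ _) (_ , ≡.refl) (_ , ≡.refl) = ≡.refl
    only zero    la (inj₁ b) _        a~b _ = ⊥-elim (ℕₚ.0≢1+n (≡.trans (≡.sym la) (lower a~b)))
    only zero    la (inj₂ _) (inj₁ c) _ a~c = ⊥-elim (ℕₚ.0≢1+n (≡.trans (≡.sym la) (lower a~c)))
    only (suc n) la (inj₁ b) (inj₁ c) a~b a~c = ≡.cong inj₁ (T.parent-unique la a~b a~c (pred-level a~b) (pred-level a~c))
      where
      pred-level : ∀ {b} → Graph._~_ K a b → T.level b ≡ n
      pred-level a~b = ℕₚ.suc-injective (≡.trans (≡.sym (lower a~b)) la)
    only (suc n) la (inj₂ _) (inj₁ c) (a≡k , _) _ = ⊥-elim (level-1+ la a≡k)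
    only (suc n) la (inj₁ b) (inj₂ _) _ (a≡k , _) = ⊥-elim (level-1+ la a≡k)

doubleRay-two-neighbours : ∀ i → ∃₂ λ j j′ → Graph._~_ doubleRay i j × Graph._~_ doubleRay i j′ × j ≢ j′
doubleRay-two-neighbours i = ℤ.suc i , ℤ.pred i , inj₁ ≡.refl , inj₂ (≡.sym (ℤₚ.suc-pred i)) ,
  λ e → ℤₚ.<-irrefl (≡.sym e) (ℤₚ.≤-<-trans (ℤₚ.i≤j⇒pred[i]≤j (ℤₚ.≤-refl {i})) (ℤₚ.suc[i]≤j⇒i<j ℤₚ.≤-refl))

module _ (em : ExcludedMiddle 0ℓ) (R : CompleteOrderedField) where

  not-both : ∀ {G} → IsDoubleRay G → ¬ IsFiniteTreeWithRay G
  not-both {G} iso (K , tree , k , iso′) =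
    let x , only = AttachRay.leaf em R K tree k
        v = from iso′ x
        j , j′ , i~j , i~j′ , j≢j′ = doubleRay-two-neighbours (to iso v)
    in j≢j′ (from-injective (only (neighbour {x} {j} i~j) (neighbour {x} {j′} i~j′)))
    where
    to : ∀ {H} → G ≅ H → Graph.V G → Graph.V H
    to iso = Inverse.to (_≅_.bijection iso)
    from : ∀ {H} → G ≅ H → Graph.V H → Graph.V G
    from iso = Inverse.from (_≅_.bijection iso)
    from-injective : ∀ {j j′} → to iso′ (from iso j) ≡ to iso′ (from iso j′) → j ≡ j′
    from-injective {j} {j′} e = ≡.trans (≡.sym (Inverse.strictlyInverseˡ (_≅_.bijection iso) j))
      (≡.trans (≡.cong (to iso) (≅-injective iso′ e))
        (Inverse.strictlyInverseˡ (_≅_.bijection iso) j′))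
    neighbour : ∀ {x j} → Graph._~_ doubleRay (to iso (from iso′ x)) j →
                Graph._~_ (attachRay K k) x (to iso′ (from iso j))
    neighbour {x} {j} i~j = ≡.subst (λ y → Graph._~_ (attachRay K k) y (to iso′ (from iso j)))
      (Inverse.strictlyInverseˡ (_≅_.bijection iso′) x)
      (Equivalence.to (_≅_.adjacent iso′ _ _) (Equivalence.from (_≅_.adjacent iso _ _)
        (≡.subst (Graph._~_ doubleRay (to iso (from iso′ x)))
          (≡.sym (Inverse.strictlyInverseˡ (_≅_.bijection iso) j)) i~j)))

-- From an admissible weight of finite distortion to the shape of the graph.

module Distortion (em : ExcludedMiddle 0ℓ) (R : CompleteOrderedField)
                     (G : Graph) (conn : Graph.Connected G) (lf : Graph.LocallyFinite G)
                     (inf : Graph.Infinite G)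
                     (girth : Graph.GirthAtLeast G 6) where
  open OrderedField R
  open Sums em R
  open Graph G
  open EdgeCurvature em R G conn lf girth
  open NonBacktracking em G
  open ShortCycles G
  open AddSupremumStrict _<_ using ([_]<⊤⁺)

  -- The default value of `inf` is zero, so a positive value can only come from an actual infimum.
  inf-lowerBound : ∀ {P} → 0# < C.inf P → LowerBound P (C.inf P)
  inf-lowerBound {P} 0<inf with em {P = ∃ (IsInf P)}
  ... | yes (_ , lb , _) = lb
  ... | no _ = ⊥-elim (<⇒≱ 0<inf ≤.refl)

  -- The infimum is obtained as the supremum of the lower bounds.
  inf-exists : ∀ P {l x} → LowerBound P l → P x → ∃ (IsInf P)
  inf-exists P {l} {x} lb Px =
    let s , ub , lub = complete (LowerBound P) (l , lb) (x , λ _ lb′ → lb′ x Px)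
    in s , (λ y Py → lub y λ _ lb′ → lb′ y Py) , ub

  EdgeValue : C.Weight G conn lf → Carrier → Set
  EdgeValue = C.EdgeValue G conn lf

  dist-finite⇔ : ∀ W → (∃ λ r → C.Dist G conn lf W ≡ [ r ]) ⇔
                 (∃ (UpperBound (EdgeValue W)) × 0# < C.inf (EdgeValue W))
  dist-finite⇔ W = mk⇔ to from
    where
    to : (∃ λ r → C.Dist G conn lf W ≡ [ r ]) → ∃ (UpperBound (EdgeValue W)) × 0# < C.inf (EdgeValue W)
    to (r , eq) with em {P = ∃ (UpperBound (EdgeValue W)) × 0# < C.inf (EdgeValue W)}
    ... | yes p = p
    to (r , ()) | no _
    from : ∃ (UpperBound (EdgeValue W)) × 0# < C.inf (EdgeValue W) → ∃ λ r → C.Dist G conn lf W ≡ [ r ]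
    from p with em {P = ∃ (UpperBound (EdgeValue W)) × 0# < C.inf (EdgeValue W)}
    ... | yes _ = _ , ≡.refl
    ... | no ¬p = ⊥-elim (¬p p)

  DN-finite⇔ : (C.DN-LLY G conn lf C.<⁺ ⊤⁺) ⇔ ∃ (C.FiniteDistortion G conn lf)
  DN-finite⇔ = mk⇔ to from
    where
    to : C.DN-LLY G conn lf C.<⁺ ⊤⁺ → ∃ (C.FiniteDistortion G conn lf)
    to lt with em {P = ∃ (C.FiniteDistortion G conn lf)}
    ... | yes p = p
    to () | no _
    from : ∃ (C.FiniteDistortion G conn lf) → C.DN-LLY G conn lf C.<⁺ ⊤⁺
    from p with em {P = ∃ (C.FiniteDistortion G conn lf)}
    ... | yes _ = [ _ ]<⊤⁺
    ... | no ¬p = ⊥-elim (¬p p)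

  module Bounded (W : C.Weight G conn lf) (adm : C.Admissible G conn lf W) {m M : Carrier} (0<m : 0# < m)
                 (m≤w : ∀ {x y} → x ~ y → m ≤ C.Weight.w W x y)
                 (w≤M : ∀ {x y} → x ~ y → C.Weight.w W x y ≤ M) where
    open C.Weight W

    -- Nonnegative curvature at `y z`, with the weight of selected neighbours behind `y` and of a
    -- single neighbour `t` beyond `z`. One neighbour in the list gives log-concavity, two give the
    -- gain at a branching.
    concave : ∀ {xs y z t} → Unique (z ∷ xs) → (∀ {u} → u ∈ xs → y ~ u) → y ~ z → z ~ t → t ≢ y →
              ∑ xs (w y) * w z t ≤ w y z * w y z
    concave {xs} {y} {z} {t} uzxs y~xs y~z z~t t≢y = curvature-≥0⇒ W y~z
      (Equivalence.from (admissible⇔ W) adm y z y~z)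
      (∑-nonneg xs (<⇒≤ ∘ positive ∘ y~xs)) (<⇒≤ (positive z~t))
      (∑-⊆ uzxs (λ { (here ≡.refl) → ~⇒∈N y~z ; (there u∈xs) → ~⇒∈N (y~xs u∈xs) })
         (<⇒≤ ∘ positive ∘ ∈N⇒~))
      (begin
        w y z + w z t             ≈⟨ +-cong (w-sym y~z) (≈-sym (+-identityʳ _)) ⟩
        ∑ (y ∷ t ∷ []) (w z)      ≤⟨ ∑-⊆ (((t≢y ∘ ≡.sym) ∷ []) ∷ [] ∷ [])
                                       (λ { (here ≡.refl) → ~⇒∈N (~-sym y~z) ; (there (here ≡.refl)) → ~⇒∈N z~t })
                                       (<⇒≤ ∘ positive ∘ ∈N⇒~) ⟩
        d W z                     ∎)
      where open ≤-Reasoning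

    concave₁ : ∀ {x y z t} → x ~ y → y ~ z → z ~ t → z ≢ x → t ≢ y → w x y * w z t ≤ w y z * w y z
    concave₁ {x} {y} {z} {t} x~y y~z z~t z≢x t≢y = ≤-respˡ
      (*-congʳ (≈-trans (+-identityʳ _) (w-sym (~-sym x~y))))
      (concave ((z≢x ∷ []) ∷ [] ∷ []) (λ { (here ≡.refl) → ~-sym x~y }) y~z z~t t≢y)

    live-monotone : ∀ {x y z} → x ~ y → y ~ z → z ≢ x → Live y z → w x y ≤ w y z
    live-monotone {x} x~y y~z z≢x live = logConcave-step em t 0<m (m≤w ∘ adj)
      (λ n → concave₁ (adj n) (adj (suc n)) (adj (suc (suc n))) (nb n) (nb (suc n)))
      where
      e : LiveEdge
      e = record { edge = y~z ; live = live }
      v : ℕ → V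
      v zero    = x
      v (suc n) = walk e n
      adj : ∀ n → v n ~ v (suc n)
      adj zero    = x~y
      adj (suc n) = walk-~ e n
      nb : ∀ n → v (suc (suc n)) ≢ v n
      nb zero    = z≢x
      nb (suc n) = walk-≢ e n
      t : ℕ → Carrier
      t n = w (v n) (v (suc n))

    -- The third neighbour `u` adds at least `m` to the weight behind the edge `y z`, while the next
    -- edge of a live walk weighs at least `w y z`; that factor is then cancelled.
    live-branching : ∀ {x y z u} → x ~ y → y ~ z → y ~ u → z ≢ x → u ≢ x → u ≢ z → Live y z →
                     w x y + m ≤ w y z
    live-branching {x} {y} {z} {u} x~y y~z y~u z≢x u≢x u≢z live =
      let t , z~t , t≢y , live′ = live-next live in
      *-cancelʳ-≤ (positive y~z) (begin
        (w x y + m) * w y z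
          ≤⟨ *-mono-≤ (0≤+ (<⇒≤ (positive x~y)) (<⇒≤ 0<m)) (<⇒≤ (positive z~t))
               (+-mono-≤ (≤.reflexive (w-sym x~y)) (≤-respʳ (≈-sym (+-identityʳ _)) (m≤w y~u)))
               (live-monotone y~z z~t t≢y live′) ⟩
        ∑ (x ∷ u ∷ []) (w y) * w z t
          ≤⟨ concave ((z≢x ∷ (u≢z ∘ ≡.sym) ∷ []) ∷ ((u≢x ∘ ≡.sym) ∷ []) ∷ [] ∷ [])
               (λ { (here ≡.refl) → ~-sym x~y ; (there (here ≡.refl)) → y~u }) y~z z~t t≢y ⟩
        w y z * w y z ∎)
      where open ≤-Reasoning

    m≰0 : ∀ {a} → ¬ a + m ≤ a
    m≰0 {a} = <⇒≱ (<-by m 0<m ≈-refl)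

    -- If `y` branched, the weight would gain `m` on passing from `x y` to a live continuation
    -- `y z`, whereas liveness in the other direction makes `w x y` at least `w y z`. Of `a` and
    -- `b`, one differs from `z` and serves as the third neighbour.
    bilive-unique : ∀ {x y a b} → BiLive x y → y ~ a → y ~ b → a ≢ x → b ≢ x → a ≡ b
    bilive-unique {x} {y} {a} {b} (x~y , x→y , y→x) y~a y~b a≢x b≢x with em {P = a ≡ b}
    ... | yes a≡b = a≡b
    ... | no a≢b  = let z , y~z , z≢x , live = live-next x→y in ⊥-elim (contra y~z z≢x live)
      where
      branch : ∀ {z u} → y ~ z → z ≢ x → Live y z → y ~ u → u ≢ x → u ≢ z → ⊥
      branch {z} y~z z≢x live y~u u≢x u≢z = m≰0 (begin
        w x y + m ≤⟨ live-branching x~y y~z y~u z≢x u≢x u≢z live ⟩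
        w y z     ≈⟨ w-sym y~z ⟩
        w z y     ≤⟨ live-monotone (~-sym y~z) (~-sym x~y) (z≢x ∘ ≡.sym) y→x ⟩
        w y x     ≈⟨ w-sym (~-sym x~y) ⟩
        w x y     ∎)
        where open ≤-Reasoning
      contra : ∀ {z} → y ~ z → z ≢ x → Live y z → ⊥
      contra {z} y~z z≢x live with em {P = a ≡ z}
      ... | no a≢z     = branch y~z z≢x live y~a a≢x a≢z
      ... | yes ≡.refl = branch y~z z≢x live y~b b≢x (a≢b ∘ ≡.sym)

    module Two-sided {x y} (bilive : BiLive x y) where

      private
        x~y = proj₁ bilive

        e e′ : LiveEdge
        e  = record { edge = x~y ; live = proj₁ (proj₂ bilive) }
        e′ = record { edge = ~-sym x~y ; live = proj₂ (proj₂ bilive) }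

        -- Walked backwards, the path returns to its first edge, whose reverse is live by
        -- assumption, and prepending steps preserves liveness.
        live-back : ∀ (e : LiveEdge) → Live (walk e 1) (walk e 0) → ∀ n → Live (walk e (suc n)) (walk e n)
        live-back e live zero    = live
        live-back e live (suc n) =
          live-prepend (~-sym (walk-~ e n)) (walk-≢ e n ∘ ≡.sym) (live-back e live n)

      line : ℤ.ℤ → V
      line (ℤ.+ n)    = walk e n
      -- The walk `e′` begins with `y` and `x`, which have the indices 1 and 0 on the line, so its
      -- entries from 2 on fill the negative indices.
      line ℤ.-[1+ n ] = walk e′ (suc (suc n))

      line-bilive : ∀ i → BiLive (line i) (line (ℤ.suc i))
      line-bilive (ℤ.+ n) = walk-~ e n , walk-live e n , live-back e (LiveEdge.live e′) n
      line-bilive ℤ.-[1+ zero ] =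
        ~-sym (walk-~ e′ 1) , live-back e′ (LiveEdge.live e) 1 , walk-live e′ 1
      line-bilive ℤ.-[1+ suc n ] =
        ~-sym (walk-~ e′ (suc (suc n))) , live-back e′ (LiveEdge.live e) (suc (suc n)) , walk-live e′ (suc (suc n))

      line-~ : ∀ i → line i ~ line (ℤ.suc i)
      line-~ i = proj₁ (line-bilive i)

      line-≢ : ∀ i → line (ℤ.suc (ℤ.suc i)) ≢ line i
      line-≢ (ℤ.+ n)                = walk-≢ e n
      line-≢ ℤ.-[1+ zero ]          = walk-≢ e′ 0 ∘ ≡.sym
      line-≢ ℤ.-[1+ suc zero ]      = walk-≢ e′ 1 ∘ ≡.sym
      line-≢ ℤ.-[1+ suc (suc n) ]   = walk-≢ e′ (suc (suc n)) ∘ ≡.sym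

      line-neighbour : ∀ i {u} → line (ℤ.suc i) ~ u → u ≡ line i ⊎ u ≡ line (ℤ.suc (ℤ.suc i))
      line-neighbour i {u} ~u with em {P = u ≡ line i}
      ... | yes u≡ = inj₁ u≡
      ... | no u≢  = inj₂ (bilive-unique (line-bilive i) ~u (line-~ (ℤ.suc i)) u≢ (line-≢ i))

      line-neighbour′ : ∀ i {u} → line i ~ u → u ≡ line (ℤ.pred i) ⊎ u ≡ line (ℤ.suc i)
      line-neighbour′ i ~u = ≡.subst (λ j → _ ≡ line (ℤ.pred i) ⊎ _ ≡ line (ℤ.suc j)) (ℤₚ.suc-pred i)
        (line-neighbour (ℤ.pred i) (≡.subst (λ j → line j ~ _) (≡.sym (ℤₚ.suc-pred i)) ~u))

      line-surjective : ∀ v → ∃ λ i → line i ≡ v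
      line-surjective = closed⇒everything {G} conn {λ v → ∃ λ i → line i ≡ v} (ℤ.+ 0 , ≡.refl) closed
        where
        closed : ∀ u v → u ~ v → (∃ λ i → line i ≡ u) → ∃ λ i → line i ≡ v
        closed u v u~v (i , ≡.refl) with line-neighbour′ i u~v
        ... | inj₁ v≡ = ℤ.pred i , ≡.sym v≡
        ... | inj₂ v≡ = ℤ.suc i , ≡.sym v≡

      degree≤2 : ∀ {y a b c} → y ~ a → y ~ b → y ~ c → a ≢ b → c ≡ a ⊎ c ≡ b
      degree≤2 {y} y~a y~b y~c a≢b with line-surjective y
      ... | i , ≡.refl with line-neighbour′ i y~a | line-neighbour′ i y~b | line-neighbour′ i y~c
      ...   | inj₁ ≡.refl | inj₁ ≡.refl | _           = ⊥-elim (a≢b ≡.refl)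
      ...   | inj₂ ≡.refl | inj₂ ≡.refl | _           = ⊥-elim (a≢b ≡.refl)
      ...   | inj₁ ≡.refl | inj₂ ≡.refl | c≡          = c≡
      ...   | inj₂ ≡.refl | inj₁ ≡.refl | inj₁ c≡     = inj₂ c≡
      ...   | inj₂ ≡.refl | inj₁ ≡.refl | inj₂ c≡     = inj₁ c≡

      line-≢+ : ∀ i d → line (ℤ.+ suc d ℤ.+ i) ≢ line i
      line-≢+ i d eq = inf (Core.finite core conn degree≤2)
        where
        v : ℕ → V
        v n = line (ℤ.+ n ℤ.+ i)
        suc-v : ∀ n → line (ℤ.suc (ℤ.+ n ℤ.+ i)) ≡ v (suc n)
        suc-v n = ≡.cong line (≡.sym (ℤₚ.suc-+ n i))
        core : Core
        core = repetition⇒core v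
          (λ n → ≡.subst (v n ~_) (suc-v n) (line-~ (ℤ.+ n ℤ.+ i)))
          (λ n e → line-≢ (ℤ.+ n ℤ.+ i) (≡.trans (≡.cong (λ j → line (ℤ.suc j)) (≡.sym (ℤₚ.suc-+ n i)))
            (≡.trans (suc-v (suc n)) e)))
          d 0 (≡.trans (≡.cong (λ k → line (ℤ.+ suc k ℤ.+ i)) (ℕₚ.+-identityʳ d))
            (≡.trans eq (≡.cong line (≡.sym (ℤₚ.+-identityˡ i)))))

      line-injective : ∀ {i j} → line i ≡ line j → i ≡ j
      line-injective {i} {j} eq = go (j ℤ.- i) difference
        where
        difference : (j ℤ.- i) ℤ.+ i ≡ j
        difference = ≡.trans (ℤₚ.+-assoc j (ℤ.- i) i)
          (≡.trans (≡.cong (λ k → j ℤ.+ k) (ℤₚ.+-inverseˡ i)) (ℤₚ.+-identityʳ j))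
        go : ∀ k → k ℤ.+ i ≡ j → i ≡ j
        go (ℤ.+ zero)    k+i≡j = ≡.trans (≡.sym (ℤₚ.+-identityˡ i)) k+i≡j
        go (ℤ.+ suc d)   k+i≡j = ⊥-elim (line-≢+ i d (≡.trans (≡.cong line k+i≡j) (≡.sym eq)))
        go ℤ.-[1+ d ]    k+i≡j = ⊥-elim (line-≢+ j d (≡.trans (≡.cong line (≡.trans
          (≡.cong (λ k → ℤ.+ suc d ℤ.+ k) (≡.sym k+i≡j))
          (≡.trans (≡.sym (ℤₚ.+-assoc (ℤ.+ suc d) ℤ.-[1+ d ] i))
            (≡.trans (≡.cong (λ k → k ℤ.+ i) (ℤₚ.+-inverseʳ (ℤ.+ suc d))) (ℤₚ.+-identityˡ i))))) eq))

      isDoubleRay : IsDoubleRay G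
      isDoubleRay = ≅-from line line-injective line-surjective
        (λ { {i} (inj₁ ≡.refl) → line-~ i ; {_} {j} (inj₂ ≡.refl) → ~-sym (line-~ j) })
        (λ {i} {j} i~j → reflect i j (line-neighbour′ i i~j))
        where
        reflect : ∀ i j → line j ≡ line (ℤ.pred i) ⊎ line j ≡ line (ℤ.suc i) → j ≡ ℤ.suc i ⊎ i ≡ ℤ.suc j
        reflect i j (inj₁ e) = inj₂ (≡.trans (≡.sym (ℤₚ.suc-pred i)) (≡.cong ℤ.suc (≡.sym (line-injective {j} {ℤ.pred i} e))))
        reflect i j (inj₂ e) = inj₁ (line-injective {j} {ℤ.suc i} e)

    module One-sided (none : ¬ ∃₂ BiLive) (e : LiveEdge) (N₀ : ℕ)
      (tail : ∀ i → w (walk e i) (walk e (suc i)) < w (walk e N₀) (walk e (suc N₀)) + m) where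

      private
        t : ℕ → Carrier
        t n = w (walk e n) (walk e (suc n))

        v : ℕ → V
        v n = walk e (n ℕ.+ N₀)

        v-~ : ∀ n → v n ~ v (suc n)
        v-~ n = walk-~ e (n ℕ.+ N₀)

        t-monotone : ∀ n → t N₀ ≤ t (n ℕ.+ N₀)
        t-monotone zero    = ≤.refl
        t-monotone (suc n) = ≤.trans (t-monotone n)
          (live-monotone (v-~ n) (v-~ (suc n)) (walk-≢ e (n ℕ.+ N₀)) (walk-live e (suc n ℕ.+ N₀)))

        -- A third neighbour would raise the weight by `m` above a value that is already at least
        -- the one at `N₀`, contradicting `tail`.
        v-neighbour : ∀ n {u} → v (suc n) ~ u → u ≡ v n ⊎ u ≡ v (suc (suc n))
        v-neighbour n {u} ~u with em {P = u ≡ v n} | em {P = u ≡ v (suc (suc n))}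
        ... | yes u≡ | _      = inj₁ u≡
        ... | no _   | yes u≡ = inj₂ u≡
        ... | no u≢  | no u≢′ = ⊥-elim (<⇒≱ (tail (suc n ℕ.+ N₀)) (≤.trans
                (+-monoˡ-≤ m (t-monotone n))
                (live-branching (v-~ n) (v-~ (suc n)) ~u (walk-≢ e (n ℕ.+ N₀)) u≢ u≢′ (walk-live e (suc n ℕ.+ N₀)))))

      isFiniteTreeWithRay : IsFiniteTreeWithRay G
      isFiniteTreeWithRay = RayEnd.isFiniteTreeWithRay conn lf none v v-~
        (λ n → walk-≢ e (n ℕ.+ N₀)) (walk-live e N₀) v-neighbour

  finiteDistortion⇒ : ∃ (C.FiniteDistortion G conn lf) → ExactlyOne (IsDoubleRay G) (IsFiniteTreeWithRay G)
  finiteDistortion⇒ (r , W , adm , eq) = go (em {P = ∃₂ BiLive})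
    where
    bounds : ∃ (UpperBound (EdgeValue W)) × 0# < C.inf (EdgeValue W)
    bounds = Equivalence.to (dist-finite⇔ W) (r , eq)

    open Bounded W adm (proj₂ bounds)
      (λ x~y → inf-lowerBound (proj₂ bounds) _ (_ , _ , x~y , ≈-refl))
      (λ x~y → proj₂ (proj₁ bounds) _ (_ , _ , x~y , ≈-refl))

    go : Dec (∃₂ BiLive) → ExactlyOne (IsDoubleRay G) (IsFiniteTreeWithRay G)
    go (yes (_ , _ , bilive)) = inj₁ (Two-sided.isDoubleRay bilive , not-both em R (Two-sided.isDoubleRay bilive))
    go (no none) = inj₂ ((λ double → not-both em R double tree) , tree)
      where
      open C.Weight W
      e : LiveEdge
      e = liveEdge-exists lf conn inf
      tail : ∃ λ N → ∀ i → w (walk e i) (walk e (suc i)) < w (walk e N) (walk e (suc N)) + _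
      tail = near-sup em (λ n → w (walk e n) (walk e (suc n)))
               (λ n → proj₂ (proj₁ bounds) _ (_ , _ , walk-~ e n , ≈-refl)) (proj₂ bounds)
      tree : IsFiniteTreeWithRay G
      tree = One-sided.isFiniteTreeWithRay none e (proj₁ tail) (proj₂ tail)

  -- An admissible weight of finite distortion from a layering.

  module LayeredWeight (L : Layering G) where
    open Layering L

    degreeBound : ∃ λ D → ∀ {x} → x ∈ inner → length (N x) ℕ.≤ D
    degreeBound = bounded-on (length ∘ N) inner

    -- The degree bound concerns the finitely many vertices with a neighbour of positive level;
    -- adding 1 makes `D` at least 1 even if there are none. The choice of `ε` compensates two
    -- factors `D`, one for each end of an edge.
    D ε : Carrier
    D = suc (proj₁ degreeBound) · 1#
    ε = (D * D) ⁻¹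

    1≤D : 1# ≤ D
    1≤D = ≤-by _ (0≤· (proj₁ degreeBound) 0≤1) ≈-refl

    0<D : 0# < D
    0<D = <-≤-trans 0<1 1≤D

    0≤D : 0# ≤ D
    0≤D = <⇒≤ 0<D

    0<DD : 0# < D * D
    0<DD = 0<* 0<D 0<D

    0<ε : 0# < ε
    0<ε = 0<⁻¹ 0<DD

    DDε : D * D * ε ≈ 1#
    DDε = *-inverse 0<DD

    Dε≤1 : D * ε ≤ 1#
    Dε≤1 = begin
      D * ε             ≈⟨ *-congʳ (*-identityˡ D) ⟨
      1# * D * ε        ≤⟨ *-mono-≤ (*-nonneg 0≤1 0≤D) (<⇒≤ 0<ε) (*-mono-≤ 0≤1 0≤D 1≤D ≤.refl) ≤.refl ⟩
      D * D * ε         ≈⟨ DDε ⟩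
      1#                ∎
      where open ≤-Reasoning

    ε≤1 : ε ≤ 1#
    ε≤1 = begin
      ε       ≈⟨ *-identityˡ ε ⟨
      1# * ε  ≤⟨ *-mono-≤ 0≤1 (<⇒≤ 0<ε) 1≤D ≤.refl ⟩
      D * ε   ≤⟨ Dε≤1 ⟩
      1#      ∎
      where open ≤-Reasoning

    u : ℕ → Carrier
    u zero    = 1#
    u (suc n) = ε * (u n * u n)

    0<u : ∀ n → 0# < u n
    0<u zero    = 0<1
    0<u (suc n) = 0<* 0<ε (0<* (0<u n) (0<u n))

    0≤u : ∀ n → 0# ≤ u n
    0≤u n = <⇒≤ (0<u n)

    u-1 : u 1 ≈ ε
    u-1 = ≈-trans (*-congˡ (*-identityʳ 1#)) (*-identityʳ ε)

    u≤1 : ∀ n → u n ≤ 1#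
    u-decreasing : ∀ n → u (suc n) ≤ u n

    u≤1 zero    = ≤.refl
    u≤1 (suc n) = ≤.trans (u-decreasing n) (u≤1 n)

    u-decreasing n = begin
      ε * (u n * u n)     ≤⟨ *-mono-≤ (<⇒≤ 0<ε) (*-nonneg 0≤1 (0≤u n)) ε≤1 (*-mono-≤ (0≤u n) (0≤u n) (u≤1 n) ≤.refl) ⟩
      1# * (1# * u n)     ≈⟨ ≈-trans (*-identityˡ _) (*-identityˡ _) ⟩
      u n                 ∎
      where open ≤-Reasoning

    u-antitone : ∀ {m n} → m ℕ.≤ n → u n ≤ u m
    u-antitone {m} {n} m≤n with ℕₚ.m≤n⇒m<n∨m≡n m≤n
    ... | inj₂ ≡.refl = ≤.refl
    u-antitone {m} {suc n} _ | inj₁ (s≤s m≤n) = ≤.trans (u-decreasing n) (u-antitone m≤n)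

    weight : C.Weight G conn lf
    weight = record
      { w        = λ x y → u (level x ℕ.⊔ level y)
      ; w-sym    = λ {x} {y} _ → reflexive (≡.cong u (ℕₚ.⊔-comm (level x) (level y)))
      ; positive = λ {x} {y} _ → 0<u (level x ℕ.⊔ level y) }

    open C.Weight weight

    w-≡ : ∀ {x y n} → level x ℕ.⊔ level y ≡ n → w x y ≈ u n
    w-≡ = reflexive ∘ ≡.cong u

    w≤1 : ∀ x y → w x y ≤ 1#
    w≤1 x y = u≤1 (level x ℕ.⊔ level y)

    others : V → V → Carrier
    others x y = d weight x - w x y

    module _ {x y : V} (x~y : x ~ y) where

      private
        rest : List V
        rest = proj₁ (extract (~⇒∈N x~y))

        perm : N x ↭ y ∷ rest
        perm = proj₂ (extract (~⇒∈N x~y))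

        unique : Unique (y ∷ rest)
        unique = Unique-resp-↭ perm (N-unique x)

        rest⇒~ : ∀ {z} → z ∈ rest → x ~ z
        rest⇒~ z∈ = ∈N⇒~ (∈-resp-↭ (↭.↭-sym perm) (there z∈))

        others-≈ : others x y ≈ ∑ rest (w x)
        others-≈ = ≈-trans (+-congʳ (∑-↭ (w x) perm))
          (solve 2 (λ a b → a :+ b :- a := b) ≈-refl (w x y) (∑ rest (w x)))

      0≤others : 0# ≤ others x y
      0≤others = ≤-respʳ (≈-sym others-≈) (∑-nonneg rest λ {z} _ → 0≤u (level x ℕ.⊔ level z))

      others-≤1 : (∀ {z z′} → x ~ z → x ~ z′ → z ≢ y → z′ ≢ y → z ≡ z′) → others x y ≤ 1#
      others-≤1 single = ≤-respˡ (≈-sym others-≈) (go rest unique rest⇒~)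
        where
        go : ∀ zs → Unique (y ∷ zs) → (∀ {z} → z ∈ zs → x ~ z) → ∑ zs (w x) ≤ 1#
        go []            _  _  = 0≤1
        go (z ∷ [])      _  _  = ≤-respˡ (≈-sym (+-identityʳ _)) (w≤1 x z)
        go (z ∷ z′ ∷ zs) uy zs~ = ⊥-elim (Unique-head (Unique-tail uy) (here ≡.refl)
          (single (zs~ (there (here ≡.refl))) (zs~ (here ≡.refl))
            (Unique-head uy (there (here ≡.refl))) (Unique-head uy (here ≡.refl))))

      others-≤ : ∀ {c} → 0# ≤ c → (∀ {z} → x ~ z → z ≢ y → w x z ≤ c × x ∈ inner) → others x y ≤ D * c
      others-≤ {c} 0≤c bound = begin
        others x y                              ≈⟨ others-≈ ⟩
        ∑ rest (w x)                            ≤⟨ ∑-≤-length rest (λ z∈ → proj₁ (bound (rest⇒~ z∈) (Unique-head unique z∈))) ⟩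
        length rest · c                         ≤⟨ ·-monoˡ (length≤ rest perm (λ z∈ → proj₂ (bound (rest⇒~ z∈) (Unique-head unique z∈)))) 0≤c ⟩
        suc (proj₁ degreeBound) · c             ≈⟨ ·1* (suc (proj₁ degreeBound)) c ⟩
        D * c                                   ∎
        where
        open ≤-Reasoning
        -- That `x` lies in `inner` is known only through a neighbour other than `y`; if there is
        -- none, the list is empty.
        length≤ : ∀ zs → N x ↭ y ∷ zs → (∀ {z} → z ∈ zs → x ∈ inner) → length zs ℕ.≤ suc (proj₁ degreeBound)
        length≤ []       _  _       = z≤n
        length≤ (z ∷ zs) pm x∈inner = ℕₚ.≤-trans (ℕₚ.n≤1+n _) (ℕₚ.≤-trans (ℕₚ.≤-reflexive (≡.sym (↭-length pm)))
          (ℕₚ.≤-trans (proj₂ degreeBound (x∈inner (here ≡.refl))) (ℕₚ.n≤1+n _)))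

    Concave : V → V → Set
    Concave x y = others x y * others y x ≤ w x y * w x y

    -- On a ray there is at most one further edge, of weight at most 1. Where the tree is attached,
    -- the further edges lead to level 1 and weigh `ε` each, and `D * ε` is at most 1.
    others-0 : ∀ {x y} → x ~ y → level x ≡ 0 → level y ≡ 0 → others x y ≤ 1#
    others-0 {x} {y} x~y lx ly with level-0 x~y lx ly
    ... | inj₁ single = others-≤1 x~y single
    ... | inj₂ higher = begin
      others x y  ≤⟨ others-≤ x~y (0≤u 1) (λ x~z z≢y →
                       ≤.reflexive (w-≡ (≡.cong₂ ℕ._⊔_ lx (higher x~z z≢y))) ,
                       inner-complete x~z (ℕₚ.≤-reflexive (≡.sym (higher x~z z≢y)))) ⟩
      D * u 1     ≈⟨ *-congˡ u-1 ⟩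
      D * ε       ≤⟨ Dε≤1 ⟩
      1#          ∎
      where open ≤-Reasoning

    concave-0 : ∀ {x y} → x ~ y → level x ≡ 0 → level y ≡ 0 → Concave x y
    concave-0 {x} {y} x~y lx ly = begin
      others x y * others y x ≤⟨ *-mono-≤ (0≤others x~y) 0≤1 (others-0 x~y lx ly) (others-0 (~-sym x~y) ly lx) ⟩
      1# * 1#                 ≈⟨ *-cong w≈1 w≈1 ⟨
      w x y * w x y           ∎
      where
      open ≤-Reasoning
      w≈1 : w x y ≈ 1#
      w≈1 = w-≡ {x} {y} (≡.cong₂ ℕ._⊔_ lx ly)

    -- At the deeper end `x` the other edges weigh `u (n + 2)` each; at `y` the crude bound 1 per
    -- edge suffices. The product is at most `D * D * u (n + 2)`, and the recursion for `u` makes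
    -- this the square of `u (n + 1)`, the weight of the edge.
    concave-up : ∀ {x y} → x ~ y → level x ≡ suc (level y) → Concave x y
    concave-up {x} {y} x~y lx = begin
      others x y * others y x
        ≤⟨ *-mono-≤ (0≤others x~y) (*-nonneg 0≤D 0≤1)
             (others-≤ x~y (0≤u (suc (suc n))) λ x~z z≢y → child x~z z≢y)
             (others-≤ (~-sym x~y) 0≤1 λ {z} _ _ → w≤1 y z , inner-complete (~-sym x~y) (≡.subst (1 ℕ.≤_) (≡.sym lx) (s≤s z≤n))) ⟩
      D * (ε * (u (suc n) * u (suc n))) * (D * 1#)
        ≈⟨ solve 3 (λ D ε s → D :* (ε :* s) :* (D :* :1) := D :* D :* ε :* s) ≈-refl D ε (u (suc n) * u (suc n)) ⟩
      D * D * ε * (u (suc n) * u (suc n))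
        ≈⟨ ≈-trans (*-congʳ DDε) (*-identityˡ _) ⟩
      u (suc n) * u (suc n)
        ≈⟨ *-cong w≈ w≈ ⟨
      w x y * w x y ∎
      where
      open ≤-Reasoning
      n : ℕ
      n = level y
      w≈ : w x y ≈ u (suc n)
      w≈ = w-≡ {x} {y} (≡.trans (≡.cong (ℕ._⊔ n) lx) (ℕₚ.m≥n⇒m⊔n≡m (ℕₚ.n≤1+n n)))
      level-child : ∀ {z} → x ~ z → z ≢ y → level z ≡ suc (level x)
      level-child x~z z≢y with level-~ x~z
      ... | inj₁ (lx≡0 , _) = ⊥-elim (ℕₚ.0≢1+n (≡.trans (≡.sym lx≡0) lx))
      ... | inj₂ (inj₂ lz)  = lz
      ... | inj₂ (inj₁ lx′) = ⊥-elim (z≢y (parent-unique lx x~z x~y (ℕₚ.suc-injective (≡.trans (≡.sym lx′) lx)) ≡.refl))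
      child : ∀ {z} → x ~ z → z ≢ y → w x z ≤ u (suc (suc n)) × x ∈ inner
      child {z} x~z z≢y = let lz = level-child x~z z≢y in
        ≤.reflexive (w-≡ {x} {z} (≡.trans (≡.cong (level x ℕ.⊔_) lz)
          (≡.trans (ℕₚ.m≤n⇒m⊔n≡n (ℕₚ.n≤1+n (level x))) (≡.cong suc lx)))) ,
        inner-complete x~z (≡.subst (1 ℕ.≤_) (≡.sym lz) (s≤s z≤n))

    concave-everywhere : ∀ {x y} → x ~ y → Concave x y
    concave-everywhere {x} {y} x~y with level-~ x~y
    ... | inj₁ (lx , ly)  = concave-0 x~y lx ly
    ... | inj₂ (inj₁ lx)  = concave-up x~y lx
    ... | inj₂ (inj₂ ly)  = begin
      others x y * others y x  ≈⟨ *-comm _ _ ⟩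
      others y x * others x y  ≤⟨ concave-up (~-sym x~y) ly ⟩
      w y x * w y x            ≈⟨ *-cong (w-sym (~-sym x~y)) (w-sym (~-sym x~y)) ⟩
      w x y * w x y            ∎
      where open ≤-Reasoning

    admissible : C.Admissible G conn lf weight
    admissible = Equivalence.to (admissible⇔ weight) λ x y x~y → ⇒curvature-≥0 weight x~y (begin
      (d weight x - w x y) * (d weight y - w x y)
        ≈⟨ *-congˡ (+-congˡ (-‿cong (w-sym x~y))) ⟩
      others x y * others y x
        ≤⟨ concave-everywhere x~y ⟩
      w x y * w x y ∎)
      where open ≤-Reasoning

    finiteDistortion : ∃ (C.FiniteDistortion G conn lf)
    finiteDistortion =
      let s , isInf = inf-exists (EdgeValue weight) lower (_ , _ , LiveEdge.edge e , ≈-refl)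
          0<inf = <-respʳ (≈-sym (inf-≈ isInf)) (<-≤-trans (0<u height) (proj₂ isInf _ lower))
          r , eq = Equivalence.from (dist-finite⇔ weight) ((1# , upper) , 0<inf)
      in r , weight , admissible , eq
      where
      -- Any edge would serve: the infimum of the edge values exists only if there is one.
      e : LiveEdge
      e = liveEdge-exists lf conn inf
      lower : LowerBound (EdgeValue weight) (u height)
      lower r (x , y , _ , w≈r) = ≤-respʳ w≈r (u-antitone (ℕₚ.⊔-lub (level≤height x) (level≤height y)))
      upper : UpperBound (EdgeValue weight) 1#
      upper r (x , y , _ , w≈r) = ≤-respˡ w≈r (w≤1 x y)

corollary6p7 : (em : ExcludedMiddle 0ℓ) (R : CompleteOrderedField) →
    let open Curvature em R in
    (G : Graph) → (conn : Graph.Connected G) → (lf : Graph.LocallyFinite G) →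
    Graph.Infinite G → Graph.GirthAtLeast G 6 →
    (DN-LLY G conn lf <⁺ ⊤⁺) ⇔ ExactlyOne (IsDoubleRay G) (IsFiniteTreeWithRay G)
corollary6p7 em R G conn lf inf girth = mk⇔
  (finiteDistortion⇒ ∘ Equivalence.to DN-finite⇔)
  (Equivalence.from DN-finite⇔ ∘ LayeredWeight.finiteDistortion ∘ layering)
  where
  open Distortion em R G conn lf inf girth
  layering : ExactlyOne (IsDoubleRay G) (IsFiniteTreeWithRay G) → Layering G
  layering (inj₁ (iso , _))                  = transport iso doubleRay-layering
  layering (inj₂ (_ , K , tree , k , iso))   = transport iso (AttachRay.layering em R K tree k)
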